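{- For all $n$ and all $p = p_n$ such that $p\binom{n}{2}$ is a non-negative integer and $n^{ -2/3} < p_n < 1 - n^{ -1/7}$, \[ f(n,p) \geq \frac{1}{4}(1-p)^{2/3} n^{2/3} - 1. \] Moreover, for each fixed real $c \geq 1$ and each fixed positive integer $r$, if $p = \frac{r}{r+1} + c n^{ -2/3}$, then $f(n,p) = \Theta(n^{2/3})$; that is, there are constants $C_1, C_2 > 0$ and $n_0$ (depending only on $r$ and $c$) such that $C_1 n^{2/3} \leq f(n,p) \leq C_2 n^{2/3}$ for every $n \geq n_0$ for which $p\binom{n}{2}$, with this value of $p$, is an integer.
   Context: Graphs are finite and simple. The density of a graph $G$ on $n \geq 2$ vertices is $p = |E(G)|/\binom{n}{2}$. A full subgraph of a graph $G$ of density $p$ is an $m$-vertex subgraph $H$ of $G$ (with $m \geq 1$) of minimum degree at least $p(m-1)$. $f(G)$ denotes the largest number of vertices in a full subgraph of $G$. If $p\binom{n}{2}$ is a non-negative integer (and $0 \le p \le 1$), define \[ f(n,p) = \min\{ f(G) : |V(G)| = n,\ |E(G)| = p\tbinom{n}{2} \}. \] -}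

module Defs where

open import Data.Bool.Base using (if_then_else_)
open import Data.Fin.Base using (Fin)
import Data.Fin.Properties as Fin
open import Data.Fin.Subset using (Subset; _∈_; _∉_; ∣_∣)
open import Data.Fin.Subset.Properties using (_∈?_)
open import Data.Integer.Base as ℤ using (ℤ; +_; -[1+_])
import Data.Integer.Properties as ℤ
open import Data.List.Base using (List; allFin; cartesianProduct; filter; length)
open import Data.Nat.Base as ℕ using (ℕ; zero; suc; NonTrivial)
open import Data.Nat.Combinatorics using (_C_; nC1≡n; nCk+nC[k+1]≡[n+1]C[k+1])
import Data.Nat.Properties as ℕ
open import Data.Product.Base using (_×_; _,_; ∃-syntax)
open import Data.Rational.Base as ℚ
  using (ℚ; 0ℚ; 1ℚ; ½; _+_; _*_; _-_; -_; 1/_; _/_; _≤_; _<_; _⊔_; ↥_; ↧ₙ_)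
open import Data.Rational.Properties as ℚ using (_≤?_; _≟_)
open import Data.Rational.Solver using (module +-*-Solver)
open import Data.Rational.Unnormalised.Base as ℚᵘ using (*≤*; *<*; *≡*; mkℚᵘ)
import Data.Rational.Unnormalised.Properties as ℚᵘ
open import Data.Sum.Base using (inj₁; inj₂)
open import Data.Vec.Base using (Vec; lookup)
open import Relation.Binary.PropositionalEquality
  using (_≡_; refl; sym; trans; cong; subst)
open import Relation.Nullary using (¬_; Dec; yes; no; does; contradiction)
open import Relation.Nullary.Decidable using (_×-dec_)

open import Algebra.Definitions.RawSemiring ℚ.+-*-rawSemiring using (_^_)

open +-*-Solver using (solve; _:=_; _:+_; _:*_; :-_; _:-_)

------------------------------------------------------------------------
-- Real numbers as Cauchy sequences of rationals

Cauchy : (ℕ → ℚ) → Set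
Cauchy x = ∀ ε → 0ℚ < ε →
  ∃[ N ] ∀ i j → N ℕ.≤ i → N ℕ.≤ j → ℚ.∣ x i - x j ∣ < ε

record ℝ : Set where
  constructor mkℝ
  field
    seq    : ℕ → ℚ
    cauchy : Cauchy seq

open ℝ public

infix 4 _≤ᴿ_ _<ᴿ_ _≈ᴿ_

_≤ᴿ_ : ℝ → ℝ → Set
x ≤ᴿ y = ∀ ε → 0ℚ < ε → ∃[ N ] ∀ i → N ℕ.≤ i → seq x i ≤ seq y i + ε

_<ᴿ_ : ℝ → ℝ → Set
x <ᴿ y = ∃[ ε ] 0ℚ < ε × ∃[ N ] ∀ i → N ℕ.≤ i → seq x i + ε ≤ seq y i

_≈ᴿ_ : ℝ → ℝ → Set
x ≈ᴿ y = ∀ ε → 0ℚ < ε → ∃[ N ] ∀ i → N ℕ.≤ i → ℚ.∣ seq x i - seq y i ∣ < ε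

½*-pos : ∀ {ε} → 0ℚ < ε → 0ℚ < ½ * ε
½*-pos {ε} 0<ε = subst (_< ½ * ε) (ℚ.*-zeroʳ ½) (ℚ.*-monoʳ-<-pos ½ 0<ε)

½+½ : ∀ ε → ½ * ε + ½ * ε ≡ ε
½+½ ε = trans (sym (ℚ.*-distribʳ-+ ε ½ ½)) (ℚ.*-identityˡ ε)

-- Triangle inequality, with the sum and the bounds given up to equality.
∣∣<-split : ∀ {s t u a b c} → t + u ≡ s → ℚ.∣ t ∣ < a → ℚ.∣ u ∣ < b → a + b ≡ c →
  ℚ.∣ s ∣ < c
∣∣<-split {t = t} {u} refl t<a u<b refl =
  ℚ.≤-<-trans (ℚ.∣p+q∣≤∣p∣+∣q∣ t u) (ℚ.+-mono-< t<a u<b)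

const-cauchy : ∀ q → Cauchy (λ _ → q)
const-cauchy q ε 0<ε =
  0 , λ _ _ _ _ → subst (λ d → ℚ.∣ d ∣ < ε) (sym (ℚ.+-inverseʳ q)) 0<ε

neg-cauchy : ∀ {x} → Cauchy x → Cauchy (λ i → - x i)
neg-cauchy {x} cx ε 0<ε with cx ε 0<ε
... | N , h = N , λ i j N≤i N≤j → subst (_< ε) (eq (x i) (x j)) (h i j N≤i N≤j)
  where
  eq : ∀ a b → ℚ.∣ a - b ∣ ≡ ℚ.∣ (- a) - (- b) ∣
  eq a b = trans (sym (ℚ.∣-p∣≡∣p∣ (a - b)))
    (cong ℚ.∣_∣ (ℚ.neg-distrib-+ a (- b)))

+-cauchy : ∀ {x y} → Cauchy x → Cauchy y → Cauchy (λ i → x i + y i)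
+-cauchy {x} {y} cx cy ε 0<ε with cx (½ * ε) (½*-pos 0<ε) | cy (½ * ε) (½*-pos 0<ε)
... | M , h | N , k = M ℕ.⊔ N , λ i j le le′ →
  ∣∣<-split (eq (x i) (x j) (y i) (y j))
    (h i j (ℕ.m⊔n≤o⇒m≤o M N le) (ℕ.m⊔n≤o⇒m≤o M N le′))
    (k i j (ℕ.m⊔n≤o⇒n≤o M N le) (ℕ.m⊔n≤o⇒n≤o M N le′))
    (½+½ ε)
  where
  eq : ∀ a b c d → (a - b) + (c - d) ≡ (a + c) - (b + d)
  eq = solve 4 (λ a b c d → (a :- b) :+ (c :- d) := (a :+ c) :- (b :+ d)) refl

cauchy-bounded : ∀ {x} → Cauchy x →
  ∃[ B ] 0ℚ < B × ∃[ N ] ∀ i → N ℕ.≤ i → ℚ.∣ x i ∣ < B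
cauchy-bounded {x} cx with cx 1ℚ (ℚ.positive⁻¹ 1ℚ)
... | N , h = 1ℚ + (ℚ.∣ x N ∣ + 1ℚ)
            , ℚ.+-mono-<-≤ (ℚ.positive⁻¹ 1ℚ)
                (ℚ.≤-trans (ℚ.0≤∣p∣ (x N)) (ℚ.<⇒≤ (<+1 ℚ.∣ x N ∣)))
            , N , λ i N≤i →
  ∣∣<-split (eq (x i) (x N)) (h i N N≤i ℕ.≤-refl) (<+1 ℚ.∣ x N ∣) refl
  where
  eq : ∀ a b → (a - b) + b ≡ a
  eq = solve 2 (λ a b → (a :- b) :+ b := a) refl
  <+1 : ∀ a → a < a + 1ℚ
  <+1 a = subst (_< a + 1ℚ) (ℚ.+-identityʳ a) (ℚ.+-monoʳ-< a (ℚ.positive⁻¹ 1ℚ))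

*-∣∣< : ∀ {K δ} → 0ℚ < K → ∀ a b → ℚ.∣ a ∣ < K → ℚ.∣ b ∣ < δ → ℚ.∣ a * b ∣ < K * δ
*-∣∣< {K} {δ} 0<K a b a<K b<δ = subst (_< K * δ) (sym (ℚ.∣p*q∣≡∣p∣*∣q∣ a b))
  (ℚ.≤-<-trans
    (ℚ.*-monoʳ-≤-nonNeg ℚ.∣ b ∣ {{ℚ.∣-∣-nonNeg b}} (ℚ.<⇒≤ a<K))
    (ℚ.*-monoʳ-<-pos K {{ℚ.positive 0<K}} b<δ))

divide-pos : ∀ K ε → 0ℚ < K → 0ℚ < ε → ∃[ δ ] 0ℚ < δ × K * δ ≡ ε
divide-pos K ε 0<K 0<ε = 1/K * ε
  , subst (_< 1/K * ε) (ℚ.*-zeroʳ 1/K)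
      (ℚ.*-monoʳ-<-pos 1/K {{ℚ.1/pos⇒pos K}} 0<ε)
  , trans (sym (ℚ.*-assoc K 1/K ε))
      (trans (cong (_* ε) (ℚ.*-inverseʳ K)) (ℚ.*-identityˡ ε))
  where
  instance
    K-pos : ℚ.Positive K
    K-pos = ℚ.positive 0<K
    K≢0 : ℚ.NonZero K
    K≢0 = ℚ.pos⇒nonZero K
  1/K : ℚ
  1/K = 1/ K

*-cauchy : ∀ {x y} → Cauchy x → Cauchy y → Cauchy (λ i → x i * y i)
*-cauchy {x} {y} cx cy ε 0<ε =
  let A , 0<A , M , ∣x∣<A = cauchy-bounded cx
      B , 0<B , N , ∣y∣<B = cauchy-bounded cy
      δ , 0<δ , eqδ       = divide-pos (A + B) ε (ℚ.+-mono-< 0<A 0<B) 0<ε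
      P , h               = cx δ 0<δ
      Q , k               = cy δ 0<δ
  in combine A B δ M N P Q 0<A 0<B ∣x∣<A ∣y∣<B h k
       (trans (sym (ℚ.*-distribʳ-+ δ A B)) eqδ)
  where
  identity : ∀ a b c d → a * (c - d) + d * (a - b) ≡ a * c - b * d
  identity = solve 4
    (λ a b c d → a :* (c :- d) :+ d :* (a :- b) := a :* c :- b :* d) refl

  combine : ∀ A B δ M N P Q → 0ℚ < A → 0ℚ < B →
    (∀ i → M ℕ.≤ i → ℚ.∣ x i ∣ < A) → (∀ i → N ℕ.≤ i → ℚ.∣ y i ∣ < B) →
    (∀ i j → P ℕ.≤ i → P ℕ.≤ j → ℚ.∣ x i - x j ∣ < δ) →
    (∀ i j → Q ℕ.≤ i → Q ℕ.≤ j → ℚ.∣ y i - y j ∣ < δ) →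
    A * δ + B * δ ≡ ε →
    ∃[ K ] ∀ i j → K ℕ.≤ i → K ℕ.≤ j → ℚ.∣ x i * y i - x j * y j ∣ < ε
  combine A B δ M N P Q 0<A 0<B ∣x∣<A ∣y∣<B h k eqε =
    (M ℕ.⊔ N) ℕ.⊔ (P ℕ.⊔ Q) , λ i j le le′ →
      ∣∣<-split {t = x i * (y i - y j)} {u = y j * (x i - x j)}
        {a = A * δ} {b = B * δ}
        (identity (x i) (x j) (y i) (y j))
        (*-∣∣< 0<A (x i) (y i - y j)
          (∣x∣<A i (ℕ.m⊔n≤o⇒m≤o M N (left le)))
          (k i j (ℕ.m⊔n≤o⇒n≤o P Q (right le)) (ℕ.m⊔n≤o⇒n≤o P Q (right le′))))
        (*-∣∣< 0<B (y j) (x i - x j)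
          (∣y∣<B j (ℕ.m⊔n≤o⇒n≤o M N (left le′)))
          (h i j (ℕ.m⊔n≤o⇒m≤o P Q (right le)) (ℕ.m⊔n≤o⇒m≤o P Q (right le′))))
        eqε
    where
    left : ∀ {i} → (M ℕ.⊔ N) ℕ.⊔ (P ℕ.⊔ Q) ℕ.≤ i → M ℕ.⊔ N ℕ.≤ i
    left = ℕ.m⊔n≤o⇒m≤o (M ℕ.⊔ N) (P ℕ.⊔ Q)
    right : ∀ {i} → (M ℕ.⊔ N) ℕ.⊔ (P ℕ.⊔ Q) ℕ.≤ i → P ℕ.⊔ Q ℕ.≤ i
    right = ℕ.m⊔n≤o⇒n≤o (M ℕ.⊔ N) (P ℕ.⊔ Q)

infixl 7 _*ᴿ_
infixl 6 _+ᴿ_ _-ᴿ_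
infix  8 -ᴿ_

fromℚ : ℚ → ℝ
fromℚ q = mkℝ (λ _ → q) (const-cauchy q)

_+ᴿ_ : ℝ → ℝ → ℝ
x +ᴿ y = mkℝ (λ i → seq x i + seq y i) (+-cauchy {seq x} {seq y} (cauchy x) (cauchy y))

-ᴿ_ : ℝ → ℝ
-ᴿ x = mkℝ (λ i → - seq x i) (neg-cauchy {seq x} (cauchy x))

_-ᴿ_ : ℝ → ℝ → ℝ
x -ᴿ y = x +ᴿ (-ᴿ y)

_*ᴿ_ : ℝ → ℝ → ℝ
x *ᴿ y = mkℝ (λ i → seq x i * seq y i) (*-cauchy {seq x} {seq y} (cauchy x) (cauchy y))

------------------------------------------------------------------------
-- Roots and rational powers of rationals

fromℕ : ℕ → ℚ
fromℕ n = + n / 1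

-- The largest j ≤ b satisfying P, or 0 if there is none.
largest : {P : ℕ → Set} → (∀ j → Dec (P j)) → ℕ → ℕ
largest P? zero    = zero
largest P? (suc b) = if does (P? (suc b)) then suc b else largest P? b

largest-holds : ∀ {P : ℕ → Set} (P? : ∀ j → Dec (P j)) b → P 0 → P (largest P? b)
largest-holds P? zero    p₀ = p₀
largest-holds P? (suc b) p₀ with P? (suc b)
... | yes p = p
... | no  _ = largest-holds P? b p₀

largest-fails : ∀ {P : ℕ → Set} (P? : ∀ j → Dec (P j)) b → ¬ P (suc b) →
  ¬ P (suc (largest P? b))
largest-fails P? zero    ¬p = ¬p
largest-fails P? (suc b) ¬p with P? (suc b)
... | yes _  = ¬p
... | no ¬p′ = largest-fails P? b ¬p′

-- The i-th approximation to the b-th root of q is the largest fraction j/(i+1)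
-- whose b-th power is at most q. Such a j is at most (i+1)(1+∣numerator∣),
-- which bounds the search. Negative q are replaced by 0.
rootNum : ℕ → ℚ → ℕ → ℕ
rootNum b q i =
  largest (λ j → (+ j / suc i) ^ b ≤? q ⊔ 0ℚ) (suc i ℕ.* suc ℤ.∣ ↥ (q ⊔ 0ℚ) ∣)

rootSeq : ℕ → ℚ → ℕ → ℚ
rootSeq b q i = + rootNum b q i / suc i

0≤/ : ∀ j i → 0ℚ ≤ + j / suc i
0≤/ j i = ℚ.nonNegative⁻¹ _ {{ℚ.normalize-nonNeg j (suc i)}}

^-nonNeg : ∀ {a} b → 0ℚ ≤ a → 0ℚ ≤ a ^ b
^-nonNeg zero    _   = ℚ.nonNegative⁻¹ 1ℚ
^-nonNeg {a} (suc b) 0≤a = subst (_≤ a * a ^ b) (ℚ.*-zeroʳ a)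
  (ℚ.*-monoˡ-≤-nonNeg a {{ℚ.nonNegative 0≤a}} (^-nonNeg b 0≤a))

^-mono : ∀ {a c} b → 0ℚ ≤ a → a ≤ c → a ^ b ≤ c ^ b
^-mono zero    _   _   = ℚ.≤-refl
^-mono {a} {c} (suc b) 0≤a a≤c = ℚ.≤-trans
  (ℚ.*-monoʳ-≤-nonNeg (a ^ b) {{ℚ.nonNegative (^-nonNeg b 0≤a)}} a≤c)
  (ℚ.*-monoˡ-≤-nonNeg c {{ℚ.nonNegative (ℚ.≤-trans 0≤a a≤c)}} (^-mono b 0≤a a≤c))

^-cancel-< : ∀ {a c} b → 0ℚ ≤ c → a ^ b < c ^ b → a < c
^-cancel-< {a} {c} b 0≤c lt with c ≤? a
... | no  c≰a = ℚ.≰⇒> c≰a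
... | yes c≤a = contradiction (ℚ.<-≤-trans lt (^-mono b 0≤c c≤a)) (ℚ.<-irrefl refl)

^-infl : ∀ {a} b .{{_ : ℕ.NonZero b}} → 1ℚ ≤ a → a ≤ a ^ b
^-infl {a} (suc b) 1≤a = subst (_≤ a * a ^ b) (ℚ.*-identityʳ a)
  (ℚ.*-monoˡ-≤-nonNeg a {{ℚ.nonNegative (ℚ.≤-trans (ℚ.nonNegative⁻¹ 1ℚ) 1≤a)}}
    (subst (_≤ a ^ b) (one b) (^-mono b (ℚ.nonNegative⁻¹ 1ℚ) 1≤a)))
  where
  one : ∀ b → 1ℚ ^ b ≡ 1ℚ
  one zero    = refl
  one (suc b) = trans (ℚ.*-identityˡ (1ℚ ^ b)) (one b)

toℚᵘ-/ : ∀ m d → ℚ.toℚᵘ (m / suc d) ℚᵘ.≃ mkℚᵘ m d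
toℚᵘ-/ m d = ℚ.toℚᵘ-fromℚᵘ (mkℚᵘ m d)

/-≤ : ∀ m d m′ d′ → m ℤ.* + suc d′ ℤ.≤ m′ ℤ.* + suc d → m / suc d ≤ m′ / suc d′
/-≤ m d m′ d′ le = ℚ.toℚᵘ-cancel-≤
  (ℚᵘ.≤-respˡ-≃ (ℚᵘ.≃-sym (toℚᵘ-/ m d))
    (ℚᵘ.≤-respʳ-≃ (ℚᵘ.≃-sym (toℚᵘ-/ m′ d′)) (*≤* le)))

/-suc : ∀ j i → + suc j / suc i ≡ + j / suc i + + 1 / suc i
/-suc j i = ℚ.toℚᵘ-injective (ℚᵘ.≃-trans (toℚᵘ-/ (+ suc j) i)
  (ℚᵘ.≃-sym (ℚᵘ.≃-trans (ℚ.toℚᵘ-homo-+ (+ j / suc i) (+ 1 / suc i))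
    (ℚᵘ.≃-trans (ℚᵘ.+-cong (toℚᵘ-/ (+ j) i) (toℚᵘ-/ (+ 1) i)) (*≡* eq)))))
  where
  eq : (+ j ℤ.* + suc i ℤ.+ + 1 ℤ.* + suc i) ℤ.* + suc i ≡ + suc j ℤ.* (+ suc i ℤ.* + suc i)
  eq = trans (cong (ℤ._* + suc i) (trans (sym (ℤ.*-distribʳ-+ (+ suc i) (+ j) (+ 1)))
               (cong (λ t → + t ℤ.* + suc i) (ℕ.+-comm j 1))))
             (ℤ.*-assoc (+ suc j) (+ suc i) (+ suc i))

archimedean : ∀ {ε} → 0ℚ < ε → ∀ i → ↧ₙ ε ℕ.≤ i → + 1 / suc i < ε
archimedean {ε@(ℚ.mkℚ (+ zero) d _)} 0<ε = contradiction 0<ε (λ { (ℚ.*<* (ℤ.+<+ ())) })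
archimedean {ε@(ℚ.mkℚ (-[1+ _ ]) d _)} 0<ε = contradiction 0<ε (λ { (ℚ.*<* ()) })
archimedean {ε@(ℚ.mkℚ (+ suc m) d _)} _ i d<i = ℚ.toℚᵘ-cancel-<
  (ℚᵘ.<-respˡ-≃ (ℚᵘ.≃-sym (toℚᵘ-/ (+ 1) i)) (*<* (ℤ.+<+ lt)))
  where
  open ℕ.≤-Reasoning
  lt : 1 ℕ.* suc d ℕ.< suc m ℕ.* suc i
  lt = begin-strict
    1 ℕ.* suc d     ≡⟨ ℕ.*-identityˡ (suc d) ⟩
    suc d           <⟨ ℕ.s≤s d<i ⟩
    suc i           ≤⟨ ℕ.m≤n*m (suc i) (suc m) ⟩
    suc m ℕ.* suc i ∎

∣-∣< : ∀ {d ε} → d < ε → - d < ε → ℚ.∣ d ∣ < ε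
∣-∣< {d} {ε} p q with ℚ.∣p∣≡p∨∣p∣≡-p d
... | inj₁ eq = subst (_< ε) (sym eq) p
... | inj₂ eq = subst (_< ε) (sym eq) q

q<∣num∣+1 : ∀ q → q < fromℕ (suc ℤ.∣ ↥ q ∣)
q<∣num∣+1 (ℚ.mkℚ n d _) = ℚ.toℚᵘ-cancel-<
  (ℚᵘ.<-respʳ-≃ (ℚᵘ.≃-sym (toℚᵘ-/ (+ suc ℤ.∣ n ∣) 0)) (*<* (lt n)))
  where
  lt : ∀ n → n ℤ.* + 1 ℤ.< + suc ℤ.∣ n ∣ ℤ.* + suc d
  lt n = subst (ℤ._< + suc ℤ.∣ n ∣ ℤ.* + suc d) (sym (ℤ.*-identityʳ n)) (lt′ n)
    where
    lt′ : ∀ n → n ℤ.< + suc ℤ.∣ n ∣ ℤ.* + suc d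
    lt′ (+ n)    = ℤ.+<+ (ℕ.m≤m*n (suc n) (suc d))
    lt′ -[1+ n ] = ℤ.-<+

rootSeq-≤ : ∀ b .{{_ : ℕ.NonZero b}} q i → rootSeq b q i ^ b ≤ q ⊔ 0ℚ
rootSeq-≤ b@(suc b-1) q i = largest-holds
  (λ j → (+ j / suc i) ^ b ≤? q ⊔ 0ℚ) (suc i ℕ.* suc ℤ.∣ ↥ (q ⊔ 0ℚ) ∣)
  (subst (_≤ q ⊔ 0ℚ) (sym 0^b) (ℚ.p≤q⊔p q 0ℚ))
  where
  0/≡0 : + 0 / suc i ≡ 0ℚ
  0/≡0 = ℚ.0/n≡0 (suc i)
  0^b : (+ 0 / suc i) ^ b ≡ 0ℚ
  0^b = trans (cong (_* (+ 0 / suc i) ^ b-1) 0/≡0) (ℚ.*-zeroˡ ((+ 0 / suc i) ^ b-1))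

<-rootSeq : ∀ b .{{_ : ℕ.NonZero b}} q i → q ⊔ 0ℚ < (+ suc (rootNum b q i) / suc i) ^ b
<-rootSeq b q i = ℚ.≰⇒> (largest-fails
  (λ j → (+ j / suc i) ^ b ≤? q ⊔ 0ℚ) B (λ le → ℚ.<-irrefl refl (ℚ.<-≤-trans top le)))
  where
  q⁺ = q ⊔ 0ℚ
  c  = suc ℤ.∣ ↥ q⁺ ∣
  B  = suc i ℕ.* c

  c≤ : fromℕ c ≤ + suc B / suc i
  c≤ = /-≤ (+ c) 0 (+ suc B) i (ℤ.+≤+ (begin
    c ℕ.* suc i      ≡⟨ ℕ.*-comm c (suc i) ⟩
    B                ≤⟨ ℕ.n≤1+n B ⟩
    suc B            ≡⟨ ℕ.*-identityʳ (suc B) ⟨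
    suc B ℕ.* 1      ∎))
    where open ℕ.≤-Reasoning

  1≤c : 1ℚ ≤ fromℕ c
  1≤c = /-≤ (+ 1) 0 (+ c) 0 (ℤ.+≤+ (ℕ.s≤s ℕ.z≤n))

  top : q⁺ < (+ suc B / suc i) ^ b
  top = ℚ.<-≤-trans (q<∣num∣+1 q⁺)
    (ℚ.≤-trans (^-infl b 1≤c) (^-mono b (ℚ.≤-trans (ℚ.nonNegative⁻¹ 1ℚ) 1≤c) c≤))

rootSeq-cauchy : ∀ b .{{_ : ℕ.NonZero b}} q → Cauchy (rootSeq b q)
rootSeq-cauchy b q ε 0<ε = ↧ₙ ε , λ i j N≤i N≤j →
  ∣-∣< (close i j N≤j)
    (subst (_< ε) (solve 2 (λ a b → b :- a := :- (a :- b)) refl (r i) (r j))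
      (close j i N≤i))
  where
  r = rootSeq b q

  close : ∀ i j → ↧ₙ ε ℕ.≤ j → r i - r j < ε
  close i j N≤j = ℚ.<-trans
    (subst (r i - r j <_)
      (solve 2 (λ a b → (a :+ b) :- a := b) refl (r j) (+ 1 / suc j))
      (ℚ.+-monoˡ-< (- r j) lt))
    (archimedean 0<ε j N≤j)
    where
    lt : r i < r j + + 1 / suc j
    lt = subst (r i <_) (/-suc (rootNum b q j) j)
      (^-cancel-< b (0≤/ (suc (rootNum b q j)) j)
        (ℚ.≤-<-trans (rootSeq-≤ b q i) (<-rootSeq b q j)))

root : (b : ℕ) .{{_ : ℕ.NonZero b}} → ℚ → ℝ
root b q = mkℝ (rootSeq b q) (rootSeq-cauchy b q)

infixr 8 _^ℤ_ _^ᴿ_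

-- 1/q, with 1/0 = 0
inv : ℚ → ℚ
inv q with q ≟ 0ℚ
... | yes _  = 0ℚ
... | no q≢0 = (1/ q) {{ℚ.≢-nonZero q≢0}}

_^ℤ_ : ℚ → ℤ → ℚ
x ^ℤ (+ a)    = x ^ a
x ^ℤ -[1+ a ] = inv x ^ suc a

-- x ^ᴿ (a/b) is the b-th root of x^a. Meaningful for x > 0 (and for x = 0 with a
-- nonnegative exponent) only.
_^ᴿ_ : ℚ → ℚ → ℝ
x ^ᴿ e = root (↧ₙ e) (x ^ℤ (↥ e))

------------------------------------------------------------------------
-- Finite simple graphs on the vertex set Fin n

record Graph (n : ℕ) : Set where
  field
    nbrs    : Vec (Subset n) n
    adj-sym : ∀ i j → i ∈ lookup nbrs j → j ∈ lookup nbrs i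
    adj-irr : ∀ i → i ∉ lookup nbrs i

module _ {n : ℕ} (G : Graph n) where

  open Graph G

  Adj : Fin n → Fin n → Set
  Adj i j = j ∈ lookup nbrs i

  degree : Fin n → ℕ
  degree i = ∣ lookup nbrs i ∣

  edges : List (Fin n × Fin n)
  edges = filter (λ (i , j) → i Fin.<? j ×-dec j ∈? lookup nbrs i)
                 (cartesianProduct (allFin n) (allFin n))

  ∣E∣ : ℕ
  ∣E∣ = length edges

nC2≢0 : ∀ n .{{_ : NonTrivial n}} → ℕ.NonZero (n C 2)
nC2≢0 (suc (suc n)) = subst ℕ.NonZero
  (trans (cong (ℕ._+ suc n C 2) (sym (nC1≡n (suc n))))
    (nCk+nC[k+1]≡[n+1]C[k+1] (suc n) 1))
  _

density : ∀ {n} .{{_ : NonTrivial n}} → Graph n → ℚ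
density {n} G = _/_ (+ ∣E∣ G) (n C 2) {{nC2≢0 n}}

-- A subgraph, not necessarily induced. Its edge set is carried by a graph on the
-- ambient vertex set whose edges all lie inside `verts`.
record Subgraph {n : ℕ} (G : Graph n) : Set where
  field
    verts    : Subset n
    graph    : Graph n
    inside   : ∀ i j → Adj graph i j → i ∈ verts
    subgraph : ∀ i j → Adj graph i j → Adj G i j

  order : ℕ
  order = ∣ verts ∣

record IsFull {n} .{{_ : NonTrivial n}} (G : Graph n) (H : Subgraph G) : Set where
  open Subgraph H
  field
    nonempty  : 1 ℕ.≤ order
    minDegree : ∀ v → v ∈ verts → density G * (fromℕ order - 1ℚ) ≤ fromℕ (degree graph v)

IsGreatest IsLeast : (ℕ → Set) → ℕ → Set
IsGreatest P k = P k × (∀ j → P j → j ℕ.≤ k)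
IsLeast    P k = P k × (∀ j → P j → k ℕ.≤ j)

-- f(G) = k
f[_]≡_ : ∀ {n} .{{_ : NonTrivial n}} → Graph n → ℕ → Set
f[ G ]≡ k = IsGreatest (λ m → ∃[ H ] IsFull G H × Subgraph.order H ≡ m) k

-- f(n,p) = k
f[_,_]≡_ : (n : ℕ) .{{_ : NonTrivial n}} → ℚ → ℕ → Set
f[ n , p ]≡ k = IsLeast
  (λ j → ∃[ G ] fromℕ (∣E∣ {n} G) ≡ p * fromℕ (n C 2) × f[ G ]≡ j) k

module Submission where

-- Lower bound. Let p be the density and k = f(G). Every set of more than k
-- vertices has a vertex whose degree inside it is below p(size - 1), so deleting
-- such vertices one by one, down to size k, increases e(S) - p|S|(|S|-1)/2 from 0
-- to at most (1-p)k(k-1)/2. A single deletion gains much more than rounding alone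
-- would give: cut S into parts V_j of prescribed sizes at least k together with one
-- floating vertex, maximising the number of edges inside the parts (weighted
-- against p|V_j| for the part that holds the floating vertex). A vertex violating
-- fullness of that part has fewer than p|V_j| neighbours in every V_j, hence by
-- integrality each part of size u contributes a fractional part of pu to the gain.
-- With about n/u parts and u of order k, this forces k to be of order n^(2/3).
--
-- Upper bound. Take the balanced complete (r+1)-partite graph and put the missing
-- edges among O(n^(2/3)) vertices. In a full subgraph, a class holding an average
-- share of the vertices lies among those or misses too many edges.

-- A gain of at most 1 per deletion would add up to at most n, against a final excess of order k^2,
-- and give only k of order n^(1/2). With about n/k parts, a deletion gains order n/k, the total is
-- order n^2/k, and k^3 must reach n^2. Two ranges of p need different parts. For p >= 1/2 a part
-- size k or k + 1 contributes at least 1 - p, which cancels against the 1 - p in the final excess.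
-- For p < 1/2 a contribution of 1/2 is available, but the part size may have to exceed k by about
-- 1/(2p); the hypothesis p > n^(-2/3) keeps this within order n^(2/3). The constant 1/4 is the cube
-- root of 1/64. The computation for p < 1/2 uses 64 in full; for p >= 1/2 the bound is proved with
-- 256, and (1-p)^2 <= 1/4 supplies the missing factor. All combinatorics takes place in the natural
-- numbers: p is M / N with N = n C 2, edges are counted as ordered pairs, and every inequality
-- between roots is replaced by one between cubes. Since the theorem asserts that f(n,p) exists,
-- fullness is reduced to vertex sets and the minimum is found by a finite decidable search.

module Partitions where

  open import Data.Bool.Base using (Bool; true; false; _∧_)
  open import Data.Bool.Properties using (∧-comm; ∧-zeroʳ; ∧-identityʳ)
  open import Data.Fin.Base using (Fin; zero; suc; punchIn)
  open import Data.Fin.Properties as Fin using (punchInᵢ≢i)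
  open import Data.Nat.Base
  open import Data.Nat.Properties
  open import Data.Nat.Tactic.RingSolver using (solve-∀)
  open import Data.Product.Base using (_×_; _,_; ∃-syntax; proj₁; proj₂)
  open import Data.Sum.Base using (_⊎_; inj₁; inj₂)
  open import Data.Vec.Functional using (updateAt; removeAt)
  open import Data.Vec.Functional.Properties using (updateAt-updates; updateAt-minimal)
  open import Function.Base using (_∘_; const)
  open import Relation.Binary.PropositionalEquality
  open import Relation.Nullary using (yes; no; contradiction)
  open import Algebra.Properties.CommutativeMonoid.Sum +-0-commutativeMonoid
    using (sum; sum-cong-≗; sum-remove; ∑-distrib-+; sum-replicate-zero)
  open import Data.Nat.DivMod using (m≡m%n+[m/n]*n; m%n<n; m/n*n≤m)

  -- Boolean subsets and sums over finite types

  ⟦_⟧ : Bool → ℕ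
  ⟦ false ⟧ = 0
  ⟦ true ⟧  = 1

  #_ : ∀ {n} → (Fin n → Bool) → ℕ
  # s = sum (⟦_⟧ ∘ s)

  sum-mono : ∀ {n} {f g : Fin n → ℕ} → (∀ i → f i ≤ g i) → sum f ≤ sum g
  sum-mono {zero}  f≤g = z≤n
  sum-mono {suc n} f≤g = +-mono-≤ (f≤g zero) (sum-mono (f≤g ∘ suc))

  sum-≤ : ∀ {n} {f : Fin n → ℕ} b → (∀ i → f i ≤ b) → sum f ≤ n * b
  sum-≤ {zero}  b f≤b = z≤n
  sum-≤ {suc n} b f≤b = +-mono-≤ (f≤b zero) (sum-≤ b (f≤b ∘ suc))

  ⟦⟧≤1 : ∀ b → ⟦ b ⟧ ≤ 1
  ⟦⟧≤1 false = z≤n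
  ⟦⟧≤1 true  = ≤-refl

  ⟦⟧-mono : ∀ {b c} → (b ≡ true → c ≡ true) → ⟦ b ⟧ ≤ ⟦ c ⟧
  ⟦⟧-mono {false} _ = z≤n
  ⟦⟧-mono {true}  f rewrite f refl = ≤-refl

  #-mono : ∀ {n} {s t : Fin n → Bool} → (∀ i → s i ≡ true → t i ≡ true) → # s ≤ # t
  #-mono s⊆t = sum-mono λ i → ⟦⟧-mono (s⊆t i)

  #-cong : ∀ {n} {s t : Fin n → Bool} → (∀ i → s i ≡ t i) → # s ≡ # t
  #-cong eq = sum-cong-≗ (cong ⟦_⟧ ∘ eq)

  sum-const : ∀ n c → sum {n} (const c) ≡ n * c
  sum-const zero    c = refl
  sum-const (suc n) c = cong (c +_) (sum-const n c)

  -- Stated without subtraction: the two differing terms stand on opposite sides, which keeps the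
  -- identity in ℕ.
  sum-update : ∀ {n} (f g : Fin n → ℕ) v → (∀ w → w ≢ v → f w ≡ g w) →
    sum f + g v ≡ sum g + f v
  sum-update {suc n} f g v f≗g = begin
    sum f + g v                             ≡⟨ cong (_+ g v) (sum-remove {i = v} f) ⟩
    f v + sum (removeAt f v) + g v          ≡⟨ cong (λ x → f v + x + g v)
                                                 (sum-cong-≗ λ w → f≗g _ (punchInᵢ≢i v w)) ⟩
    f v + sum (removeAt g v) + g v          ≡⟨ rearr (f v) _ (g v) ⟩
    g v + sum (removeAt g v) + f v          ≡⟨ cong (_+ f v) (sum-remove {i = v} g) ⟨
    sum g + f v                             ∎
    where
    open ≡-Reasoning
    rearr : ∀ a b c → a + b + c ≡ c + b + a
    rearr = solve-∀

  ∑∑ : ∀ {n} → (Fin n → Fin n → ℕ) → ℕ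
  ∑∑ g = sum λ v → sum (g v)

  -- By symmetry, row `v` and column `v` have the same sum, and the zero at their crossing prevents
  -- double counting; hence the factor 2. Deleting and recolouring a vertex are both instances.
  ∑∑-update : ∀ {n} (f g : Fin n → Fin n → ℕ) v →
    (∀ u w → f u w ≡ f w u) → (∀ u w → g u w ≡ g w u) → f v v ≡ 0 → g v v ≡ 0 →
    (∀ u w → u ≢ v → w ≢ v → f u w ≡ g u w) →
    ∑∑ f + 2 * sum (g v) ≡ ∑∑ g + 2 * sum (f v)
  ∑∑-update {suc n} f g v f-sym g-sym f-irr g-irr f≗g = begin
    ∑∑ f + 2 * sum (g v)      ≡⟨ cong (_+ 2 * sum (g v)) (split f f-sym f-irr) ⟩
    2 * sum (f v) + rest f + 2 * sum (g v)
      ≡⟨ cong (λ x → 2 * sum (f v) + x + 2 * sum (g v))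
           (sum-cong-≗ λ u → sum-cong-≗ λ w → f≗g _ _ (punchInᵢ≢i v u) (punchInᵢ≢i v w)) ⟩
    2 * sum (f v) + rest g + 2 * sum (g v) ≡⟨ rearr (2 * sum (f v)) (rest g) (2 * sum (g v)) ⟩
    2 * sum (g v) + rest g + 2 * sum (f v) ≡⟨ cong (_+ 2 * sum (f v)) (split g g-sym g-irr) ⟨
    ∑∑ g + 2 * sum (f v)      ∎
    where
    open ≡-Reasoning
    rearr : ∀ a b c → a + b + c ≡ c + b + a
    rearr = solve-∀
    rearr₂ : ∀ a b → a + (a + b) ≡ 2 * a + b
    rearr₂ = solve-∀
    rest : (Fin (suc n) → Fin (suc n) → ℕ) → ℕ
    rest h = ∑∑ λ u w → h (punchIn v u) (punchIn v w)
    split : ∀ h → (∀ u w → h u w ≡ h w u) → h v v ≡ 0 → ∑∑ h ≡ 2 * sum (h v) + rest h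
    split h h-sym h-irr = begin
      ∑∑ h
        ≡⟨ sum-remove {i = v} (λ u → sum (h u)) ⟩
      sum (h v) + sum (λ u → sum (h (punchIn v u)))
        ≡⟨ cong (sum (h v) +_) (sum-cong-≗ λ u → sum-remove {i = v} (h (punchIn v u))) ⟩
      sum (h v) + sum (λ u → h (punchIn v u) v + sum (removeAt (h (punchIn v u)) v))
        ≡⟨ cong (sum (h v) +_) (∑-distrib-+ (λ u → h (punchIn v u) v) _) ⟩
      sum (h v) + (sum (λ u → h (punchIn v u) v) + rest h)
        ≡⟨ cong (λ x → sum (h v) + (x + rest h)) row ⟩
      sum (h v) + (sum (h v) + rest h)
        ≡⟨ rearr₂ (sum (h v)) (rest h) ⟩
      2 * sum (h v) + rest h ∎
      where
      row : sum (λ u → h (punchIn v u) v) ≡ sum (h v)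
      row = begin
        sum (λ u → h (punchIn v u) v)      ≡⟨ sum-cong-≗ (λ u → h-sym (punchIn v u) v) ⟩
        sum (removeAt (h v) v)             ≡⟨ cong (_+ sum (removeAt (h v) v)) h-irr ⟨
        h v v + sum (removeAt (h v) v)     ≡⟨ sum-remove {i = v} (h v) ⟨
        sum (h v)                          ∎

  -- Sums over initial segments and colourings with prescribed class sizes

  Σ< : ℕ → (ℕ → ℕ) → ℕ
  Σ< zero    f = 0
  Σ< (suc k) f = Σ< k f + f k

  Σ<-cong : ∀ k {f g} → (∀ j → j < k → f j ≡ g j) → Σ< k f ≡ Σ< k g
  Σ<-cong zero    eq = refl
  Σ<-cong (suc k) eq = cong₂ _+_ (Σ<-cong k (λ j j<k → eq j (m<n⇒m<1+n j<k))) (eq k ≤-refl)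

  Σ<-mono : ∀ k {f g} → (∀ j → j < k → f j ≤ g j) → Σ< k f ≤ Σ< k g
  Σ<-mono zero    le = z≤n
  Σ<-mono (suc k) le = +-mono-≤ (Σ<-mono k (λ j j<k → le j (m<n⇒m<1+n j<k))) (le k ≤-refl)

  Σ<-+ : ∀ k f g → Σ< k (λ j → f j + g j) ≡ Σ< k f + Σ< k g
  Σ<-+ zero    f g = refl
  Σ<-+ (suc k) f g rewrite Σ<-+ k f g = solve (Σ< k f) (Σ< k g) (f k) (g k)
    where
    solve : ∀ a b c d → a + b + (c + d) ≡ a + c + (b + d)
    solve = solve-∀

  Σ<-* : ∀ k c f → Σ< k (λ j → c * f j) ≡ c * Σ< k f
  Σ<-* zero    c f = sym (*-zeroʳ c)
  Σ<-* (suc k) c f rewrite Σ<-* k c f = sym (*-distribˡ-+ c (Σ< k f) (f k))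

  Σ<-const : ∀ k c → Σ< k (const c) ≡ k * c
  Σ<-const zero    c = refl
  Σ<-const (suc k) c rewrite Σ<-const k c = +-comm (k * c) c

  ≡ᵇ-refl : ∀ j → (j ≡ᵇ j) ≡ true
  ≡ᵇ-refl zero    = refl
  ≡ᵇ-refl (suc j) = ≡ᵇ-refl j

  ≢⇒≡ᵇ : ∀ i j → i ≢ j → (i ≡ᵇ j) ≡ false
  ≢⇒≡ᵇ zero    zero    i≢j = contradiction refl i≢j
  ≢⇒≡ᵇ zero    (suc j) i≢j = refl
  ≢⇒≡ᵇ (suc i) zero    i≢j = refl
  ≢⇒≡ᵇ (suc i) (suc j) i≢j = ≢⇒≡ᵇ i j (i≢j ∘ cong suc)

  ≡ᵇ⇒≡′ : ∀ i j → (i ≡ᵇ j) ≡ true → i ≡ j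
  ≡ᵇ⇒≡′ zero    zero    eq = refl
  ≡ᵇ⇒≡′ (suc i) (suc j) eq = cong suc (≡ᵇ⇒≡′ i j eq)

  ≡ᵇ-sym : ∀ i j → (i ≡ᵇ j) ≡ (j ≡ᵇ i)
  ≡ᵇ-sym zero    zero    = refl
  ≡ᵇ-sym zero    (suc j) = refl
  ≡ᵇ-sym (suc i) zero    = refl
  ≡ᵇ-sym (suc i) (suc j) = ≡ᵇ-sym i j

  <⇒<ᵇ′ : ∀ {i j} → i < j → (i <ᵇ j) ≡ true
  <⇒<ᵇ′ {zero}  {suc j} _ = refl
  <⇒<ᵇ′ {suc i} {suc j} (s≤s i<j) = <⇒<ᵇ′ i<j

  <ᵇ⇒<′ : ∀ i j → (i <ᵇ j) ≡ true → i < j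
  <ᵇ⇒<′ zero    (suc j) _  = z<s
  <ᵇ⇒<′ (suc i) (suc j) eq = s≤s (<ᵇ⇒<′ i j eq)

  Σ<-δ-≥ : ∀ k i → k ≤ i → Σ< k (λ j → ⟦ i ≡ᵇ j ⟧) ≡ 0
  Σ<-δ-≥ zero    i k≤i = refl
  Σ<-δ-≥ (suc k) i k<i rewrite Σ<-δ-≥ k i (<⇒≤ k<i) | ≢⇒≡ᵇ i k (>⇒≢ k<i) = refl

  Σ<-δ : ∀ k i → i < k → Σ< k (λ j → ⟦ i ≡ᵇ j ⟧) ≡ 1
  Σ<-δ (suc k) i (s≤s i≤k) with m≤n⇒m<n∨m≡n i≤k
  ... | inj₁ i<k  rewrite Σ<-δ k i i<k | ≢⇒≡ᵇ i k (<⇒≢ i<k) = refl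
  ... | inj₂ refl rewrite Σ<-δ-≥ k k ≤-refl | ≡ᵇ-refl k = refl

  Σ<-0 : ∀ k {f} → Σ< k f ≡ 0 → ∀ j → j < k → f j ≡ 0
  Σ<-0 (suc k) {f} eq j (s≤s j≤k) with m≤n⇒m<n∨m≡n j≤k
  ... | inj₁ j<k  = Σ<-0 k (m+n≡0⇒m≡0 (Σ< k f) eq) j j<k
  ... | inj₂ refl = m+n≡0⇒n≡0 (Σ< k f) eq

  Σ<-pos : ∀ k {f m} → Σ< k f ≡ suc m → ∃[ j ] j < k × 0 < f j
  Σ<-pos (suc k) {f} eq with Σ< k f in eq′
  ... | zero  = k , ≤-refl , subst (0 <_) (sym eq) z<s
  ... | suc _ with Σ<-pos k eq′
  ...   | j , j<k , 0<fj = j , m<n⇒m<1+n j<k , 0<fj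

  #-split : ∀ {n} (s : Fin n → Bool) (χ : Fin n → ℕ) K →
    # (λ v → s v ∧ (χ v <ᵇ K)) ≡ Σ< K (λ j → # (λ v → s v ∧ (χ v ≡ᵇ j)))
  #-split {n} s χ zero    = trans (#-cong (λ v → ∧-zeroʳ (s v))) (sum-replicate-zero n)
  #-split {n} s χ (suc K) = begin
    # (λ v → s v ∧ (χ v <ᵇ suc K))
      ≡⟨ sum-cong-≗ (λ v → pointwise (s v) (χ v) K) ⟩
    sum (λ v → ⟦ s v ∧ (χ v <ᵇ K) ⟧ + ⟦ s v ∧ (χ v ≡ᵇ K) ⟧)
      ≡⟨ ∑-distrib-+ (λ v → ⟦ s v ∧ (χ v <ᵇ K) ⟧) _ ⟩
    # (λ v → s v ∧ (χ v <ᵇ K)) + # (λ v → s v ∧ (χ v ≡ᵇ K))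
      ≡⟨ cong (_+ # (λ v → s v ∧ (χ v ≡ᵇ K))) (#-split s χ K) ⟩
    Σ< (suc K) (λ j → # (λ v → s v ∧ (χ v ≡ᵇ j))) ∎
    where
    open ≡-Reasoning
    pointwise : ∀ b m K → ⟦ b ∧ (m <ᵇ suc K) ⟧ ≡ ⟦ b ∧ (m <ᵇ K) ⟧ + ⟦ b ∧ (m ≡ᵇ K) ⟧
    pointwise false m       K       = refl
    pointwise true  zero    zero    = refl
    pointwise true  zero    (suc K) = refl
    pointwise true  (suc m) zero    = refl
    pointwise true  (suc m) (suc K) = pointwise true m K

  level : ∀ {n} → (Fin n → ℕ) → ℕ → Fin n → Bool
  level χ j v = χ v ≡ᵇ j

  -- Colours from `K` on mean "outside `s`", so one function encodes the set together with its
  -- partition. The construction is greedy: each vertex of `s` takes a colour with capacity left and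
  -- lowers that capacity by one.
  colouring : ∀ {n} K (b : ℕ → ℕ) (s : Fin n → Bool) → # s ≡ Σ< K b →
    ∃[ χ ] (∀ v → (χ v <ᵇ K) ≡ s v) × (∀ j → j < K → # (level χ j) ≡ b j)
  colouring {zero}  K b s eq = (λ ()) , (λ ()) , λ j j<K → sym (Σ<-0 K (sym eq) j j<K)
  colouring {suc n} K b s eq with s zero in s₀
  ... | false with colouring K b (s ∘ suc) eq
  ...   | χ , χ<K , sizes = (λ { zero → K ; (suc v) → χ v })
        , (λ { zero → trans (irr K) (sym s₀) ; (suc v) → χ<K v })
        , λ j j<K → cong₂ _+_ (cong ⟦_⟧ (≢⇒≡ᵇ K j (>⇒≢ j<K))) (sizes j j<K)
    where
    irr : ∀ K → (K <ᵇ K) ≡ false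
    irr zero    = refl
    irr (suc K) = irr K
  colouring {suc n} K b s eq | true with Σ<-pos K (sym eq)
  ... | i , i<K , 0<bi with colouring K (λ j → b j ∸ ⟦ i ≡ᵇ j ⟧) (s ∘ suc) (suc-injective eq′)
    where
    restore : ∀ j → b j ≡ ⟦ i ≡ᵇ j ⟧ + (b j ∸ ⟦ i ≡ᵇ j ⟧)
    restore j with i ≡ᵇ j in e
    ... | false = refl
    ... | true  = sym (m+[n∸m]≡n (subst (λ x → 0 < b x) (≡ᵇ⇒≡′ i j e) 0<bi))
    eq′ : suc (# (s ∘ suc)) ≡ suc (Σ< K (λ j → b j ∸ ⟦ i ≡ᵇ j ⟧))
    eq′ = begin
      suc (# (s ∘ suc))  ≡⟨ eq ⟩
      Σ< K b             ≡⟨ Σ<-cong K (λ j _ → restore j) ⟩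
      Σ< K (λ j → ⟦ i ≡ᵇ j ⟧ + (b j ∸ ⟦ i ≡ᵇ j ⟧)) ≡⟨ Σ<-+ K _ _ ⟩
      Σ< K (λ j → ⟦ i ≡ᵇ j ⟧) + Σ< K (λ j → b j ∸ ⟦ i ≡ᵇ j ⟧)
        ≡⟨ cong (_+ Σ< K (λ j → b j ∸ ⟦ i ≡ᵇ j ⟧)) (Σ<-δ K i i<K) ⟩
      suc (Σ< K (λ j → b j ∸ ⟦ i ≡ᵇ j ⟧)) ∎
      where open ≡-Reasoning
  ...   | χ , χ<K , sizes = (λ { zero → i ; (suc v) → χ v })
        , (λ { zero → trans (<⇒<ᵇ′ i<K) (sym s₀) ; (suc v) → χ<K v })
        , λ j j<K → trans (cong (⟦ i ≡ᵇ j ⟧ +_) (sizes j j<K)) (m+[n∸m]≡n (le j))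
    where
    le : ∀ j → ⟦ i ≡ᵇ j ⟧ ≤ b j
    le j with i ≡ᵇ j in e
    ... | false = z≤n
    ... | true  = subst (λ x → 0 < b x) (≡ᵇ⇒≡′ i j e) 0<bi

  _∖_ : ∀ {n} → (Fin n → Bool) → Fin n → Fin n → Bool
  s ∖ v = updateAt s v (const false)

  #-∖ : ∀ {n} (s : Fin n → Bool) v → s v ≡ true → # s ≡ suc (# (s ∖ v))
  #-∖ s v v∈s = begin
    # s                        ≡⟨ +-identityʳ (# s) ⟨
    # s + 0                    ≡⟨ cong (λ b → # s + ⟦ b ⟧) (updateAt-updates v s) ⟨
    # s + ⟦ (s ∖ v) v ⟧        ≡⟨ sum-update (⟦_⟧ ∘ s) (⟦_⟧ ∘ (s ∖ v)) v
                                   (λ w w≢v → cong ⟦_⟧ (sym (updateAt-minimal w v s w≢v))) ⟩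
    # (s ∖ v) + ⟦ s v ⟧        ≡⟨ cong (λ b → # (s ∖ v) + ⟦ b ⟧) v∈s ⟩
    # (s ∖ v) + 1              ≡⟨ +-comm (# (s ∖ v)) 1 ⟩
    suc (# (s ∖ v))            ∎
    where open ≡-Reasoning

  #-pos : ∀ {n} (s : Fin n → Bool) → 0 < # s → ∃[ v ] s v ≡ true
  #-pos {suc n} s 0<s with s zero in eq
  ... | true  = zero , eq
  ... | false with #-pos (s ∘ suc) 0<s
  ...   | v , v∈s = suc v , v∈s

  deg : ∀ {n} → (Fin n → Fin n → Bool) → (Fin n → Bool) → Fin n → ℕ
  deg a s v = # λ w → a v w ∧ s w

  -- Edge counts under deletion and recolouring, and the potential argument

  module Edges {n : ℕ} (a : Fin n → Fin n → Bool)
    (a-sym : ∀ v w → a v w ≡ a w v) (a-irr : ∀ v → a v v ≡ false) where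

    -- Twice the number of edges inside s.
    e₂ : (Fin n → Bool) → ℕ
    e₂ s = ∑∑ λ v w → ⟦ a v w ∧ (s v ∧ s w) ⟧

    -- Twice the number of edges inside the colour classes below K.
    mono : ℕ → (Fin n → ℕ) → ℕ
    mono K χ = ∑∑ λ v w → ⟦ a v w ∧ ((χ v ≡ᵇ χ w) ∧ (χ v <ᵇ K)) ⟧

    deg-∖ : ∀ s v → deg a s v ≡ deg a (s ∖ v) v
    deg-∖ s v = #-cong eq
      where
      eq : ∀ w → a v w ∧ s w ≡ a v w ∧ (s ∖ v) w
      eq w with w Fin.≟ v
      ... | yes refl rewrite a-irr v = refl
      ... | no  w≢v  = cong (a v w ∧_) (sym (updateAt-minimal w v s w≢v))

    deg≤# : ∀ s v → deg a s v ≤ # s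
    deg≤# s v = #-mono incl
      where
      incl : ∀ w → a v w ∧ s w ≡ true → s w ≡ true
      incl w eq with a v w
      ... | true = eq

    e₂-∖ : ∀ s v → s v ≡ true → e₂ s ≡ e₂ (s ∖ v) + 2 * deg a s v
    e₂-∖ s v v∈s = begin
      e₂ s                             ≡⟨ +-identityʳ (e₂ s) ⟨
      e₂ s + 2 * 0                     ≡⟨ cong (λ x → e₂ s + 2 * x) row₀ ⟨
      e₂ s + 2 * sum (f (s ∖ v) v)     ≡⟨ ∑∑-update (f s) (f (s ∖ v)) v (f-sym s) (f-sym (s ∖ v))
                                            (f-irr s) (f-irr (s ∖ v)) f≗ ⟩
      e₂ (s ∖ v) + 2 * sum (f s v)     ≡⟨ cong (λ x → e₂ (s ∖ v) + 2 * x) row₁ ⟩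
      e₂ (s ∖ v) + 2 * deg a s v         ∎
      where
      open ≡-Reasoning
      f : (Fin n → Bool) → Fin n → Fin n → ℕ
      f t u w = ⟦ a u w ∧ (t u ∧ t w) ⟧
      f-sym : ∀ t u w → f t u w ≡ f t w u
      f-sym t u w = cong ⟦_⟧ (cong₂ _∧_ (a-sym u w) (∧-comm (t u) (t w)))
      f-irr : ∀ t → f t v v ≡ 0
      f-irr t rewrite a-irr v = refl
      row₀ : sum (f (s ∖ v) v) ≡ 0
      row₀ = trans (sum-cong-≗ λ w → cong ⟦_⟧ (trans
          (cong (λ b → a v w ∧ (b ∧ (s ∖ v) w)) (updateAt-updates v s)) (∧-zeroʳ (a v w))))
        (sum-replicate-zero n)
      row₁ : sum (f s v) ≡ deg a s v
      row₁ = sum-cong-≗ λ w → cong (λ b → ⟦ a v w ∧ (b ∧ s w) ⟧) v∈s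
      f≗ : ∀ u w → u ≢ v → w ≢ v → f s u w ≡ f (s ∖ v) u w
      f≗ u w u≢v w≢v = cong₂ (λ b c → ⟦ a u w ∧ (b ∧ c) ⟧)
        (sym (updateAt-minimal u v s u≢v)) (sym (updateAt-minimal w v s w≢v))

    recolour : (Fin n → ℕ) → Fin n → ℕ → Fin n → ℕ
    recolour χ v j = updateAt χ v (const j)

    -- Whether `v` itself belongs to the class is irrelevant to its degree there, because `v` is not
    -- its own neighbour; so both degrees may be taken with respect to the old colouring.
    mono-recolour : ∀ K χ v j → χ v < K → j < K →
      mono K χ + 2 * deg a (level χ j) v ≡ mono K (recolour χ v j) + 2 * deg a (level χ (χ v)) v
    mono-recolour K χ v j i<K j<K = begin
      mono K χ + 2 * deg a (level χ j) v
        ≡⟨ cong (λ x → mono K χ + 2 * x) (trans (row′ χ′ j (updateAt-updates v χ) j<K) off) ⟨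
      mono K χ + 2 * sum (f χ′ v)
        ≡⟨ ∑∑-update (f χ) (f χ′) v (f-sym χ) (f-sym χ′) (f-irr χ) (f-irr χ′) f≗ ⟩
      mono K χ′ + 2 * sum (f χ v)
        ≡⟨ cong (λ x → mono K χ′ + 2 * x) (row′ χ (χ v) refl i<K) ⟩
      mono K χ′ + 2 * deg a (level χ (χ v)) v ∎
      where
      open ≡-Reasoning
      χ′ = recolour χ v j
      f : (Fin n → ℕ) → Fin n → Fin n → ℕ
      f ψ u w = ⟦ a u w ∧ ((ψ u ≡ᵇ ψ w) ∧ (ψ u <ᵇ K)) ⟧
      f-sym : ∀ ψ u w → f ψ u w ≡ f ψ w u
      f-sym ψ u w = cong ⟦_⟧ (cong₂ _∧_ (a-sym u w) eq)
        where
        eq : (ψ u ≡ᵇ ψ w) ∧ (ψ u <ᵇ K) ≡ (ψ w ≡ᵇ ψ u) ∧ (ψ w <ᵇ K)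
        eq rewrite ≡ᵇ-sym (ψ w) (ψ u) with ψ u ≡ᵇ ψ w in e
        ... | false = refl
        ... | true  = cong (_<ᵇ K) (≡ᵇ⇒≡′ (ψ u) (ψ w) e)
      f-irr : ∀ ψ → f ψ v v ≡ 0
      f-irr ψ rewrite a-irr v = refl
      row′ : ∀ ψ i → ψ v ≡ i → i < K → sum (f ψ v) ≡ deg a (level ψ i) v
      row′ ψ i refl i<K = #-cong λ w → cong (a v w ∧_) (trans
        (cong ((ψ v ≡ᵇ ψ w) ∧_) (<⇒<ᵇ′ i<K))
        (trans (∧-identityʳ _) (≡ᵇ-sym (ψ v) (ψ w))))
      off : deg a (level χ′ j) v ≡ deg a (level χ j) v
      off = #-cong eq
        where
        eq : ∀ w → a v w ∧ level χ′ j w ≡ a v w ∧ level χ j w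
        eq w with w Fin.≟ v
        ... | yes refl rewrite a-irr v = refl
        ... | no  w≢v  = cong (λ c → a v w ∧ (c ≡ᵇ j)) (updateAt-minimal w v χ w≢v)
      f≗ : ∀ u w → u ≢ v → w ≢ v → f χ u w ≡ f χ′ u w
      f≗ u w u≢v w≢v = cong₂ (λ b c → ⟦ a u w ∧ ((b ≡ᵇ c) ∧ (b <ᵇ K)) ⟧)
        (sym (updateAt-minimal u v χ u≢v)) (sym (updateAt-minimal w v χ w≢v))

    #-recolour-new : ∀ χ v j → χ v ≢ j → # (level (recolour χ v j) j) ≡ suc (# (level χ j))
    #-recolour-new χ v j χv≢j = begin
      # (level χ′ j)                          ≡⟨ +-identityʳ _ ⟨
      # (level χ′ j) + 0
        ≡⟨ cong (λ b → # (level χ′ j) + ⟦ b ⟧) (≢⇒≡ᵇ (χ v) j χv≢j) ⟨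
      # (level χ′ j) + ⟦ level χ j v ⟧        ≡⟨ sum-update (⟦_⟧ ∘ level χ′ j) (⟦_⟧ ∘ level χ j) v
                                                   (λ w w≢v → cong (λ c → ⟦ c ≡ᵇ j ⟧) (updateAt-minimal w v χ w≢v)) ⟩
      # (level χ j) + ⟦ χ′ v ≡ᵇ j ⟧
        ≡⟨ cong (λ c → # (level χ j) + ⟦ c ≡ᵇ j ⟧) (updateAt-updates v χ) ⟩
      # (level χ j) + ⟦ j ≡ᵇ j ⟧              ≡⟨ cong (λ b → # (level χ j) + ⟦ b ⟧) (≡ᵇ-refl j) ⟩
      # (level χ j) + 1                       ≡⟨ +-comm _ 1 ⟩
      suc (# (level χ j))                     ∎
      where
      open ≡-Reasoning
      χ′ = recolour χ v j

    #-recolour-old : ∀ χ v j → χ v ≢ j → # (level χ (χ v)) ≡ suc (# (level (recolour χ v j) (χ v)))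
    #-recolour-old χ v j χv≢j = begin
      # (level χ i)                           ≡⟨ +-identityʳ _ ⟨
      # (level χ i) + 0                       ≡⟨ cong (λ b → # (level χ i) + ⟦ b ⟧) eq ⟨
      # (level χ i) + ⟦ level χ′ i v ⟧        ≡⟨ sum-update (⟦_⟧ ∘ level χ i) (⟦_⟧ ∘ level χ′ i) v
                                                   (λ w w≢v → cong (λ c → ⟦ c ≡ᵇ i ⟧) (sym (updateAt-minimal w v χ w≢v))) ⟩
      # (level χ′ i) + ⟦ i ≡ᵇ i ⟧             ≡⟨ cong (λ b → # (level χ′ i) + ⟦ b ⟧) (≡ᵇ-refl i) ⟩
      # (level χ′ i) + 1                      ≡⟨ +-comm _ 1 ⟩
      suc (# (level χ′ i))                    ∎
      where
      open ≡-Reasoning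
      χ′ = recolour χ v j
      i = χ v
      eq : level χ′ i v ≡ false
      eq = trans (cong (_≡ᵇ i) (updateAt-updates v χ)) (≢⇒≡ᵇ j i (χv≢j ∘ sym))

    #-recolour-other : ∀ χ v j l → l ≢ j → l ≢ χ v → # (level (recolour χ v j) l) ≡ # (level χ l)
    #-recolour-other χ v j l l≢j l≢χv = #-cong eq
      where
      eq : ∀ w → level (recolour χ v j) l w ≡ level χ l w
      eq w with w Fin.≟ v
      ... | yes refl = trans (cong (_≡ᵇ l) (updateAt-updates v χ))
                         (trans (≢⇒≡ᵇ j l (l≢j ∘ sym)) (sym (≢⇒≡ᵇ (χ v) l (l≢χv ∘ sym))))
      ... | no  w≢v  = cong (_≡ᵇ l) (updateAt-minimal w v χ w≢v)

    recolour-below : ∀ K χ v j → χ v < K → j < K → ∀ w → (recolour χ v j w <ᵇ K) ≡ (χ w <ᵇ K)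
    recolour-below K χ v j i<K j<K w with w Fin.≟ v
    ... | yes refl = trans (cong (_<ᵇ K) (updateAt-updates v χ)) (trans (<⇒<ᵇ′ j<K) (sym (<⇒<ᵇ′ i<K)))
    ... | no  w≢v  = cong (_<ᵇ K) (updateAt-minimal w v χ w≢v)

    mono≤ : ∀ K χ → mono K χ ≤ n * (n * 1)
    mono≤ K χ = sum-≤ {n} (n * 1) λ v → sum-≤ {n} 1 λ w → ⟦⟧≤1 (a v w ∧ ((χ v ≡ᵇ χ w) ∧ (χ v <ᵇ K)))

    module _ (N M K : ℕ) (b : ℕ → ℕ)
      (deficient : ∀ j → j < K → ∀ s → # s ≡ suc (b j) → ∃[ v ] s v ≡ true × N * deg a s v < M * b j)
      where

      -- Moving the deficient vertex of the class i that holds the extra vertex to a class j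
      -- in which it is not deficient increases the potential N * mono K χ - 2 M (b i).
      refine : ∀ fuel χ i → i < K → # (level χ i) ≡ suc (b i) →
        (∀ j → j < K → j ≢ i → # (level χ j) ≡ b j) →
        N * (n * (n * 1)) + 2 * (M * b i) < N * mono K χ + fuel →
        ∃[ ψ ] (∀ w → (ψ w <ᵇ K) ≡ (χ w <ᵇ K)) ×
        ∃[ v ] (χ v <ᵇ K) ≡ true × (∀ j → j < K → N * deg a (level ψ j) v < M * b j)
      -- Fuel bounds how far the potential can still rise; without fuel the invariant contradicts
      -- `mono≤`.
      refine zero χ i _ _ _ lt = contradiction
        (≤-trans lt (≤-trans (≤-reflexive (+-identityʳ _)) (*-monoʳ-≤ N (mono≤ K χ))))
        (<⇒≱ (≤-<-trans (m≤m+n _ (2 * (M * b i))) ≤-refl))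
      refine (suc fuel) χ i i<K big rest lt with deficient i i<K (level χ i) big
      ... | v , v∈ , d< with ≡ᵇ⇒≡′ (χ v) i v∈
      ...   | refl with anyUpTo? (λ j → M * b j ≤? N * deg a (level χ j) v) K
      ...     | no none = χ , (λ _ → refl) , v , <⇒<ᵇ′ i<K ,
                  λ j j<K → ≰⇒> λ le → none (j , j<K , le)
      ...     | yes (j , j<K , le) = continue (refine fuel χ′ j j<K
                  (trans (#-recolour-new χ v j i≢j) (cong suc (rest j j<K (i≢j ∘ sym)))) rest′ lt′)
        where
        χ′ = recolour χ v j
        -- `v` is deficient in its own class, so the class found is a different one and the move is
        -- genuine.
        i≢j : χ v ≢ j
        i≢j refl = <⇒≱ d< le
        rest′ : ∀ l → l < K → l ≢ j → # (level χ′ l) ≡ b l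
        rest′ l l<K l≢j with l ≟ χ v
        ... | yes refl = suc-injective (trans (sym (#-recolour-old χ v j i≢j)) big)
        ... | no  l≢i  = trans (#-recolour-other χ v j l l≢j l≢i) (rest l l<K l≢i)
        d = deg a (level χ (χ v)) v
        d′ = deg a (level χ j) v
        -- By integrality the strict inequality `d<` raises the potential by at least 2, which pays
        -- for the single unit of fuel spent.
        lt′ : N * (n * (n * 1)) + 2 * (M * b j) < N * mono K χ′ + fuel
        lt′ = arith (N * (n * (n * 1))) (M * b (χ v)) (M * b j) (N * d) (N * d′) _ _ fuel
          gain lt d< le
          where
          gain : N * mono K χ + 2 * (N * d′) ≡ N * mono K χ′ + 2 * (N * d)
          gain = begin
            N * mono K χ + 2 * (N * d′)   ≡⟨ lem N (mono K χ) d′ ⟩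
            N * (mono K χ + 2 * d′)       ≡⟨ cong (N *_) (mono-recolour K χ v j i<K j<K) ⟩
            N * (mono K χ′ + 2 * d)       ≡⟨ lem N (mono K χ′) d ⟨
            N * mono K χ′ + 2 * (N * d)   ∎
            where
            open ≡-Reasoning
            lem : ∀ N m d → N * m + 2 * (N * d) ≡ N * (m + 2 * d)
            lem = solve-∀
          arith : ∀ B x y d d′ m m′ f → m + 2 * d′ ≡ m′ + 2 * d →
            B + 2 * x < m + suc f → d < x → y ≤ d′ → B + 2 * y < m′ + f
          arith B x y d d′ m m′ f eq p q r = +-cancelʳ-≤ (2 * x + 1) _ _ (begin
            suc (B + 2 * y) + (2 * x + 1)   ≡⟨ l₁ B y x ⟩
            suc (B + 2 * x) + (2 * y + 1)   ≤⟨ +-monoˡ-≤ (2 * y + 1) p ⟩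
            m + suc f + (2 * y + 1)         ≤⟨ +-monoʳ-≤ (m + suc f) (+-monoˡ-≤ 1 (*-monoʳ-≤ 2 r)) ⟩
            m + suc f + (2 * d′ + 1)        ≡⟨ l₂ m f d′ ⟩
            (m + 2 * d′) + (f + 2)          ≡⟨ cong (_+ (f + 2)) eq ⟩
            (m′ + 2 * d) + (f + 2)          ≡⟨ l₃ m′ f d ⟩
            (m′ + f) + 2 * suc d            ≤⟨ +-monoʳ-≤ (m′ + f) (*-monoʳ-≤ 2 q) ⟩
            (m′ + f) + 2 * x                ≤⟨ +-monoʳ-≤ (m′ + f) (m≤m+n (2 * x) 1) ⟩
            m′ + f + (2 * x + 1)            ∎)
            where
            open ≤-Reasoning
            l₁ : ∀ B y x → suc (B + 2 * y) + (2 * x + 1) ≡ suc (B + 2 * x) + (2 * y + 1)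
            l₁ = solve-∀
            l₂ : ∀ m f d → m + suc f + (2 * d + 1) ≡ (m + 2 * d) + (f + 2)
            l₂ = solve-∀
            l₃ : ∀ m f d → (m + 2 * d) + (f + 2) ≡ (m + f) + 2 * suc d
            l₃ = solve-∀
        continue : (∃[ ψ ] (∀ w → (ψ w <ᵇ K) ≡ (χ′ w <ᵇ K)) ×
          ∃[ u ] (χ′ u <ᵇ K) ≡ true × (∀ l → l < K → N * deg a (level ψ l) u < M * b l)) → _
        continue (ψ , same , u , u∈ , all) =
          ψ , (λ w → trans (same w) (below w)) , u , trans (sym (below u)) u∈ , all
          where below = recolour-below K χ v j i<K j<K

      -- When no move raises the potential, a single vertex is deficient towards all classes
      -- simultaneously. The classes partition `s`, so its degrees into them add up to its degree in
      -- `s`, and integrality can be exploited in each class separately.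
      common-deficient : 0 < K → ∀ s → # s ≡ suc (Σ< K b) →
        ∃[ v ] s v ≡ true × ∃[ d ] deg a s v ≡ Σ< K d × (∀ j → j < K → N * d j < M * b j)
      common-deficient 0<K s eq = finish (refine fuel χ 0 0<K (sizes 0 0<K)
          (λ { zero _ 0≢0 → contradiction refl 0≢0 ; (suc j) j<K _ → sizes (suc j) j<K })
          (m≤n+m (suc B) (N * mono K χ)))
        where
        -- The floating vertex starts in class 0.
        b⁺ : ℕ → ℕ
        b⁺ j = ⟦ 0 ≡ᵇ j ⟧ + b j
        coloured = colouring K b⁺ s (trans eq (sym (trans (Σ<-+ K (λ j → ⟦ 0 ≡ᵇ j ⟧) b)
          (cong (_+ Σ< K b) (Σ<-δ K 0 0<K)))))
        χ = proj₁ coloured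
        χ<K = proj₁ (proj₂ coloured)
        sizes = proj₂ (proj₂ coloured)
        B = N * (n * (n * 1)) + 2 * (M * b 0)
        -- This much fuel makes the invariant true whatever the initial value of `mono` is.
        fuel = suc B
        finish : (∃[ ψ ] (∀ w → (ψ w <ᵇ K) ≡ (χ w <ᵇ K)) ×
          ∃[ v ] (χ v <ᵇ K) ≡ true × (∀ j → j < K → N * deg a (level ψ j) v < M * b j)) → _
        finish (ψ , same , v , v∈ , all) = v , trans (sym (χ<K v)) v∈ ,
          (λ j → deg a (level ψ j) v) ,
          trans (#-cong λ w → cong (a v w ∧_) (sym (trans (same w) (χ<K w)))) (#-split (a v) ψ K) ,
          all

  -- R / N is a lower bound for the fractional part, taken in (0, 1], of p u with p = M / N.
  record Gap (N M u R : ℕ) : Set where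
    constructor mkGap
    field
      raise : ∀ d → N * d < M * u → N * d + R ≤ M * u

  -- Deleting deficient vertices down to order `k`

  module Descent {n : ℕ} (a : Fin n → Fin n → Bool)
    (a-sym : ∀ v w → a v w ≡ a w v) (a-irr : ∀ v → a v v ≡ false) where

    open Edges a a-sym a-irr

    module _ (N M k : ℕ)
      (deficient : ∀ s → k < # s → ∃[ v ] s v ≡ true × N * deg a s v < M * (# s ∸ 1))
      where

      -- κ classes of base size u and one of base size w.
      deficient-vertex : ∀ {u R} → k ≤ u → Gap N M u R → ∀ κ w → k ≤ w → ∀ s → # s ≡ suc (w + κ * u) →
        ∃[ v ] s v ≡ true × N * deg a s v + κ * R ≤ M * (w + κ * u)
      deficient-vertex {u} {R} k≤u gap κ w k≤w s eq =
        finish (common-deficient N M (suc κ) b small z<s s (trans eq (cong suc (sym (total κ)))))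
        where
        b : ℕ → ℕ
        b zero    = w
        b (suc _) = u
        k≤b : ∀ j → k ≤ b j
        k≤b zero    = k≤w
        k≤b (suc _) = k≤u
        total : ∀ κ → Σ< (suc κ) b ≡ w + κ * u
        total zero    = sym (+-identityʳ w)
        total (suc κ) = trans (cong (_+ u) (total κ)) (lem w (κ * u) u)
          where
          lem : ∀ w x u → w + x + u ≡ w + (u + x)
          lem = solve-∀
        small : ∀ j → j < suc κ → ∀ t → # t ≡ suc (b j) → ∃[ v ] t v ≡ true × N * deg a t v < M * b j
        small j _ t #t with deficient t (subst (k <_) (sym #t) (s≤s (k≤b j)))
        ... | v , v∈t , lt = v , v∈t , subst (λ m → N * deg a t v < M * (m ∸ 1)) #t lt
        finish : (∃[ v ] s v ≡ true × ∃[ d ] deg a s v ≡ Σ< (suc κ) d ×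
          (∀ j → j < suc κ → N * d j < M * b j)) → _
        finish (v , v∈s , d , split , lt) = v , v∈s , (begin
          N * deg a s v + κ * R          ≡⟨ cong (λ x → N * x + κ * R) split ⟩
          N * Σ< (suc κ) d + κ * R     ≡⟨ cong (_+ κ * R) (Σ<-* (suc κ) N d) ⟨
          Σ< (suc κ) (λ j → N * d j) + κ * R ≤⟨ gains κ (λ j j<K → lt j j<K) ⟩
          Σ< (suc κ) (λ j → M * b j)   ≡⟨ Σ<-* (suc κ) M b ⟩
          M * Σ< (suc κ) b             ≡⟨ cong (M *_) (total κ) ⟩
          M * (w + κ * u)              ∎)
          where
          open ≤-Reasoning
          lem : ∀ x y z w → x + y + (z + w) ≡ x + w + (y + z)
          lem = solve-∀
          gains : ∀ κ → (∀ j → j < suc κ → N * d j < M * b j) →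
            Σ< (suc κ) (λ j → N * d j) + κ * R ≤ Σ< (suc κ) (λ j → M * b j)
          -- Class 0 only absorbs the vertices that the `κ` equal classes leave over; its own
          -- rounding gain is ignored.
          gains zero    lt = ≤-trans (≤-reflexive (+-identityʳ (N * d 0))) (<⇒≤ (lt 0 z<s))
          gains (suc κ) lt = begin
            Σ< (suc κ) (λ j → N * d j) + N * d (suc κ) + (R + κ * R)
              ≡⟨ lem (Σ< (suc κ) (λ j → N * d j)) (N * d (suc κ)) R (κ * R) ⟩
            (Σ< (suc κ) (λ j → N * d j) + κ * R) + (N * d (suc κ) + R)
              ≤⟨ +-mono-≤ (gains κ (λ j j<K → lt j (m<n⇒m<1+n j<K)))
                   (Gap.raise gap (d (suc κ)) (lt (suc κ) ≤-refl)) ⟩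
            Σ< (suc κ) (λ j → M * b j) + M * b (suc κ) ∎

      -- `G` is the guaranteed excess of N e₂ over M times the number of ordered pairs. The latter
      -- term drops by 2 M m and the former by 2 N deg, so a deficiency of `g` adds 2 g to the
      -- excess.
      remove : ∀ G m g s v → s v ≡ true → # s ≡ suc m → N * deg a s v + g ≤ M * m →
        M * (suc m * m) + G ≤ N * e₂ s →
        # (s ∖ v) ≡ m × M * (m * (m ∸ 1)) + (G + 2 * g) ≤ N * e₂ (s ∖ v)
      remove G m g s v v∈s #s low dense = suc-injective (trans (sym (#-∖ s v v∈s)) #s) ,
        +-cancelʳ-≤ (2 * (N * deg a s v)) _ _ (begin
          M * (m * (m ∸ 1)) + (G + 2 * g) + 2 * (N * deg a s v)
            ≡⟨ l₁ (M * (m * (m ∸ 1))) G g (N * deg a s v) ⟩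
          M * (m * (m ∸ 1)) + 2 * (N * deg a s v + g) + G
            ≤⟨ +-monoˡ-≤ G (+-monoʳ-≤ (M * (m * (m ∸ 1))) (*-monoʳ-≤ 2 low)) ⟩
          M * (m * (m ∸ 1)) + 2 * (M * m) + G                   ≡⟨ cong (_+ G) (l₂ M m) ⟩
          M * (suc m * m) + G                                   ≤⟨ dense ⟩
          N * e₂ s                                              ≡⟨ cong (N *_) (e₂-∖ s v v∈s) ⟩
          N * (e₂ (s ∖ v) + 2 * deg a s v)                        ≡⟨ l₃ N _ (deg a s v) ⟩
          N * e₂ (s ∖ v) + 2 * (N * deg a s v)                    ∎)
        where
        open ≤-Reasoning
        l₁ : ∀ x G g d → x + (G + 2 * g) + 2 * d ≡ x + 2 * (d + g) + G
        l₁ = solve-∀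
        l₂ : ∀ M m → M * (m * (m ∸ 1)) + 2 * (M * m) ≡ M * (suc m * m)
        l₂ M zero    = trans (cong₂ _+_ (*-zeroʳ M) (cong (2 *_) (*-zeroʳ M))) (sym (*-zeroʳ M))
        l₂ M (suc m) = lem M m
          where
          lem : ∀ M m → M * (suc m * m) + 2 * (M * suc m) ≡ M * (suc (suc m) * suc m)
          lem = solve-∀
        l₃ : ∀ N e d → N * (e + 2 * d) ≡ N * e + 2 * (N * d)
        l₃ = solve-∀

      e₂≤ : ∀ m s → # s ≡ m → e₂ s ≤ m * (m ∸ 1)
      e₂≤ zero s #s = ≤-trans (sum-≤ {n} 0 λ v → ≤-trans
          (sum-≤ {n} 0 λ w → empty v w) (≤-reflexive (*-zeroʳ n)))
          (≤-reflexive (*-zeroʳ n))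
        where
        empty : ∀ v w → ⟦ a v w ∧ (s v ∧ s w) ⟧ ≤ 0
        empty v w with s v in v∈s
        ... | false = ≤-reflexive (cong ⟦_⟧ (∧-zeroʳ (a v w)))
        ... | true  = contradiction (trans (sym #s) (#-∖ s v v∈s)) λ ()
      e₂≤ (suc m) s #s with #-pos s (subst (0 <_) (sym #s) z<s)
      ... | v , v∈s = begin
        e₂ s                            ≡⟨ e₂-∖ s v v∈s ⟩
        e₂ (s ∖ v) + 2 * deg a s v        ≤⟨ +-mono-≤ (e₂≤ m (s ∖ v) #s∖v) (*-monoʳ-≤ 2 (begin
          deg a s v                         ≡⟨ deg-∖ s v ⟩
          deg a (s ∖ v) v                   ≤⟨ deg≤# (s ∖ v) v ⟩
          # (s ∖ v)                       ≡⟨ #s∖v ⟩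
          m                               ∎)) ⟩
        m * (m ∸ 1) + 2 * m             ≡⟨ lem m ⟩
        suc m * m                       ∎
        where
        open ≤-Reasoning
        #s∖v : # (s ∖ v) ≡ m
        #s∖v = suc-injective (trans (sym (#-∖ s v v∈s)) #s)
        lem : ∀ m → m * (m ∸ 1) + 2 * m ≡ suc m * m
        lem zero    = refl
        lem (suc m) = lem′ m
          where
          lem′ : ∀ m → suc m * m + 2 * suc m ≡ suc (suc m) * suc m
          lem′ = solve-∀

      -- With no room left for the parts, a deletion is only used not to lose excess. At `k`
      -- vertices the edges number at most those of a complete graph, which bounds the accumulated
      -- `G`.
      descend₀ : ∀ x G s → # s ≡ x + k → M * ((x + k) * (x + k ∸ 1)) + G ≤ N * e₂ s →
        M * (k * (k ∸ 1)) + G ≤ N * (k * (k ∸ 1))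
      descend₀ zero    G s #s dense = ≤-trans dense (*-monoʳ-≤ N (e₂≤ k s #s))
      descend₀ (suc x) G s #s dense with deficient s (subst (k <_) (sym #s) (s≤s (m≤n+m k x)))
      ... | v , v∈s , lt with remove G (x + k) 0 s v v∈s #s
                (subst₂ _≤_ (sym (+-identityʳ _)) (cong (λ m → M * (m ∸ 1)) #s) (<⇒≤ lt)) dense
      ...   | #s′ , dense′ = descend₀ x G (s ∖ v) #s′
                (subst (λ g → M * _ + g ≤ _) (+-identityʳ G) dense′)

      -- The `κ` parts of size `u` stay fixed while class 0, of base size x + k, shrinks. Each of
      -- the `x` deletions gains `κ * R`, doubled because edges are counted as ordered pairs; below
      -- k + κ u the descent continues without gain.
      descend : ∀ {u R} → k ≤ u → Gap N M u R → ∀ κ x G s → # s ≡ x + (k + κ * u) →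
        M * ((x + (k + κ * u)) * (x + (k + κ * u) ∸ 1)) + G ≤ N * e₂ s →
        M * (k * (k ∸ 1)) + (G + x * (2 * (κ * R))) ≤ N * (k * (k ∸ 1))
      descend {u} {R} k≤u gap κ zero G s #s dense = descend₀ (κ * u) _ s (trans #s (+-comm k (κ * u)))
        (subst₂ (λ m g → M * (m * (m ∸ 1)) + g ≤ N * e₂ s) (+-comm k (κ * u)) (sym (+-identityʳ G)) dense)
      descend {u} {R} k≤u gap κ (suc x) G s #s dense =
        let h = k + κ * u
            v , v∈s , low = deficient-vertex k≤u gap κ (x + k) (m≤n+m k x) s
              (trans #s (cong suc (sym (+-assoc x k (κ * u)))))
            #s′ , dense′ = remove G (x + h) (κ * R) s v v∈s #s
              (subst (λ m → N * deg a s v + κ * R ≤ M * m) (+-assoc x k (κ * u)) low) dense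
        in subst (λ g → M * (k * (k ∸ 1)) + g ≤ N * (k * (k ∸ 1)))
             (+-assoc G (2 * (κ * R)) (x * (2 * (κ * R))))
             (descend k≤u gap κ x (G + 2 * (κ * R)) (s ∖ v) #s′ dense′)

      whole : ∀ {u R} → k ≤ u → Gap N M u R → ∀ κ x → n ≡ x + (k + κ * u) →
        M * (n * (n ∸ 1)) ≤ N * e₂ (const true) →
        M * (k * (k ∸ 1)) + x * (2 * (κ * R)) ≤ N * (k * (k ∸ 1))
      whole {u} k≤u gap κ x eq dense = descend k≤u gap κ x 0 (const true) (trans #⊤ eq)
        (subst (_≤ N * e₂ (const true)) (trans (cong (λ m → M * (m * (m ∸ 1))) eq) (sym (+-identityʳ _))) dense)
        where
        #⊤ : # (λ (_ : Fin n) → true) ≡ n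
        #⊤ = trans (sum-const n 1) (*-identityʳ n)

  -- Fractional parts of multiples of the density

  gap : ∀ {N M u} q {R} → N * q + R ≡ M * u → R ≤ N → Gap N M u R
  gap {N} {M} {u} q {R} eq R≤N = mkGap raise
    where
    open ≤-Reasoning
    raise : ∀ d → N * d < M * u → N * d + R ≤ M * u
    raise d lt with d ≤? q
    ... | yes d≤q = subst (N * d + R ≤_) eq (+-monoˡ-≤ R (*-monoʳ-≤ N d≤q))
    ... | no  d≰q = contradiction lt (≤⇒≯ (begin
      M * u        ≡⟨ eq ⟨
      N * q + R    ≤⟨ +-monoʳ-≤ (N * q) R≤N ⟩
      N * q + N    ≡⟨ +-comm (N * q) N ⟩
      N + N * q    ≡⟨ *-suc N q ⟨
      N * suc q    ≤⟨ *-monoʳ-≤ N (≰⇒> d≰q) ⟩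
      N * d        ∎))

  gap-mono : ∀ {N M u R R′} → R ≤ R′ → Gap N M u R′ → Gap N M u R
  gap-mono {N} R≤R′ g = mkGap λ d lt → ≤-trans (+-monoʳ-≤ (N * d) R≤R′) (Gap.raise g d lt)

  -- The remainder is taken in (0, N] instead of [0, N): an integral p u counts as fractional part
  -- 1, since a degree strictly below an integer is below it by at least 1.
  divide : ∀ N x → 0 < N → 0 < x → ∃[ q ] ∃[ r ] N * q + r ≡ x × 0 < r × r ≤ N
  divide N@(suc _) (suc x) _ _ = x / N , suc (x % N) , eq , z<s , m%n<n x N
    where
    eq : N * (x / N) + suc (x % N) ≡ suc x
    eq = begin
      N * (x / N) + suc (x % N)    ≡⟨ +-comm (N * (x / N)) _ ⟩
      suc (x % N + N * (x / N))    ≡⟨ cong (λ y → suc (x % N + y)) (*-comm N (x / N)) ⟩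
      suc (x % N + x / N * N)      ≡⟨ cong suc (m≡m%n+[m/n]*n x N) ⟨
      suc x                        ∎
      where open ≡-Reasoning

  -- The fractional parts of pk and p(k+1) are not both smaller than 1 - p ≤ p.
  dense-gap : ∀ N M k → 0 < k → M < N → N ≤ 2 * M →
    ∃[ u ] k ≤ u × u ≤ suc k × Gap N M u (N ∸ M)
  dense-gap N M k 0<k M<N N≤2M with divide N (M * k) (≤-<-trans z≤n M<N) (*-mono-< {0} 0<M 0<k)
    where
    0<M : 0 < M
    0<M = *-cancelˡ-< 2 0 M (<-≤-trans (≤-<-trans z≤n M<N) N≤2M)
  ... | q , r , eq , _ , r≤N with N ∸ M ≤? r
  ...   | yes le = k , ≤-refl , n≤1+n k , gap-mono le (gap {N} q eq r≤N)
  -- Passing to k + 1 adds `M` to the remainder: `r` < N - M prevents overflow beyond `N`, and the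
  -- result is at least M >= N - M.
  ...   | no  lt = suc k , n≤1+n k , ≤-refl , gap-mono N∸M≤ (gap {N} q eq′ r+M≤N)
    where
    open ≤-Reasoning
    r+M≤N : r + M ≤ N
    r+M≤N = begin
      r + M        ≤⟨ +-monoˡ-≤ M (<⇒≤ (≰⇒> lt)) ⟩
      N ∸ M + M    ≡⟨ m∸n+n≡m (<⇒≤ M<N) ⟩
      N            ∎
    N∸M≤ : N ∸ M ≤ r + M
    N∸M≤ = begin
      N ∸ M        ≤⟨ ∸-monoˡ-≤ M N≤2M ⟩
      2 * M ∸ M    ≡⟨ cong (_∸ M) (cong (M +_) (+-identityʳ M)) ⟩
      M + M ∸ M    ≡⟨ m+n∸n≡m M M ⟩
      M            ≤⟨ m≤n+m M r ⟩
      r + M        ∎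
    eq′ : N * q + (r + M) ≡ M * suc k
    eq′ = trans (sym (+-assoc (N * q) r M)) (trans (cong (_+ M) eq) (trans (+-comm (M * k) M) (sym (*-suc M k))))

  -- While the fractional part of pu stays below 1/2 it grows by p at each step.
  sparse-gap : ∀ N M k a → 0 < k → 0 < M → 2 * M < N → N ≤ 2 * (a * M) →
    ∃[ u ] k ≤ u × u ≤ k + a × Gap (2 * N) (2 * M) u N
  sparse-gap N M k a 0<k 0<M 2M<N N≤2aM = conclude (search a)
    where
    -- Doubling numerator and denominator leaves the density unchanged and makes half of the
    -- denominator the natural number `N`.
    found : ∀ u q r → N * q + r ≡ M * u → r ≤ N → N ≤ 2 * r → Gap (2 * N) (2 * M) u N
    found u q r eq r≤N N≤2r = gap-mono N≤2r (gap {2 * N} q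
      (trans (lem N q r) (trans (cong (2 *_) eq) (sym (*-assoc 2 M u)))) (*-monoʳ-≤ 2 r≤N))
      where
      lem : ∀ N q r → 2 * N * q + 2 * r ≡ 2 * (N * q + r)
      lem = solve-∀
    -- State of the search after `j` failures: the remainder has collected j * M and is still below
    -- N / 2. This is impossible at `a`, where 2 a M >= N.
    Low : ℕ → Set
    Low j = ∃[ q ] ∃[ r ] N * q + r ≡ M * (k + j) × j * M ≤ r × 2 * r < N
    search : ∀ j → (∃[ u ] k ≤ u × u ≤ k + j × Gap (2 * N) (2 * M) u N) ⊎ Low j
    search zero with divide N (M * k) (≤-<-trans z≤n 2M<N) (*-mono-< {0} 0<M 0<k)
    ... | q , r , eq , _ , r≤N with N ≤? 2 * r
    ...   | yes le = inj₁ (k , ≤-refl , m≤m+n k 0 , found k q r eq r≤N le)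
    ...   | no  lt = inj₂ (q , r , trans eq (cong (M *_) (sym (+-identityʳ k))) , z≤n , ≰⇒> lt)
    search (suc j) with search j
    ... | inj₁ (u , k≤u , u≤ , g) = inj₁ (u , k≤u , ≤-trans u≤ (+-monoʳ-≤ k (n≤1+n j)) , g)
    ... | inj₂ (q , r , eq , jM≤r , 2r<N) with N ≤? 2 * (M + r)
    ...   | yes le = inj₁ (k + suc j , m≤m+n k (suc j) , ≤-refl ,
                       found (k + suc j) q (M + r) eq′ M+r≤N le)
      where
      lem : ∀ N q M r → N * q + (M + r) ≡ M + (N * q + r)
      lem = solve-∀
      eq′ : N * q + (M + r) ≡ M * (k + suc j)
      eq′ = trans (lem N q M r) (trans (cong (M +_) eq) (trans (sym (*-suc M (k + j))) (cong (M *_) (sym (+-suc k j)))))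
      M+r≤N : M + r ≤ N
      M+r≤N = *-cancelˡ-≤ 2 (begin
        2 * (M + r)    ≡⟨ *-distribˡ-+ 2 M r ⟩
        2 * M + 2 * r  ≤⟨ +-mono-≤ (<⇒≤ 2M<N) (<⇒≤ 2r<N) ⟩
        N + N          ≡⟨ cong (N +_) (+-identityʳ N) ⟨
        2 * N          ∎)
        where open ≤-Reasoning
    ...   | no  lt = inj₂ (q , M + r , eq′ , +-monoʳ-≤ M jM≤r , ≰⇒> lt)
      where
      lem : ∀ N q M r → N * q + (M + r) ≡ M + (N * q + r)
      lem = solve-∀
      eq′ : N * q + (M + r) ≡ M * (k + suc j)
      eq′ = trans (lem N q M r) (trans (cong (M +_) eq) (trans (sym (*-suc M (k + j))) (cong (M *_) (sym (+-suc k j)))))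
    conclude : (∃[ u ] k ≤ u × u ≤ k + a × Gap (2 * N) (2 * M) u N) ⊎ Low a → _
    conclude (inj₁ r) = r
    conclude (inj₂ (q , r , _ , aM≤r , 2r<N)) =
      contradiction (≤-trans N≤2aM (*-monoʳ-≤ 2 aM≤r)) (<⇒≱ 2r<N)

  -- Choosing the number and size of the parts

  Descends : (n N M k : ℕ) → Set
  Descends n N M k = ∀ {u R} → k ≤ u → Gap N M u R → ∀ κ x → n ≡ x + (k + κ * u) →
    M * (k * (k ∸ 1)) + x * (2 * (κ * R)) ≤ N * (k * (k ∸ 1))

  k[k-1]≤ : ∀ k → k * (k ∸ 1) ≤ suc k * suc k
  k[k-1]≤ k = *-mono-≤ (n≤1+n k) (≤-trans (m∸n≤m k 1) (n≤1+n k))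

  cube : ℕ → ℕ
  cube x = x * (x * x)

  cube-mono : ∀ {x y} → x ≤ y → cube x ≤ cube y
  cube-mono le = *-mono-≤ le (*-mono-≤ le le)

  -- The total gain is proportional to the product of the number `κ` of parts and the number of
  -- gaining deletions. Giving the parts at most half of the vertices makes the first of order n / Y
  -- and leaves the second of order n.
  half-quotient : ∀ n Y → 0 < Y → ∃[ κ ] 2 * (κ * Y) ≤ n × n < 2 * (κ * Y) + 2 * Y
  half-quotient n (suc y) _ = κ , le , lt
    where
    Y = suc y
    κ = n / (2 * Y)
    lem : ∀ κ Y → κ * (2 * Y) ≡ 2 * (κ * Y)
    lem = solve-∀
    le : 2 * (κ * Y) ≤ n
    le = subst (_≤ n) (lem κ Y) (m/n*n≤m n (2 * Y))
    lt : n < 2 * (κ * Y) + 2 * Y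
    lt = begin-strict
      n                            ≡⟨ m≡m%n+[m/n]*n n (2 * Y) ⟩
      n % (2 * Y) + κ * (2 * Y)    <⟨ +-monoˡ-< (κ * (2 * Y)) (m%n<n n (2 * Y)) ⟩
      2 * Y + κ * (2 * Y)          ≡⟨ +-comm (2 * Y) _ ⟩
      κ * (2 * Y) + 2 * Y          ≡⟨ cong (_+ 2 * Y) (lem κ Y) ⟩
      2 * (κ * Y) + 2 * Y          ∎
      where open ≤-Reasoning

  -- The gain per part and the final excess both carry the factor N - M. Cancelling it leaves 2 x κ
  -- <= k (k - 1), while x >= n / 4 and κ z > n / 4 for z = k + 1; together n² <= 8 z³, against the
  -- assumed n² > 256 z³. The constant is 4 * 64 because 1 - p <= 1/2 returns a factor 4 in
  -- `order-bound`.
  dense-bound : ∀ n N M k → 0 < k → M < N → N ≤ 2 * M → Descends n N M k →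
    n * n ≤ 256 * cube (suc k)
  dense-bound n N M k 0<k M<N N≤2M desc with n * n ≤? 256 * cube (suc k)
  ... | yes le = le
  ... | no  gt = contradiction (begin-strict
      n * n                   ≤⟨ *-mono-≤ n≤4x (<⇒≤ n<4κz) ⟩
      4 * x * (4 * (κ * z))   ≡⟨ l₁ x κ z ⟩
      8 * z * (x * (2 * κ))   ≤⟨ *-monoʳ-≤ (8 * z) final ⟩
      8 * z * (k * (k ∸ 1))   ≤⟨ *-monoʳ-≤ (8 * z) (k[k-1]≤ k) ⟩
      8 * z * (z * z)         ≡⟨ *-assoc 8 z (z * z) ⟩
      8 * cube z              ≤⟨ *-monoˡ-≤ (cube z) (m≤m+n 8 248) ⟩
      256 * cube z            <⟨ big ⟩
      n * n                   ∎) (<-irrefl refl)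
    where
    open ≤-Reasoning
    z = suc k
    big : 256 * cube z < n * n
    big = ≰⇒> gt
    l₁ : ∀ x κ z → 4 * x * (4 * (κ * z)) ≡ 8 * z * (x * (2 * κ))
    l₁ = solve-∀
    4z≤n : 4 * z ≤ n
    4z≤n with 4 * z ≤? n
    ... | yes le = le
    ... | no  nle = contradiction (begin-strict
      n * n               ≤⟨ *-mono-≤ (<⇒≤ (≰⇒> nle)) (<⇒≤ (≰⇒> nle)) ⟩
      4 * z * (4 * z)     ≡⟨ l z ⟩
      16 * (1 * (z * z))  ≤⟨ *-mono-≤ (m≤m+n 16 240) (*-monoˡ-≤ (z * z) (s≤s (z≤n {k}))) ⟩
      256 * cube z        <⟨ big ⟩
      n * n               ∎) (<-irrefl refl)
      where
      l : ∀ z → 4 * z * (4 * z) ≡ 16 * (1 * (z * z))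
      l = solve-∀
    found = dense-gap N M k 0<k M<N N≤2M
    u = proj₁ found
    quotient = half-quotient n z z<s
    κ = proj₁ quotient
    κu≤κz : κ * u ≤ κ * z
    κu≤κz = *-monoʳ-≤ κ (proj₁ (proj₂ (proj₂ found)))
    h≤n : k + κ * u ≤ n
    h≤n = *-cancelˡ-≤ 2 (begin
      2 * (k + κ * u)          ≡⟨ *-distribˡ-+ 2 k (κ * u) ⟩
      2 * k + 2 * (κ * u)      ≤⟨ +-mono-≤ (*-mono-≤ (m≤m+n 2 2) (n≤1+n k)) (*-monoʳ-≤ 2 κu≤κz) ⟩
      4 * z + 2 * (κ * z)      ≤⟨ +-mono-≤ 4z≤n (proj₁ (proj₂ quotient)) ⟩
      n + n                    ≡⟨ cong (n +_) (+-identityʳ n) ⟨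
      2 * n                    ∎)
    x = n ∸ (k + κ * u)
    n≡ : n ≡ x + (k + κ * u)
    n≡ = sym (m∸n+n≡m h≤n)
    n≤4x : n ≤ 4 * x
    n≤4x = +-cancelʳ-≤ (n + 2 * n) _ _ (begin
      n + (n + 2 * n)                        ≡⟨ l₂ n ⟩
      4 * n                                  ≡⟨ cong (4 *_) n≡ ⟩
      4 * (x + (k + κ * u))                  ≡⟨ l₃ x k (κ * u) ⟩
      4 * x + (4 * k + 2 * (2 * (κ * u)))
        ≤⟨ +-monoʳ-≤ (4 * x) (+-mono-≤ (≤-trans (*-monoʳ-≤ 4 (n≤1+n k)) 4z≤n)
            (*-monoʳ-≤ 2 (≤-trans (*-monoʳ-≤ 2 κu≤κz) (proj₁ (proj₂ quotient))))) ⟩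
      4 * x + (n + 2 * n)                    ∎)
      where
      l₂ : ∀ n → n + (n + 2 * n) ≡ 4 * n
      l₂ = solve-∀
      l₃ : ∀ x k y → 4 * (x + (k + y)) ≡ 4 * x + (4 * k + 2 * (2 * y))
      l₃ = solve-∀
    n<4κz : n < 4 * (κ * z)
    n<4κz = +-cancelʳ-< n _ _ (begin-strict
      n + n
        <⟨ +-mono-< (proj₂ (proj₂ quotient)) (proj₂ (proj₂ quotient)) ⟩
      2 * (κ * z) + 2 * z + (2 * (κ * z) + 2 * z) ≡⟨ l₂ (κ * z) z ⟩
      4 * (κ * z) + 4 * z                    ≤⟨ +-monoʳ-≤ (4 * (κ * z)) 4z≤n ⟩
      4 * (κ * z) + n                        ∎)
      where
      l₂ : ∀ y z → 2 * y + 2 * z + (2 * y + 2 * z) ≡ 4 * y + 4 * z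
      l₂ = solve-∀
    R = N ∸ M
    final : x * (2 * κ) ≤ k * (k ∸ 1)
    final = *-cancelˡ-≤ R {{>-nonZero (m<n⇒0<n∸m M<N)}}
      (+-cancelˡ-≤ (M * (k * (k ∸ 1))) _ _ (begin
        M * (k * (k ∸ 1)) + R * (x * (2 * κ))   ≡⟨ cong (M * (k * (k ∸ 1)) +_) (l₂ R x κ) ⟩
        M * (k * (k ∸ 1)) + x * (2 * (κ * R))
          ≤⟨ desc (proj₁ (proj₂ found)) (proj₂ (proj₂ (proj₂ found))) κ x n≡ ⟩
        N * (k * (k ∸ 1))                       ≡⟨ cong (_* (k * (k ∸ 1))) (m+[n∸m]≡n (<⇒≤ M<N)) ⟨
        (M + R) * (k * (k ∸ 1))                 ≡⟨ *-distribʳ-+ (k * (k ∸ 1)) M R ⟩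
        M * (k * (k ∸ 1)) + R * (k * (k ∸ 1))   ∎))
      where
      l₂ : ∀ R x κ → R * (x * (2 * κ)) ≡ x * (2 * (κ * R))
      l₂ = solve-∀

  -- `suc y` is 1/(2p) rounded up: the number of steps in which increments of p add up to at least
  -- 1/2.
  ceiling : ∀ N M → 0 < M → 0 < N → ∃[ y ] 2 * (y * M) < N × N ≤ 2 * (suc y * M)
  ceiling N M 0<M 0<N with divide (2 * M) N (*-mono-< {0} {2} z<s 0<M) 0<N
  ... | y , r , eq , 0<r , r≤2M = y , lt , le
    where
    open ≤-Reasoning
    lem : ∀ y M → 2 * M * y ≡ 2 * (y * M)
    lem = solve-∀
    lem₂ : ∀ y M → 2 * (y * M) + 2 * M ≡ 2 * (suc y * M)
    lem₂ = solve-∀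
    lt : 2 * (y * M) < N
    lt = begin-strict
      2 * (y * M)       ≡⟨ lem y M ⟨
      2 * M * y         ≡⟨ +-identityʳ _ ⟨
      2 * M * y + 0     <⟨ +-monoʳ-< (2 * M * y) 0<r ⟩
      2 * M * y + r     ≡⟨ eq ⟩
      N                 ∎
    le : N ≤ 2 * (suc y * M)
    le = begin
      N                       ≡⟨ eq ⟨
      2 * M * y + r           ≤⟨ +-mono-≤ (≤-reflexive (lem y M)) r≤2M ⟩
      2 * (y * M) + 2 * M     ≡⟨ lem₂ y M ⟩
      2 * (suc y * M)         ∎

  -- Part sizes are at most Y = z + y, where z = k + 1 and 2 y < 1/p < n^(2/3). If n² > 64 z³, then
  -- 3 n <= 8 x, n < 8 κ Y and x κ <= z² give 3 n² <= 64 Y z² = 4 Y (4 z)², which is at most 3 t³ <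
  -- 3 n² for t the larger of 4 z and 2 y. The bound (4 z)³ < n² is where 64 comes from.
  sparse-bound : ∀ n N M k → 0 < k → 2 * M < N → cube N < cube M * (n * n) →
    Descends n (2 * N) (2 * M) k → n * n ≤ 64 * cube (suc k)
  sparse-bound n N M k 0<k 2M<N p-large desc with n * n ≤? 64 * cube (suc k)
  ... | yes le = le
  ... | no  gt = contradiction (begin-strict
      3 * (n * n)                   ≡⟨ *-assoc 3 n n ⟨
      3 * n * n                     ≤⟨ *-mono-≤ 3n≤8x (<⇒≤ n<8κY) ⟩
      8 * x * (8 * (κ * Y))         ≡⟨ l₁ x κ Y ⟩
      64 * Y * (x * κ)              ≤⟨ *-monoʳ-≤ (64 * Y) final ⟩
      64 * Y * (k * (k ∸ 1))        ≤⟨ *-monoʳ-≤ (64 * Y) (k[k-1]≤ k) ⟩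
      64 * Y * (z * z)              ≡⟨ l₂ Y z ⟩
      4 * Y * (4 * z * (4 * z))     ≤⟨ *-mono-≤ 4Y≤3t (*-mono-≤ 4z≤t 4z≤t) ⟩
      3 * t * (t * t)               ≡⟨ *-assoc 3 t (t * t) ⟩
      3 * cube t                    <⟨ *-monoʳ-< 3 t³<n² ⟩
      3 * (n * n)                   ∎) (<-irrefl refl)
    where
    open ≤-Reasoning
    z = suc k
    big : 64 * cube z < n * n
    big = ≰⇒> gt
    l₁ : ∀ x κ Y → 8 * x * (8 * (κ * Y)) ≡ 64 * Y * (x * κ)
    l₁ = solve-∀
    l₂ : ∀ Y z → 64 * Y * (z * z) ≡ 4 * Y * (4 * z * (4 * z))
    l₂ = solve-∀
    0<N : 0 < N
    0<N = ≤-<-trans z≤n 2M<N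
    0<M : 0 < M
    0<M = pos M p-large
      where
      pos : ∀ M → cube N < cube M * (n * n) → 0 < M
      pos (suc _) _ = z<s
    ceil = ceiling N M 0<M 0<N
    y = proj₁ ceil
    found = sparse-gap N M k (suc y) 0<k 0<M 2M<N (proj₂ (proj₂ ceil))
    u = proj₁ found
    Y = z + y
    -- A common measure for the two contributions to a part size, `k` and the search for a good `u`:
    -- the cubes of 4 z and of 2 y are both below n², the first by assumption and the second by p >
    -- n^(-2/3).
    t = 4 * z ⊔ 2 * y
    4z≤t : 4 * z ≤ t
    4z≤t = m≤m⊔n (4 * z) (2 * y)
    2y≤t : 2 * y ≤ t
    2y≤t = m≤n⊔m (4 * z) (2 * y)
    4Y≤3t : 4 * Y ≤ 3 * t
    4Y≤3t = begin
      4 * (z + y)              ≡⟨ l z y ⟩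
      4 * z + 2 * (2 * y)      ≤⟨ +-mono-≤ 4z≤t (*-monoʳ-≤ 2 2y≤t) ⟩
      3 * t                    ∎
      where
      l : ∀ z y → 4 * (z + y) ≡ 4 * z + 2 * (2 * y)
      l = solve-∀
    t³<n² : cube t < n * n
    t³<n² with ⊔-sel (4 * z) (2 * y)
    ... | inj₁ eq = subst (λ t → cube t < n * n) (sym eq) (subst (_< n * n) (l z) big)
      where
      l : ∀ z → 64 * (z * (z * z)) ≡ 4 * z * (4 * z * (4 * z))
      l = solve-∀
    ... | inj₂ eq = subst (λ t → cube t < n * n) (sym eq) (*-cancelˡ-< (cube M) _ _ (begin-strict
      cube M * cube (2 * y)    ≡⟨ l M y ⟩
      cube (2 * (y * M))       ≤⟨ cube-mono (<⇒≤ (proj₁ (proj₂ ceil))) ⟩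
      cube N                   <⟨ p-large ⟩
      cube M * (n * n)         ∎))
      where
      l : ∀ M y → M * (M * M) * (2 * y * (2 * y * (2 * y))) ≡
        2 * (y * M) * (2 * (y * M) * (2 * (y * M)))
      l = solve-∀
    4≤t : 4 ≤ t
    4≤t = ≤-trans (*-monoʳ-≤ 4 (s≤s (z≤n {k}))) 4z≤t
    -- As 4 <= t, the square of 2 t is at most t³, hence below n².
    2t≤n : 2 * t ≤ n
    2t≤n with 2 * t ≤? n
    ... | yes le = le
    ... | no nle = contradiction (begin-strict
      n * n              ≤⟨ *-mono-≤ (<⇒≤ (≰⇒> nle)) (<⇒≤ (≰⇒> nle)) ⟩
      2 * t * (2 * t)    ≡⟨ l t ⟩
      4 * (t * t)        ≤⟨ *-monoˡ-≤ (t * t) 4≤t ⟩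
      cube t             <⟨ t³<n² ⟩
      n * n              ∎) (<-irrefl refl)
      where
      l : ∀ t → 2 * t * (2 * t) ≡ 4 * (t * t)
      l = solve-∀
    quotient = half-quotient n Y z<s
    κ = proj₁ quotient
    κu≤κY : κ * u ≤ κ * Y
    κu≤κY = *-monoʳ-≤ κ (≤-trans (proj₁ (proj₂ (proj₂ found))) (≤-reflexive (+-suc k y)))
    h≤n : k + κ * u ≤ n
    h≤n = *-cancelˡ-≤ 2 (begin
      2 * (k + κ * u)          ≡⟨ *-distribˡ-+ 2 k (κ * u) ⟩
      2 * k + 2 * (κ * u)      ≤⟨ +-mono-≤ (*-mono-≤ (m≤m+n 2 2) (n≤1+n k)) (*-monoʳ-≤ 2 κu≤κY) ⟩
      4 * z + 2 * (κ * Y)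
        ≤⟨ +-mono-≤ (≤-trans 4z≤t (≤-trans (m≤n*m t 2) 2t≤n)) (proj₁ (proj₂ quotient)) ⟩
      n + n                    ≡⟨ cong (n +_) (+-identityʳ n) ⟨
      2 * n                    ∎)
    x = n ∸ (k + κ * u)
    n≡ : n ≡ x + (k + κ * u)
    n≡ = sym (m∸n+n≡m h≤n)
    3n≤8x : 3 * n ≤ 8 * x
    3n≤8x = +-cancelʳ-≤ (n + 4 * n) _ _ (begin
      3 * n + (n + 4 * n)                    ≡⟨ l₃ n ⟩
      8 * n                                  ≡⟨ cong (8 *_) n≡ ⟩
      8 * (x + (k + κ * u))                  ≡⟨ l₄ x k (κ * u) ⟩
      8 * x + (2 * (4 * k) + 4 * (2 * (κ * u)))
        ≤⟨ +-monoʳ-≤ (8 * x) (+-mono-≤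
            (≤-trans (*-monoʳ-≤ 2 (≤-trans (*-monoʳ-≤ 4 (n≤1+n k)) 4z≤t)) 2t≤n)
            (*-monoʳ-≤ 4 (≤-trans (*-monoʳ-≤ 2 κu≤κY) (proj₁ (proj₂ quotient))))) ⟩
      8 * x + (n + 4 * n)                    ∎)
      where
      l₃ : ∀ n → 3 * n + (n + 4 * n) ≡ 8 * n
      l₃ = solve-∀
      l₄ : ∀ x k y → 8 * (x + (k + y)) ≡ 8 * x + (2 * (4 * k) + 4 * (2 * y))
      l₄ = solve-∀
    n<8κY : n < 8 * (κ * Y)
    n<8κY = +-cancelʳ-< (3 * n) _ _ (begin-strict
      n + 3 * n                          ≡⟨⟩
      4 * n                              <⟨ *-monoʳ-< 4 (proj₂ (proj₂ quotient)) ⟩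
      4 * (2 * (κ * Y) + 2 * Y)          ≡⟨ l₃ (κ * Y) Y ⟩
      8 * (κ * Y) + 2 * (4 * Y)          ≤⟨ +-monoʳ-≤ (8 * (κ * Y)) (*-monoʳ-≤ 2 4Y≤3t) ⟩
      8 * (κ * Y) + 2 * (3 * t)          ≡⟨ cong (8 * (κ * Y) +_) (l₄ t) ⟩
      8 * (κ * Y) + 3 * (2 * t)          ≤⟨ +-monoʳ-≤ (8 * (κ * Y)) (*-monoʳ-≤ 3 2t≤n) ⟩
      8 * (κ * Y) + 3 * n                ∎)
      where
      l₃ : ∀ w Y → 4 * (2 * w + 2 * Y) ≡ 8 * w + 2 * (4 * Y)
      l₃ = solve-∀
      l₄ : ∀ t → 2 * (3 * t) ≡ 3 * (2 * t)
      l₄ = solve-∀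
    -- The term with `M` is dropped; for p < 1/2 this costs at most a factor 2.
    final : x * κ ≤ k * (k ∸ 1)
    final = *-cancelˡ-≤ (2 * N) {{>-nonZero (*-mono-< {0} {2} z<s 0<N)}} (begin
      2 * N * (x * κ)                             ≡⟨ l₃ N x κ ⟩
      x * (2 * (κ * N))                           ≤⟨ m≤n+m _ (2 * M * (k * (k ∸ 1))) ⟩
      2 * M * (k * (k ∸ 1)) + x * (2 * (κ * N))
        ≤⟨ desc (proj₁ (proj₂ found)) (proj₂ (proj₂ (proj₂ found))) κ x n≡ ⟩
      2 * N * (k * (k ∸ 1))                       ∎)
      where
      l₃ : ∀ N x κ → 2 * N * (x * κ) ≡ x * (2 * (κ * N))
      l₃ = solve-∀

  module _ {n : ℕ} (a : Fin n → Fin n → Bool)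
    (a-sym : ∀ v w → a v w ≡ a w v) (a-irr : ∀ v → a v v ≡ false) where

    open Edges a a-sym a-irr

    -- For p >= 1/2, (1-p)² <= 1/4 turns the constant 256 into 64. For p < 1/2, (1-p)² is bounded by
    -- 1, and the descent is run with 2 N and 2 M so that a gap of one half is integral.
    order-bound : ∀ N M k → 0 < k → M < N → cube N < cube M * (n * n) →
      (∀ s → k < # s → ∃[ v ] s v ≡ true × N * deg a s v < M * (# s ∸ 1)) →
      M * (n * (n ∸ 1)) ≤ N * e₂ (const true) →
      (N ∸ M) * (N ∸ M) * (n * n) ≤ 64 * cube (suc k) * (N * N)
    order-bound N M k 0<k M<N p-large deficient dense with N ≤? 2 * M
    ... | yes N≤2M = *-cancelˡ-≤ 4 (begin
      4 * ((N ∸ M) * (N ∸ M) * (n * n))       ≡⟨ l₁ (N ∸ M) (n * n) ⟩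
      2 * (N ∸ M) * (2 * (N ∸ M)) * (n * n)   ≤⟨ *-mono-≤ (*-mono-≤ 2R≤N 2R≤N) bound ⟩
      N * N * (256 * cube (suc k))            ≡⟨ l₂ (N * N) (cube (suc k)) ⟩
      4 * (64 * cube (suc k) * (N * N))       ∎)
      where
      open ≤-Reasoning
      bound = dense-bound n N M k 0<k M<N N≤2M
        (λ k≤u g κ x eq → Descent.whole a a-sym a-irr N M k deficient k≤u g κ x eq dense)
      l₁ : ∀ R m → 4 * (R * R * m) ≡ 2 * R * (2 * R) * m
      l₁ = solve-∀
      l₂ : ∀ m c → m * (256 * c) ≡ 4 * (64 * c * m)
      l₂ = solve-∀
      2R≤N : 2 * (N ∸ M) ≤ N
      2R≤N = begin
        2 * (N ∸ M)      ≡⟨ *-distribˡ-∸ 2 N M ⟩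
        2 * N ∸ 2 * M    ≤⟨ ∸-monoʳ-≤ (2 * N) N≤2M ⟩
        2 * N ∸ N        ≡⟨ cong (_∸ N) (cong (N +_) (+-identityʳ N)) ⟩
        N + N ∸ N        ≡⟨ m+n∸n≡m N N ⟩
        N                ∎
    ... | no N≰2M = begin
      (N ∸ M) * (N ∸ M) * (n * n)    ≤⟨ *-mono-≤ (*-mono-≤ (m∸n≤m N M) (m∸n≤m N M)) bound ⟩
      N * N * (64 * cube (suc k))    ≡⟨ *-comm (N * N) _ ⟩
      64 * cube (suc k) * (N * N)    ∎
      where
      open ≤-Reasoning
      double : ∀ x y z → x * y < z → 2 * x * y < 2 * z
      double x y z lt = subst (_< 2 * z) (sym (*-assoc 2 x y)) (*-monoʳ-< 2 lt)
      bound = sparse-bound n N M k 0<k (≰⇒> N≰2M) p-large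
        (λ k≤u g κ x eq → Descent.whole a a-sym a-irr (2 * N) (2 * M) k
          (λ s k<s → let v , v∈s , lt = deficient s k<s in v , v∈s ,
            subst (2 * N * deg a s v <_) (sym (*-assoc 2 M (# s ∸ 1))) (double N (deg a s v) _ lt))
          k≤u g κ x eq
          (subst₂ _≤_ (sym (*-assoc 2 M (n * (n ∸ 1)))) (sym (*-assoc 2 N _)) (*-monoʳ-≤ 2 dense)))

-- Graphs as matrices, existence of f, and the extremal construction

module Graphs where

  open Partitions
  open import Defs
  open import Data.Bool.Base using (Bool; true; false; _∧_; not; _∨_)
  import Data.Bool.Properties as Bool
  open import Data.Fin.Base using (Fin; zero; suc; toℕ)
  import Data.Fin.Properties as Fin
  open import Data.Fin.Subset using (Subset; _∈_; _∉_; ∣_∣; ⁅_⁆)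
  open import Data.Fin.Subset.Properties using (_∈?_; anySubset?; ∣⁅x⁆∣≡1; ∣p∣≤n)
  open import Data.Integer.Base as ℤ using (ℤ)
  import Data.Integer.Properties as ℤ
  open import Data.List.Base as List using (List; length; filter; cartesianProduct)
  open import Data.List.Properties using (filter-++; length-++; map-tabulate)
  open import Data.Nat.Base
  open import Data.Nat.Properties
  open import Data.Nat.Combinatorics using (_C_; nC1≡n; nCk+nC[k+1]≡[n+1]C[k+1])
  open import Data.Nat.Tactic.RingSolver using (solve-∀)
  open import Data.Product.Base using (_×_; _,_; ∃; ∃-syntax; proj₁; proj₂; map₂)
  open import Data.Rational.Base as ℚ using (ℚ; 0ℚ; 1ℚ)
  import Data.Rational.Properties as ℚ
  open import Data.Rational.Unnormalised.Base as ℚᵘ using (*≤*; *≡*; mkℚᵘ)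
  import Data.Rational.Unnormalised.Properties as ℚᵘ
  open import Data.Sum.Base using (_⊎_; inj₁; inj₂)
  open import Data.Vec.Base using (Vec; []; _∷_; lookup; tabulate)
  open import Data.Vec.Properties using (lookup∘tabulate; []=⇒lookup; lookup⇒[]=)
  open import Function.Base using (_∘_; const)
  open import Level using (0ℓ)
  open import Relation.Binary.Definitions using (tri<; tri≈; tri>)
  open import Relation.Binary.PropositionalEquality
  open import Relation.Nullary using (¬_; Dec; yes; no; contradiction; does)
  open import Relation.Nullary.Decidable
    using (_×-dec_; _→-dec_; map′; dec-true; dec-false)
  open import Relation.Unary using (Decidable; Pred)
  open import Algebra.Properties.CommutativeMonoid.Sum +-0-commutativeMonoid
    using (sum; sum-cong-≗; ∑-distrib-+; ∑-comm; sum-replicate-zero)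
  open import Algebra.Properties.Semiring.Sum +-*-semiring
    using (*-distribˡ-sum; *-distribʳ-sum)
  open import Data.Nat.DivMod using (m%n<n; m<n⇒m%n≡m; [m+n]%n≡m%n; m≡m%n+[m/n]*n)

  -- Natural numbers as rationals

  toℚᵘ-fromℕ : ∀ n → ℚ.toℚᵘ (fromℕ n) ℚᵘ.≃ mkℚᵘ (ℤ.+ n) 0
  toℚᵘ-fromℕ n = toℚᵘ-/ (ℤ.+ n) 0

  fromℕ-+ : ∀ a b → fromℕ (a + b) ≡ fromℕ a ℚ.+ fromℕ b
  fromℕ-+ a b = ℚ.toℚᵘ-injective (ℚᵘ.≃-trans (toℚᵘ-fromℕ (a + b)) (ℚᵘ.≃-sym
    (ℚᵘ.≃-trans (ℚ.toℚᵘ-homo-+ (fromℕ a) (fromℕ b))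
      (ℚᵘ.≃-trans (ℚᵘ.+-cong (toℚᵘ-fromℕ a) (toℚᵘ-fromℕ b))
        (*≡* (cong (ℤ._* ℤ.+ 1) (cong₂ ℤ._+_ (ℤ.*-identityʳ (ℤ.+ a)) (ℤ.*-identityʳ (ℤ.+ b)))))))))

  fromℕ-* : ∀ a b → fromℕ (a * b) ≡ fromℕ a ℚ.* fromℕ b
  fromℕ-* a b = ℚ.toℚᵘ-injective (ℚᵘ.≃-trans (toℚᵘ-fromℕ (a * b)) (ℚᵘ.≃-sym
    (ℚᵘ.≃-trans (ℚ.toℚᵘ-homo-* (fromℕ a) (fromℕ b))
      (ℚᵘ.≃-trans (ℚᵘ.*-cong (toℚᵘ-fromℕ a) (toℚᵘ-fromℕ b))
        (*≡* (cong (ℤ._* ℤ.+ 1) (sym (ℤ.pos-* a b))))))))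

  fromℕ-mono-≤ : ∀ {a b} → a ≤ b → fromℕ a ℚ.≤ fromℕ b
  fromℕ-mono-≤ {a} {b} a≤b = /-≤ (ℤ.+ a) 0 (ℤ.+ b) 0
    (subst₂ ℤ._≤_ (sym (ℤ.*-identityʳ (ℤ.+ a))) (sym (ℤ.*-identityʳ (ℤ.+ b))) (ℤ.+≤+ a≤b))

  fromℕ-cancel-≤ : ∀ {a b} → fromℕ a ℚ.≤ fromℕ b → a ≤ b
  fromℕ-cancel-≤ {a} {b} le with ℚᵘ.≤-respˡ-≃ (toℚᵘ-fromℕ a) (ℚᵘ.≤-respʳ-≃ (toℚᵘ-fromℕ b) (ℚ.toℚᵘ-mono-≤ le))
  ... | *≤* le′ = ℤ.drop‿+≤+ (subst₂ ℤ._≤_ (ℤ.*-identityʳ (ℤ.+ a)) (ℤ.*-identityʳ (ℤ.+ b)) le′)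

  fromℕ-injective : ∀ {a b} → fromℕ a ≡ fromℕ b → a ≡ b
  fromℕ-injective eq = ≤-antisym (fromℕ-cancel-≤ (ℚ.≤-reflexive eq)) (fromℕ-cancel-≤ (ℚ.≤-reflexive (sym eq)))

  fromℕ-cancel-< : ∀ {a b} → fromℕ a ℚ.< fromℕ b → a < b
  fromℕ-cancel-< lt = ≰⇒> λ b≤a → ℚ.<-irrefl refl (ℚ.<-≤-trans lt (fromℕ-mono-≤ b≤a))

  fromℕ-mono-< : ∀ {a b} → a < b → fromℕ a ℚ.< fromℕ b
  fromℕ-mono-< lt = ℚ.≰⇒> λ le → <⇒≱ lt (fromℕ-cancel-≤ le)

  fromℕ-pos : ∀ {a} → 0 < a → ℚ.Positive (fromℕ a)
  fromℕ-pos {a} 0<a = ℚ.positive (fromℕ-mono-< {0} {a} 0<a)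

  fromℕ-nonNeg : ∀ a → ℚ.NonNegative (fromℕ a)
  fromℕ-nonNeg a = ℚ.nonNegative (fromℕ-mono-≤ {0} {a} z≤n)

  /-cancel : ∀ M N .{{_ : NonZero N}} → (ℤ.+ M ℚ./ N) ℚ.* fromℕ N ≡ fromℕ M
  /-cancel M (suc d) = ℚ.toℚᵘ-injective (ℚᵘ.≃-trans (ℚ.toℚᵘ-homo-* (ℤ.+ M ℚ./ suc d) (fromℕ (suc d)))
    (ℚᵘ.≃-trans (ℚᵘ.*-cong (toℚᵘ-/ (ℤ.+ M) d) (toℚᵘ-fromℕ (suc d)))
      (ℚᵘ.≃-trans (*≡* eq) (ℚᵘ.≃-sym (toℚᵘ-fromℕ M)))))
    where
    eq : ℤ.+ M ℤ.* ℤ.+ suc d ℤ.* ℤ.+ 1 ≡ ℤ.+ M ℤ.* (ℤ.+ suc d ℤ.* ℤ.+ 1)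
    eq = ℤ.*-assoc (ℤ.+ M) (ℤ.+ suc d) (ℤ.+ 1)

  -- Graphs as symmetric irreflexive Boolean matrices

  ∣∣≡# : ∀ {n} (s : Subset n) → ∣ s ∣ ≡ # (lookup s)
  ∣∣≡# []          = refl
  ∣∣≡# (true  ∷ s) = cong suc (∣∣≡# s)
  ∣∣≡# (false ∷ s) = ∣∣≡# s

  ∣tabulate∣ : ∀ {n} (s : Fin n → Bool) → ∣ tabulate s ∣ ≡ # s
  ∣tabulate∣ s = trans (∣∣≡# (tabulate s)) (#-cong (lookup∘tabulate s))

  lookup-∉ : ∀ {n} {v : Fin n} {s} → v ∉ s → lookup s v ≡ false
  lookup-∉ {v = v} {s} v∉s with lookup s v in eq
  ... | false = refl
  ... | true  = contradiction (lookup⇒[]= v s eq) v∉s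

  module _ {n : ℕ} (G : Graph n) where
    open Graph G

    adj : Fin n → Fin n → Bool
    adj v w = lookup (lookup nbrs v) w

    adj-symᵇ : ∀ v w → adj v w ≡ adj w v
    adj-symᵇ v w with adj v w in vw | adj w v in wv
    ... | false | false = refl
    ... | true  | true  = refl
    ... | true  | false = trans (sym ([]=⇒lookup (adj-sym w v (lookup⇒[]= w _ vw)))) wv
    ... | false | true  = trans (sym vw) ([]=⇒lookup (adj-sym v w (lookup⇒[]= v _ wv)))

    adj-irrᵇ : ∀ v → adj v v ≡ false
    adj-irrᵇ v = lookup-∉ (adj-irr v)

  fromMatrix : ∀ {n} (a : Fin n → Fin n → Bool) →
    (∀ v w → a v w ≡ a w v) → (∀ v → a v v ≡ false) → Graph n
  fromMatrix {n} a a-sym a-irr = record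
    { nbrs    = nb
    ; adj-sym = λ v w v∈ → lookup⇒[]= w _ (trans (entry v w) (trans (a-sym v w)
        (trans (sym (entry w v)) ([]=⇒lookup v∈))))
    ; adj-irr = λ v v∈ → contradiction (trans (sym ([]=⇒lookup v∈)) (trans (entry v v) (a-irr v))) λ ()
    }
    where
    nb : Vec (Subset n) n
    nb = tabulate λ v → tabulate (a v)
    entry : ∀ v w → lookup (lookup nb v) w ≡ a v w
    entry v w = trans (cong (λ s → lookup s w) (lookup∘tabulate (λ v → tabulate (a v)) v))
                      (lookup∘tabulate (a v) w)

  adj-fromMatrix : ∀ {n} (a : Fin n → Fin n → Bool) a-sym a-irr v w →
    adj (fromMatrix a a-sym a-irr) v w ≡ a v w
  adj-fromMatrix a _ _ v w = trans (cong (λ s → lookup s w) (lookup∘tabulate (λ v → tabulate (a v)) v))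
                      (lookup∘tabulate (a v) w)

  length-filter-tabulate : ∀ {A : Set} {P : Pred A 0ℓ} (P? : Decidable P) {n} (f : Fin n → A) →
    length (filter P? (List.tabulate f)) ≡ # (λ i → does (P? (f i)))
  length-filter-tabulate P? {zero}  f = refl
  length-filter-tabulate P? {suc n} f with does (P? (f zero))
  ... | true  = cong suc (length-filter-tabulate P? (f ∘ suc))
  ... | false = length-filter-tabulate P? (f ∘ suc)

  length-filter-product : ∀ {A B : Set} {P : Pred (A × B) 0ℓ} (P? : Decidable P)
    {m n} (f : Fin m → A) (g : Fin n → B) →
    length (filter P? (cartesianProduct (List.tabulate f) (List.tabulate g))) ≡
    sum (λ i → # (λ j → does (P? (f i , g j))))
  length-filter-product P? {zero}  f g = refl
  length-filter-product P? {suc m} f g = begin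
    length (filter P? (row List.++ rest))                ≡⟨ cong length (filter-++ P? row rest) ⟩
    length (filter P? row List.++ filter P? rest)        ≡⟨ length-++ (filter P? row) ⟩
    length (filter P? row) + length (filter P? rest)
      ≡⟨ cong₂ _+_ (trans (cong (λ xs → length (filter P? xs)) (map-tabulate g (f zero ,_)))
                     (length-filter-tabulate P? (λ j → f zero , g j)))
                   (length-filter-product P? (f ∘ suc) g) ⟩
    # (λ j → does (P? (f zero , g j))) + sum (λ i → # (λ j → does (P? (f (suc i) , g j)))) ∎
    where
    open ≡-Reasoning
    row  = List.map (f zero ,_) (List.tabulate g)
    rest = cartesianProduct (List.tabulate (f ∘ suc)) (List.tabulate g)

  total : ∀ {n} → (Fin n → Fin n → Bool) → ℕ
  total a = ∑∑ λ v w → ⟦ a v w ⟧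

  -- Each matrix entry is assigned to the order of its two indices. The increasing half counts
  -- `edges`, and the decreasing half is its transpose.
  handshake : ∀ {n} (G : Graph n) → total (adj G) ≡ 2 * ∣E∣ G
  handshake {n} G = begin
    total (adj G)
      ≡⟨ sum-cong-≗ (λ v → sum-cong-≗ (λ w → orient v w)) ⟩
    ∑∑ (λ v w → up v w + up w v)
      ≡⟨ sum-cong-≗ (λ v → ∑-distrib-+ (up v) (λ w → up w v)) ⟩
    sum (λ v → sum (up v) + sum (λ w → up w v))
      ≡⟨ ∑-distrib-+ (λ v → sum (up v)) _ ⟩
    ∑∑ up + ∑∑ (λ v w → up w v)
      ≡⟨ cong (λ x → ∑∑ up + x) (∑-comm (λ v w → up w v)) ⟩
    ∑∑ up + ∑∑ up
      ≡⟨ cong (λ x → ∑∑ up + x) (+-identityʳ (∑∑ up)) ⟨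
    2 * ∑∑ up
      ≡⟨ cong (2 *_) (length-filter-product P? (λ i → i) (λ i → i)) ⟨
    2 * ∣E∣ G ∎
    where
    open ≡-Reasoning
    open Graph G
    P? : Decidable _
    P? = λ ((i , j) : Fin n × Fin n) → i Fin.<? j ×-dec j ∈? lookup nbrs i
    up : Fin n → Fin n → ℕ
    up v w = ⟦ does (v Fin.<? w) ∧ does (w ∈? lookup nbrs v) ⟧
    mem : ∀ v w → does (w ∈? lookup nbrs v) ≡ adj G v w
    mem v w with w ∈? lookup nbrs v
    ... | yes w∈ = sym ([]=⇒lookup w∈)
    ... | no  w∉ = sym (lookup-∉ w∉)
    orient : ∀ v w → ⟦ adj G v w ⟧ ≡ up v w + up w v
    orient v w rewrite mem v w | mem w v | adj-symᵇ G w v with Fin.<-cmp v w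
    ... | tri< v<w _ w≮v rewrite dec-true (v Fin.<? w) v<w | dec-false (w Fin.<? v) w≮v =
      sym (+-identityʳ ⟦ adj G v w ⟧)
    ... | tri> v≮w _ w<v rewrite dec-true (w Fin.<? v) w<v | dec-false (v Fin.<? w) v≮w = refl
    ... | tri≈ v≮w refl w≮v rewrite dec-false (v Fin.<? v) v≮w | adj-irrᵇ G v = refl

  -- Denominators are cleared: the density is M / N.
  Full : ∀ {n} (a : Fin n → Fin n → Bool) (N M m : ℕ) → Set
  Full {n} a N M m = ∃[ S ] ∣ S ∣ ≡ m × 1 ≤ m ×
    (∀ (v : Fin n) → v ∈ S → M * (m ∸ 1) ≤ N * deg a (lookup S) v)

  full? : ∀ {n} (a : Fin n → Fin n → Bool) N M → Decidable (Full a N M)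
  full? a N M m = anySubset? λ S → ∣ S ∣ ≟ m ×-dec 1 ≤? m ×-dec
    Fin.all? λ v → v ∈? S →-dec (M * (m ∸ 1) ≤? N * deg a (lookup S) v)

  module _ {n : ℕ} .{{_ : NonTrivial n}} (G : Graph n) where

    private
      instance
        N≢0 : NonZero (n C 2)
        N≢0 = nC2≢0 n
      N M : ℕ
      N = n C 2
      M = ∣E∣ G

    clear : ∀ m → 1 ≤ m →
      (density G ℚ.* (fromℕ m ℚ.- 1ℚ)) ℚ.* fromℕ N ≡ fromℕ (M * (m ∸ 1))
    clear (suc m) _ = begin
      density G ℚ.* (fromℕ (suc m) ℚ.- 1ℚ) ℚ.* fromℕ N
        ≡⟨ cong (λ x → density G ℚ.* x ℚ.* fromℕ N) minus-1 ⟩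
      density G ℚ.* fromℕ m ℚ.* fromℕ N
        ≡⟨ ℚ.*-assoc (density G) (fromℕ m) (fromℕ N) ⟩
      density G ℚ.* (fromℕ m ℚ.* fromℕ N)
        ≡⟨ cong (density G ℚ.*_) (ℚ.*-comm (fromℕ m) (fromℕ N)) ⟩
      density G ℚ.* (fromℕ N ℚ.* fromℕ m)
        ≡⟨ ℚ.*-assoc (density G) (fromℕ N) (fromℕ m) ⟨
      density G ℚ.* fromℕ N ℚ.* fromℕ m
        ≡⟨ cong (ℚ._* fromℕ m) (/-cancel M N) ⟩
      fromℕ M ℚ.* fromℕ m
        ≡⟨ fromℕ-* M m ⟨
      fromℕ (M * m) ∎
      where
      open ≡-Reasoning
      minus-1 : fromℕ (suc m) ℚ.- 1ℚ ≡ fromℕ m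
      minus-1 = begin
        fromℕ (suc m) ℚ.- 1ℚ           ≡⟨ cong (ℚ._- 1ℚ) (fromℕ-+ 1 m) ⟩
        1ℚ ℚ.+ fromℕ m ℚ.- 1ℚ          ≡⟨ cong (ℚ._- 1ℚ) (ℚ.+-comm 1ℚ (fromℕ m)) ⟩
        fromℕ m ℚ.+ 1ℚ ℚ.- 1ℚ          ≡⟨ ℚ.+-assoc (fromℕ m) 1ℚ (ℚ.- 1ℚ) ⟩
        fromℕ m ℚ.+ 0ℚ                 ≡⟨ ℚ.+-identityʳ (fromℕ m) ⟩
        fromℕ m                        ∎

    clear-≤ : ∀ m d → 1 ≤ m → density G ℚ.* (fromℕ m ℚ.- 1ℚ) ℚ.≤ fromℕ d → M * (m ∸ 1) ≤ N * d
    clear-≤ m d 1≤m le = fromℕ-cancel-≤ (subst₂ ℚ._≤_ (clear m 1≤m)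
      (trans (ℚ.*-comm (fromℕ d) (fromℕ N)) (sym (fromℕ-* N d)))
      (ℚ.*-monoʳ-≤-nonNeg (fromℕ N) {{fromℕ-nonNeg N}} le))

    unclear-≤ : ∀ m d → 1 ≤ m → M * (m ∸ 1) ≤ N * d → density G ℚ.* (fromℕ m ℚ.- 1ℚ) ℚ.≤ fromℕ d
    unclear-≤ m d 1≤m le = ℚ.*-cancelʳ-≤-pos (fromℕ N) {{fromℕ-pos (>-nonZero⁻¹ N)}}
      (subst₂ ℚ._≤_ (sym (clear m 1≤m)) (trans (fromℕ-* N d) (ℚ.*-comm (fromℕ N) (fromℕ d)))
        (fromℕ-mono-≤ le))

    -- The subgraph induced on `S` serves as witness: for a vertex of `S` its degree there is its
    -- number of neighbours in `S`.
    fromFull : ∀ {m} → Full (adj G) N M m → ∃[ H ] IsFull G H × Subgraph.order H ≡ m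
    fromFull (S , refl , 1≤m , low) = H , record { nonempty = 1≤m ; minDegree = minDeg } , refl
      where
      a : Fin n → Fin n → Bool
      a v w = adj G v w ∧ (lookup S v ∧ lookup S w)
      a-sym : ∀ v w → a v w ≡ a w v
      a-sym v w = cong₂ _∧_ (adj-symᵇ G v w) (Bool.∧-comm (lookup S v) (lookup S w))
      a-irr : ∀ v → a v v ≡ false
      a-irr v = cong (_∧ (lookup S v ∧ lookup S v)) (adj-irrᵇ G v)
      K = fromMatrix a a-sym a-irr
      edge : ∀ v w → Adj K v w → a v w ≡ true
      edge v w vw = trans (sym (adj-fromMatrix a a-sym a-irr v w)) ([]=⇒lookup vw)
      H : Subgraph G
      H = record
        { verts    = S
        ; graph    = K
        ; inside   = λ v w vw → lookup⇒[]= v S (left (lookup S v) (right (adj G v w) (edge v w vw)))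
        ; subgraph = λ v w vw → lookup⇒[]= w _ (left (adj G v w) (edge v w vw))
        }
        where
        left : ∀ b {c} → b ∧ c ≡ true → b ≡ true
        left true _ = refl
        right : ∀ b {c} → b ∧ c ≡ true → c ≡ true
        right true eq = eq
      minDeg : ∀ v → v ∈ S → density G ℚ.* (fromℕ ∣ S ∣ ℚ.- 1ℚ) ℚ.≤ fromℕ (degree K v)
      minDeg v v∈S = unclear-≤ ∣ S ∣ (degree K v) 1≤m (subst (λ d → M * (∣ S ∣ ∸ 1) ≤ N * d) (sym deg≡) (low v v∈S))
        where
        deg≡ : degree K v ≡ deg (adj G) (lookup S) v
        deg≡ = trans (∣∣≡# (lookup (Graph.nbrs K) v)) (#-cong λ w →
          trans (adj-fromMatrix a a-sym a-irr v w)
                (cong (λ b → adj G v w ∧ (b ∧ lookup S w)) ([]=⇒lookup v∈S)))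

    -- Passing to the induced subgraph on the same vertices can only raise degrees. Subgraphs
    -- thereby reduce to vertex sets, over which fullness can be decided.
    toFull : ∀ {m} → (∃[ H ] IsFull G H × Subgraph.order H ≡ m) → Full (adj G) N M m
    toFull (H , full , refl) = verts , refl , nonempty , λ v v∈ →
      ≤-trans (clear-≤ order (degree graph v) nonempty (minDegree v v∈)) (*-monoʳ-≤ N (deg≤ v))
      where
      open Subgraph H
      open IsFull full
      deg≤ : ∀ v → degree graph v ≤ deg (adj G) (lookup verts) v
      deg≤ v = subst (_≤ deg (adj G) (lookup verts) v) (sym (∣∣≡# (lookup (Graph.nbrs graph) v))) (#-mono λ w vw →
        let vw′ = lookup⇒[]= w _ vw in cong₂ _∧_ ([]=⇒lookup (subgraph v w vw′))
          ([]=⇒lookup (inside w v (Graph.adj-sym graph w v vw′))))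

    -- A single vertex is full because the required degree is 0. It makes the set of orders nonempty
    -- and f at least 1.
    Full-1 : Full (adj G) N M 1
    Full-1 = ⁅ v₀ n ⁆ , ∣⁅x⁆∣≡1 (v₀ n) , ≤-refl , λ v _ → ≤-trans (≤-reflexive (*-zeroʳ M)) z≤n
      where
      v₀ : ∀ n .{{_ : NonTrivial n}} → Fin n
      v₀ (suc _) = zero

  Full-≤n : ∀ {n} (a : Fin n → Fin n → Bool) {N M m} → Full a N M m → m ≤ n
  Full-≤n a (S , refl , _) = ∣p∣≤n S

  -- Existence of f(G) and of f(n,p)

  greatest : ∀ {P : ℕ → Set} → Decidable P → ∀ b → (∀ j → P j → j ≤ b) → ∃ P → ∃ (IsGreatest P)
  greatest {P} P? zero    ≤b (j , pj) = zero , subst P (n≤0⇒n≡0 (≤b j pj)) pj , ≤b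
  greatest P? (suc b) ≤b (j , pj) with P? (suc b)
  ... | yes p = suc b , p , ≤b
  ... | no ¬p = greatest P? b (λ i pi → ≤-pred (≤∧≢⇒< (≤b i pi) λ { refl → ¬p pi })) (j , pj)

  least : ∀ {P : ℕ → Set} → Decidable P → ∃ P → ∃ (IsLeast P)
  least {P} P? (j , pj) = search j 0 (+-identityʳ j) (λ _ ())
    where
    search : ∀ d i → d + i ≡ j → (∀ l → l < i → ¬ P l) → ∃ (IsLeast P)
    search d i eq below with P? i
    ... | yes pi = i , pi , λ l pl → ≮⇒≥ λ l<i → below l l<i pl
    search zero    i refl below | no ¬pi = contradiction pj ¬pi
    search (suc d) i eq   below | no ¬pi = search d (suc i) (trans (+-suc d i) eq) λ l l<1+i pl →
      [ (λ l<i → below l l<i pl) , (λ { refl → ¬pi pl }) ]′ (m≤n⇒m<n∨m≡n (≤-pred l<1+i))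
      where open import Data.Sum.Base using ([_,_]′)

  -- Applied to vectors of subsets, this makes the minimum over all graphs on `Fin n` a finite
  -- search.
  anyVec? : ∀ {A : Set} → (∀ {P : Pred A 0ℓ} → Decidable P → Dec (∃ P)) →
    ∀ {n} {P : Pred (Vec A n) 0ℓ} → Decidable P → Dec (∃ P)
  anyVec? any? {zero}  P? = map′ ([] ,_) (λ { ([] , p) → p }) (P? [])
  anyVec? any? {suc n} P? = map′ (λ (x , xs , p) → x ∷ xs , p) (λ { (x ∷ xs , p) → x , xs , p })
    (any? λ x → anyVec? any? λ xs → P? (x ∷ xs))

  module _ {n : ℕ} .{{_ : NonTrivial n}} where

    f-greatest : ∀ (G : Graph n) {k} → IsGreatest (Full (adj G) (n C 2) (∣E∣ G)) k → f[ G ]≡ k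
    f-greatest G (p , max) = fromFull G p , λ j q → max j (toFull G q)

    greatest-f : ∀ (G : Graph n) {k} → f[ G ]≡ k → IsGreatest (Full (adj G) (n C 2) (∣E∣ G)) k
    greatest-f G (p , max) = toFull G p , λ j q → max j (fromFull G q)

    f-exists : ∀ (G : Graph n) → ∃[ k ] f[ G ]≡ k
    f-exists G = map₂ (f-greatest G)
      (greatest (full? (adj G) (n C 2) (∣E∣ G)) n (λ j → Full-≤n (adj G) {n C 2} {∣E∣ G}) (1 , Full-1 G))

    module _ (p : ℚ) (M : ℕ) (p≡ : p ℚ.* fromℕ (n C 2) ≡ fromℕ M) where

      private
        -- A graph with value `j`, expressed by its neighbourhood vectors alone: the search then
        -- runs over plain data instead of records with proof fields. The edge number enters through
        -- `total`, by `handshake`.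
        Candidate : ℕ → Vec (Subset n) n → Set
        Candidate j nb = (∀ v w → entry v w ≡ entry w v) × (∀ v → entry v v ≡ false) ×
          total entry ≡ 2 * M × IsGreatest (Full entry (n C 2) M) j
          where
          entry : Fin n → Fin n → Bool
          entry v w = lookup (lookup nb v) w

        -- Maximality quantifies over all of ℕ; it is decided by computing the greatest element and
        -- comparing it with `j`.
        isGreatest? : ∀ a j → Dec (IsGreatest (Full {n} a (n C 2) M) j)
        isGreatest? a j with full? a (n C 2) M j
        ... | no ¬full = no (¬full ∘ proj₁)
        ... | yes full with greatest (full? a (n C 2) M) n (λ j → Full-≤n a {n C 2} {M}) (j , full)
        ...   | k , fk , max with j ≟ k
        ...     | yes refl = yes (fk , max)
        ...     | no  j≢k  = no λ (fj , max′) → j≢k (≤-antisym (max j fj) (max′ k fk))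

        candidate? : ∀ j → Decidable (Candidate j)
        candidate? j nb = (Fin.all? λ v → Fin.all? λ w → _ Bool.≟ _) ×-dec
          (Fin.all? λ v → _ Bool.≟ _) ×-dec _ ≟ _ ×-dec isGreatest? _ j

        Value : ℕ → Set
        Value j = ∃[ G ] fromℕ (∣E∣ {n} G) ≡ p ℚ.* fromℕ (n C 2) × f[ G ]≡ j

        fromCandidate : ∀ j → ∃ (Candidate j) → Value j
        fromCandidate j (nb , s , i , t , g) = G , trans (cong fromℕ E≡M) (sym p≡) ,
          f-greatest G (subst (λ m → IsGreatest (Full (adj G) (n C 2) m) j) (sym E≡M) g)
          where
          G : Graph n
          G = record
            { nbrs    = nb
            ; adj-sym = λ v w v∈ → lookup⇒[]= w _ (trans (s v w) ([]=⇒lookup v∈))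
            ; adj-irr = λ v v∈ → contradiction (trans (sym ([]=⇒lookup v∈)) (i v)) λ ()
            }
          E≡M : ∣E∣ G ≡ M
          E≡M = *-cancelˡ-≡ (∣E∣ G) M 2 (trans (sym (handshake G)) t)

        toCandidate : ∀ j → Value j → ∃ (Candidate j)
        toCandidate j (G , eq , fG) = Graph.nbrs G , adj-symᵇ G , adj-irrᵇ G ,
          trans (handshake G) (cong (2 *_) E≡M) ,
          subst (λ m → IsGreatest (Full (adj G) (n C 2) m) j) E≡M (greatest-f G fG)
          where
          E≡M : ∣E∣ G ≡ M
          E≡M = fromℕ-injective (trans eq p≡)

      fₙ-exists : (G : Graph n) → ∣E∣ G ≡ M → ∃ (f[_,_]≡_ n p)
      fₙ-exists G E≡M = least
        (λ j → map′ (fromCandidate j) (toCandidate j) (anyVec? anySubset? (candidate? j)))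
        (map₂ (λ fG → G , trans (cong fromℕ E≡M) (sym p≡) , fG) (f-exists G))

  2*nC2 : ∀ n → 2 * (n C 2) ≡ n * (n ∸ 1)
  2*nC2 zero    = refl
  2*nC2 (suc n) = begin
    2 * (suc n C 2)             ≡⟨ cong (2 *_) (nCk+nC[k+1]≡[n+1]C[k+1] n 1) ⟨
    2 * (n C 1 + n C 2)         ≡⟨ cong (λ x → 2 * (x + n C 2)) (nC1≡n n) ⟩
    2 * (n + n C 2)             ≡⟨ *-distribˡ-+ 2 n (n C 2) ⟩
    2 * n + 2 * (n C 2)         ≡⟨ cong (λ x → 2 * n + x) (2*nC2 n) ⟩
    2 * n + n * (n ∸ 1)         ≡⟨ lem n ⟩
    suc n * n                   ∎
    where
    open ≡-Reasoning
    lem : ∀ n → 2 * n + n * (n ∸ 1) ≡ suc n * n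
    lem zero    = refl
    lem (suc n) = lem′ n
      where
      lem′ : ∀ n → 2 * suc n + suc n * n ≡ suc (suc n) * suc n
      lem′ = solve-∀

  -- Maximality of `k` is exactly the deficiency hypothesis: a larger set without a deficient vertex
  -- would be full. The initial density condition holds with equality, since M / N is the density of
  -- `G` itself.
  f-bound : ∀ {n} .{{_ : NonTrivial n}} (G : Graph n) k → f[ G ]≡ k →
    ∣E∣ G < n C 2 → cube (n C 2) < cube (∣E∣ G) * (n * n) →
    (n C 2 ∸ ∣E∣ G) * (n C 2 ∸ ∣E∣ G) * (n * n) ≤ 64 * cube (suc k) * ((n C 2) * (n C 2))
  f-bound {n} G k fG M<N p-large = order-bound (adj G) (adj-symᵇ G) (adj-irrᵇ G) N M k
    (max 1 (Full-1 G)) M<N p-large deficient (≤-reflexive dense)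
    where
    N = n C 2
    M = ∣E∣ G
    max = proj₂ (greatest-f G fG)
    deficient : ∀ s → k < # s → ∃[ v ] s v ≡ true × N * deg (adj G) s v < M * (# s ∸ 1)
    deficient s k<s with Fin.any? (λ v → s v Bool.≟ true ×-dec N * deg (adj G) s v <? M * (# s ∸ 1))
    ... | yes found = found
    ... | no  none  = contradiction (max (# s) (tabulate s , ∣tabulate∣ s , ≤-<-trans z≤n k<s , low)) (<⇒≱ k<s)
      where
      low : ∀ v → v ∈ tabulate s → M * (# s ∸ 1) ≤ N * deg (adj G) (lookup (tabulate s)) v
      low v v∈ = subst (λ d → M * (# s ∸ 1) ≤ N * d)
        (sym (#-cong λ w → cong (adj G v w ∧_) (lookup∘tabulate s w)))
        (≮⇒≥ λ lt → none (v , trans (sym (lookup∘tabulate s v)) ([]=⇒lookup v∈) , lt))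
    dense : M * (n * (n ∸ 1)) ≡ N * Edges.e₂ (adj G) (adj-symᵇ G) (adj-irrᵇ G) (const true)
    dense = begin
      M * (n * (n ∸ 1))    ≡⟨ cong (M *_) (2*nC2 n) ⟨
      M * (2 * N)          ≡⟨ lem M N ⟩
      N * (2 * M)          ≡⟨ cong (N *_) (handshake G) ⟨
      N * total (adj G)
        ≡⟨ cong (N *_) (sum-cong-≗ λ v → #-cong λ w → Bool.∧-identityʳ (adj G v w)) ⟨
      N * Edges.e₂ (adj G) (adj-symᵇ G) (adj-irrᵇ G) (const true) ∎
      where
      open ≡-Reasoning
      lem : ∀ M N → M * (2 * N) ≡ N * (2 * M)
      lem = solve-∀

  -- Graphs with a prescribed number of edges

  _==_ : ∀ {n} → Fin n → Fin n → Bool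
  v == w = does (v Fin.≟ w)

  ==-refl : ∀ {n} (v : Fin n) → (v == v) ≡ true
  ==-refl v = dec-true (v Fin.≟ v) refl

  ==-≢ : ∀ {n} {v w : Fin n} → v ≢ w → (v == w) ≡ false
  ==-≢ {v = v} {w} v≢w = dec-false (v Fin.≟ w) v≢w

  ==-sym : ∀ {n} (v w : Fin n) → (v == w) ≡ (w == v)
  ==-sym v w with v Fin.≟ w
  ... | yes refl = sym (==-refl v)
  ... | no  v≢w  = sym (==-≢ (v≢w ∘ sym))

  #-singleton : ∀ {n} (x : Fin n) → # (_== x) ≡ 1
  #-singleton {suc n} zero    = cong suc (sum-replicate-zero n)
  #-singleton {suc n} (suc x) = #-singleton x

  infix 4 _⊑_

  _⊑_ : ∀ {n} → (Fin n → Fin n → Bool) → (Fin n → Fin n → Bool) → Set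
  a ⊑ b = ∀ v w → a v w ≡ true → b v w ≡ true

  IsGraph : ∀ {n} → (Fin n → Fin n → Bool) → Set
  IsGraph a = (∀ v w → a v w ≡ a w v) × (∀ v → a v v ≡ false)

  module _ {n : ℕ} (a : Fin n → Fin n → Bool) (x y : Fin n) where

    addEdge : Fin n → Fin n → Bool
    addEdge v w = a v w ∨ (((v == x) ∧ (w == y)) ∨ ((v == y) ∧ (w == x)))

    addEdge-sym : (∀ v w → a v w ≡ a w v) → ∀ v w → addEdge v w ≡ addEdge w v
    addEdge-sym a-sym v w = cong₂ _∨_ (a-sym v w)
      (trans (Bool.∨-comm ((v == x) ∧ (w == y)) _)
        (cong₂ _∨_ (Bool.∧-comm (v == y) (w == x)) (Bool.∧-comm (v == x) (w == y))))

    addEdge-irr : x ≢ y → (∀ v → a v v ≡ false) → ∀ v → addEdge v v ≡ false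
    addEdge-irr x≢y a-irr v rewrite a-irr v with v Fin.≟ x
    ... | yes refl rewrite ==-≢ x≢y = refl
    ... | no  v≢x = Bool.∧-zeroʳ (v == y)

    addEdge-⊑ : ∀ {b} → (∀ v w → b v w ≡ b w v) → b x y ≡ true → a ⊑ b → addEdge ⊑ b
    addEdge-⊑ b-sym xy a⊑b v w eq with a v w in vw
    ... | true  = a⊑b v w vw
    ... | false with v Fin.≟ x | w Fin.≟ y | v Fin.≟ y | w Fin.≟ x
    ...   | yes refl | yes refl | _        | _        = xy
    ...   | _        | _        | yes refl | yes refl = trans (b-sym y x) xy
    ...   | yes _    | no  _    | yes _    | no  _    = contradiction eq λ ()
    ...   | yes _    | no  _    | no  _    | _        = contradiction eq λ ()
    ...   | no  _    | _        | yes _    | no  _    = contradiction eq λ ()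
    ...   | no  _    | _        | no  _    | _        = contradiction eq λ ()

    total-addEdge : (∀ v w → a v w ≡ a w v) → x ≢ y → a x y ≡ false → total addEdge ≡ total a + 2
    total-addEdge a-sym x≢y xy = begin
      total addEdge
        ≡⟨ sum-cong-≗ (λ v → sum-cong-≗ (λ w → pointwise v w)) ⟩
      ∑∑ (λ v w → ⟦ a v w ⟧ + (δ x v * δ y w + δ y v * δ x w))
        ≡⟨ ∑∑-+ (λ v w → ⟦ a v w ⟧) _ ⟩
      total a + ∑∑ (λ v w → δ x v * δ y w + δ y v * δ x w)
        ≡⟨ cong (total a +_) (∑∑-+ (λ v w → δ x v * δ y w) _) ⟩
      total a + (∑∑ (λ v w → δ x v * δ y w) + ∑∑ (λ v w → δ y v * δ x w))
        ≡⟨ cong (total a +_) (cong₂ _+_ (one x y) (one y x)) ⟩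
      total a + 2 ∎
      where
      open ≡-Reasoning
      δ : Fin n → Fin n → ℕ
      δ x v = ⟦ v == x ⟧
      ∑∑-+ : (f g : Fin n → Fin n → ℕ) → ∑∑ (λ v w → f v w + g v w) ≡ ∑∑ f + ∑∑ g
      ∑∑-+ f g = trans (sum-cong-≗ λ v → ∑-distrib-+ (f v) (g v)) (∑-distrib-+ (λ v → sum (f v)) (λ v → sum (g v)))
      one : ∀ x y → ∑∑ (λ v w → δ x v * δ y w) ≡ 1
      one x y = trans (sum-cong-≗ λ v → trans (sym (*-distribˡ-sum (δ x v) (δ y)))
        (trans (cong (δ x v *_) (#-singleton y)) (*-identityʳ (δ x v)))) (#-singleton x)
      pointwise : ∀ v w → ⟦ addEdge v w ⟧ ≡ ⟦ a v w ⟧ + (δ x v * δ y w + δ y v * δ x w)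
      pointwise v w with v Fin.≟ x | w Fin.≟ y
      ... | yes refl | yes refl rewrite xy | ==-≢ x≢y = refl
      ... | yes refl | no  _    rewrite ==-≢ x≢y with a v w
      ...   | false = refl
      ...   | true  = refl
      pointwise v w | no _ | yes refl with v Fin.≟ y
      ... | yes refl rewrite ==-≢ (x≢y ∘ sym) with a v v
      ...   | false = refl
      ...   | true  = refl
      pointwise v w | no _ | yes refl | no _ with a v w
      ...   | false = refl
      ...   | true  = refl
      pointwise v w | no _ | no _ with v Fin.≟ y | w Fin.≟ x
      ... | yes refl | yes refl rewrite a-sym v w | xy = refl
      ... | yes refl | no  _ with a v w
      ...   | false = refl
      ...   | true  = refl
      pointwise v w | no _ | no _ | no _ | _ with a v w
      ...   | false = refl
      ...   | true  = refl

  -- Edges of `b` missing in `a` are added one at a time, each raising `total` by 2. If none is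
  -- missing, `b` has no more edges than `a`, and the counting hypothesis forbids a further step.
  interpolate : ∀ {n} d (a b : Fin n → Fin n → Bool) → IsGraph a → IsGraph b → a ⊑ b →
    total a + 2 * d ≤ total b →
    ∃[ c ] IsGraph c × a ⊑ c × c ⊑ b × total c ≡ total a + 2 * d
  interpolate zero    a b ga gb a⊑b le = a , ga , (λ _ _ e → e) , a⊑b , sym (+-identityʳ _)
  interpolate (suc d) a b (a-sym , a-irr) gb@(b-sym , b-irr) a⊑b le
    with Fin.any? (λ x → Fin.any? (λ y → (b x y Bool.≟ true) ×-dec (a x y Bool.≟ false)))
  ... | no none = contradiction (≤-trans le (sum-mono λ v → #-mono λ w → b⊑a v w))
          (<⇒≱ (m<m+n (total a) z<s))
    where
    b⊑a : b ⊑ a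
    b⊑a v w vw with a v w in eq
    ... | true  = refl
    ... | false = contradiction (v , w , vw , eq) none
  ... | yes (x , y , xy∈b , xy∉a) =
    let x≢y = λ { refl → contradiction (trans (sym xy∈b) (b-irr x)) λ () }
        a′ = addEdge a x y
        t′ = total-addEdge a x y a-sym x≢y xy∉a
        c , gc , a′⊑c , c⊑b , tc = interpolate d a′ b
          (addEdge-sym a x y a-sym , addEdge-irr a x y x≢y a-irr) gb
          (addEdge-⊑ a x y b-sym xy∈b a⊑b)
          (≤-trans (≤-reflexive (trans (cong (_+ 2 * d) t′) (lem (total a) d))) le)
    in c , gc , (λ v w vw → a′⊑c v w (cong (_∨ _) vw)) , c⊑b ,
       trans tc (trans (cong (_+ 2 * d) t′) (lem (total a) d))
    where
    lem : ∀ t d → t + 2 + 2 * d ≡ t + 2 * suc d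
    lem = solve-∀

  -- The total of a graph is even by `handshake`, so the distance from `a` to 2 * M is a whole
  -- number of edges.
  graph-between : ∀ {n} M (a b : Fin n → Fin n → Bool) → IsGraph a → IsGraph b → a ⊑ b →
    total a ≤ 2 * M → 2 * M ≤ total b →
    ∃[ G ] ∣E∣ G ≡ M × a ⊑ adj G × adj G ⊑ b
  graph-between {n} M a b ga gb a⊑b lo hi = build (interpolate d a b ga gb a⊑b (≤-trans (≤-reflexive t) hi))
    where
    total-even : (c : Fin n → Fin n → Bool) (gc : IsGraph c) →
      total c ≡ 2 * ∣E∣ (fromMatrix c (proj₁ gc) (proj₂ gc))
    total-even c (s , i) = trans (sum-cong-≗ λ v → #-cong λ w → sym (adj-fromMatrix c s i v w))
      (handshake (fromMatrix c s i))
    e = ∣E∣ (fromMatrix a (proj₁ ga) (proj₂ ga))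
    d = M ∸ e
    t : total a + 2 * d ≡ 2 * M
    t = begin
      total a + 2 * d        ≡⟨ cong (_+ 2 * d) (total-even a ga) ⟩
      2 * e + 2 * (M ∸ e)    ≡⟨ *-distribˡ-+ 2 e (M ∸ e) ⟨
      2 * (e + (M ∸ e))
        ≡⟨ cong (2 *_) (m+[n∸m]≡n {e} {M} (*-cancelˡ-≤ 2 (subst (_≤ 2 * M) (total-even a ga) lo))) ⟩
      2 * M                  ∎
      where open ≡-Reasoning
    build : (∃[ c ] IsGraph c × a ⊑ c × c ⊑ b × total c ≡ total a + 2 * d) → _
    build (c , gc@(s , i) , a⊑c , c⊑b , tc) = fromMatrix c s i ,
      *-cancelˡ-≡ _ M 2 (trans (sym (total-even c gc)) (trans tc t)) ,
      (λ v w vw → trans (adj-fromMatrix c s i v w) (a⊑c v w vw)) ,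
      (λ v w vw → c⊑b v w (trans (sym (adj-fromMatrix c s i v w)) vw))

  total-complete : ∀ n → total (λ (v w : Fin n) → not (v == w)) + n ≡ n * n
  total-complete n = begin
    total K + n                      ≡⟨ cong (total K +_) (trans (sum-const n 1) (*-identityʳ n)) ⟨
    total K + sum {n} (const 1)      ≡⟨ ∑-distrib-+ (λ v → # (K v)) (const 1) ⟨
    sum (λ v → # (K v) + 1)          ≡⟨ sum-cong-≗ row ⟩
    sum {n} (const n)                ≡⟨ sum-const n n ⟩
    n * n                            ∎
    where
    open ≡-Reasoning
    K : Fin n → Fin n → Bool
    K v w = not (v == w)
    not-+ : ∀ b → ⟦ not b ⟧ + ⟦ b ⟧ ≡ 1
    not-+ false = refl
    not-+ true  = refl
    row : ∀ v → # (K v) + 1 ≡ n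
    row v = begin
      # (K v) + 1
        ≡⟨ cong (# (K v) +_) (trans (#-cong λ w → ==-sym v w) (#-singleton v)) ⟨
      # (K v) + # (v ==_)            ≡⟨ ∑-distrib-+ (λ w → ⟦ K v w ⟧) (λ w → ⟦ v == w ⟧) ⟨
      sum (λ w → ⟦ K v w ⟧ + ⟦ v == w ⟧) ≡⟨ sum-cong-≗ (λ w → not-+ (v == w)) ⟩
      sum {n} (const 1)              ≡⟨ trans (sum-const n 1) (*-identityʳ n) ⟩
      n                              ∎

  n²≡n[n-1]+n : ∀ n → n * n ≡ n * (n ∸ 1) + n
  n²≡n[n-1]+n zero    = refl
  n²≡n[n-1]+n (suc n) = trans (*-suc (suc n) n) (+-comm (suc n) (suc n * n))

  graph-with : ∀ n M → M ≤ n C 2 → ∃[ G ] ∣E∣ {n} G ≡ M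
  graph-with n M M≤N = map₂ proj₁ (graph-between M (λ _ _ → false) (λ v w → not (v == w))
    ((λ _ _ → refl) , (λ _ → refl))
    ((λ v w → cong not (==-sym v w)) , (λ v → cong not (==-refl v)))
    (λ _ _ ()) (≤-trans (≤-reflexive zeros) z≤n) hi)
    where
    zeros : total {n} (λ _ _ → false) ≡ 0
    zeros = trans (sum-cong-≗ {n} λ _ → sum-replicate-zero n) (sum-replicate-zero n)
    hi : 2 * M ≤ total (λ (v w : Fin n) → not (v == w))
    hi = ≤-trans (*-monoʳ-≤ 2 M≤N) (≤-reflexive (trans (2*nC2 n) (sym (+-cancelʳ-≡ n _ _
      (trans (total-complete n) (n²≡n[n-1]+n n))))))

  Σ<-head : ∀ n f → Σ< (suc n) f ≡ f 0 + Σ< n (f ∘ suc)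
  Σ<-head zero    f = +-comm 0 (f 0)
  Σ<-head (suc n) f = trans (cong (_+ f (suc n)) (Σ<-head n f)) (+-assoc (f 0) _ _)

  sum-toℕ : ∀ n (f : ℕ → ℕ) → sum {n} (λ v → f (toℕ v)) ≡ Σ< n f
  sum-toℕ zero    f = refl
  sum-toℕ (suc n) f = trans (cong (f 0 +_) (sum-toℕ n (f ∘ suc))) (sym (Σ<-head n f))

  Σ<-split : ∀ m k f → Σ< (m + k) f ≡ Σ< m f + Σ< k (λ j → f (m + j))
  Σ<-split m zero    f = trans (cong (λ x → Σ< x f) (+-identityʳ m)) (sym (+-identityʳ _))
  Σ<-split m (suc k) f = trans (cong (λ x → Σ< x f) (+-suc m k))
    (trans (cong (_+ f (m + k)) (Σ<-split m k f)) (+-assoc (Σ< m f) _ _))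

  Σ<-≤ : ∀ {m n} f → m ≤ n → Σ< m f ≤ Σ< n f
  Σ<-≤ {m} {n} f m≤n = ≤-trans (m≤m+n _ _) (≤-reflexive
    (trans (sym (Σ<-split m (n ∸ m) f)) (cong (λ x → Σ< x f) (m+[n∸m]≡n m≤n))))

  #-below : ∀ n L → L ≤ n → # (λ (v : Fin n) → toℕ v <ᵇ L) ≡ L
  #-below n L L≤n = begin
    # (λ (v : Fin n) → toℕ v <ᵇ L)                       ≡⟨ sum-toℕ n (λ j → ⟦ j <ᵇ L ⟧) ⟩
    Σ< n (λ j → ⟦ j <ᵇ L ⟧)
      ≡⟨ cong (λ x → Σ< x (λ j → ⟦ j <ᵇ L ⟧)) (m+[n∸m]≡n L≤n) ⟨
    Σ< (L + d) (λ j → ⟦ j <ᵇ L ⟧)                        ≡⟨ Σ<-split L d (λ j → ⟦ j <ᵇ L ⟧) ⟩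
    Σ< L (λ j → ⟦ j <ᵇ L ⟧) + Σ< d (λ j → ⟦ L + j <ᵇ L ⟧)
      ≡⟨ cong₂ _+_ (Σ<-cong L {g = const 1} (λ j j<L → cong ⟦_⟧ (<⇒<ᵇ′ j<L))) (Σ<-cong d {g = const 0} (λ j _ → cong ⟦_⟧ (above L j))) ⟩
    Σ< L (const 1) + Σ< d (const 0)
      ≡⟨ cong₂ _+_ (trans (Σ<-const L 1) (*-identityʳ L)) (trans (Σ<-const d 0) (*-zeroʳ d)) ⟩
    L + 0                                                ≡⟨ +-identityʳ L ⟩
    L                                                    ∎
    where
    open ≡-Reasoning
    d = n ∸ L
    above : ∀ L j → (L + j <ᵇ L) ≡ false
    above zero    j = refl
    above (suc L) j = above L j

  -- The balanced complete multipartite graph on residue classes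

  module Residues (r : ℕ) where

    R : ℕ
    R = suc r

    count : ℕ → ℕ → ℕ
    count n c = Σ< n λ j → ⟦ j % R ≡ᵇ c ⟧

    -- Sliding a window of `R` consecutive integers by one removes m and adds m + R, which have the
    -- same residue.
    window : ∀ c → c < R → ∀ m → Σ< R (λ j → ⟦ (m + j) % R ≡ᵇ c ⟧) ≡ 1
    window c c<R zero = trans (Σ<-cong R λ j j<R → cong ⟦_⟧
      (trans (cong (_≡ᵇ c) (m<n⇒m%n≡m j<R)) (≡ᵇ-sym j c))) (Σ<-δ R c c<R)
    window c c<R (suc m) = +-cancelˡ-≡ (g 0) _ _ (begin
      g 0 + Σ< R (λ j → ⟦ (suc m + j) % R ≡ᵇ c ⟧)
        ≡⟨ cong (g 0 +_) (Σ<-cong R λ j _ → cong (λ x → ⟦ x % R ≡ᵇ c ⟧) (sym (+-suc m j))) ⟩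
      g 0 + Σ< R (g ∘ suc)    ≡⟨ Σ<-head R g ⟨
      Σ< R g + g R            ≡⟨ cong₂ _+_ (window c c<R m) (cong (λ x → ⟦ x ≡ᵇ c ⟧)
                                   (trans ([m+n]%n≡m%n m R) (cong (_% R) (sym (+-identityʳ m))))) ⟩
      1 + g 0                 ≡⟨ +-comm 1 (g 0) ⟩
      g 0 + 1                 ∎)
      where
      open ≡-Reasoning
      g : ℕ → ℕ
      g j = ⟦ (m + j) % R ≡ᵇ c ⟧

    -- Each full period contributes exactly one element to the class and the incomplete rest at most
    -- one; scaled by `R`, the deviation from `n` is therefore at most r = R - 1.
    balanced : ∀ n c → c < R → R * count n c ≤ n + r × n ≤ R * count n c + r
    balanced n c c<R = subst (λ x → R * count x c ≤ x + r × x ≤ R * count x c + r)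
      (sym (m≡m%n+[m/n]*n n R)) (go (n / R))
      where
      s = n % R
      go : ∀ q → R * count (s + q * R) c ≤ s + q * R + r × s + q * R ≤ R * count (s + q * R) c + r
      go zero = subst (λ x → R * count x c ≤ x + r × x ≤ R * count x c + r) (sym (+-identityʳ s))
        (upper s (m%n<n n R) , ≤-trans (≤-pred (m%n<n n R)) (m≤n+m r _))
        where
        upper : ∀ s → s < R → R * count s c ≤ s + r
        upper zero    _   = ≤-trans (≤-reflexive (*-zeroʳ R)) z≤n
        upper (suc s) s<R = begin
          R * count (suc s) c
            ≤⟨ *-monoʳ-≤ R (≤-trans (Σ<-≤ _ (<⇒≤ s<R)) (≤-reflexive (window c c<R 0))) ⟩
          R * 1                 ≡⟨ *-identityʳ R ⟩
          suc r                 ≤⟨ s≤s (m≤n+m r s) ⟩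
          suc s + r             ∎
          where open ≤-Reasoning
      go (suc q) = subst (λ x → R * count x c ≤ x + r × x ≤ R * count x c + r) assoc
        (subst (λ y → R * y ≤ m + R + r × m + R ≤ R * y + r) (sym next)
          ( (begin
              R * (count m c + 1)      ≡⟨ l₁ R (count m c) ⟩
              R * count m c + R        ≤⟨ +-monoˡ-≤ R (proj₁ (go q)) ⟩
              m + r + R                ≡⟨ l₂ m r R ⟩
              m + R + r                ∎)
          , (begin
              m + R                    ≤⟨ +-monoˡ-≤ R (proj₂ (go q)) ⟩
              R * count m c + r + R    ≡⟨ l₃ R (count m c) r ⟩
              R * (count m c + 1) + r  ∎)))
        where
        open ≤-Reasoning
        m = s + q * R
        assoc : m + R ≡ s + suc q * R
        assoc = trans (+-assoc s (q * R) R) (cong (s +_) (+-comm (q * R) R))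
        next : count (m + R) c ≡ count m c + 1
        next = trans (Σ<-split m R _) (cong (count m c +_) (window c c<R m))
        l₁ : ∀ R x → R * (x + 1) ≡ R * x + R
        l₁ = solve-∀
        l₂ : ∀ m r R → m + r + R ≡ m + R + r
        l₂ = solve-∀
        l₃ : ∀ R x r → R * x + r + R ≡ R * (x + 1) + r
        l₃ = solve-∀

    module _ {n : ℕ} where

      class : Fin n → ℕ
      class v = toℕ v % R

      class<R : ∀ v → class v < R
      class<R v = m%n<n (toℕ v) R

      turán : Fin n → Fin n → Bool
      turán v w = not (class v ≡ᵇ class w)

      low : ℕ → Fin n → Bool
      low L v = toℕ v <ᵇ L

      -- Residues spread the first `L` vertices evenly over the classes, so joining all of them adds
      -- about L²/R to `total`, while every edge inside a class stays among these `L` vertices.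
      turán⁺ : ℕ → Fin n → Fin n → Bool
      turán⁺ L v w = turán v w ∨ (not (v == w) ∧ (low L v ∧ low L w))

      turán-graph : IsGraph turán
      turán-graph = (λ v w → cong not (≡ᵇ-sym (class v) (class w))) , λ v → cong not (≡ᵇ-refl (class v))

      turán⁺-graph : ∀ L → IsGraph (turán⁺ L)
      turán⁺-graph L =
        (λ v w → cong₂ _∨_ (proj₁ turán-graph v w)
          (cong₂ _∧_ (cong not (==-sym v w)) (Bool.∧-comm (low L v) (low L w)))) ,
        (λ v → cong₂ (λ b c → b ∨ (not c ∧ (low L v ∧ low L v))) (proj₂ turán-graph v) (==-refl v))

      turán-⊑ : ∀ L → turán ⊑ turán⁺ L
      turán-⊑ L v w e = cong (_∨ (not (v == w) ∧ (low L v ∧ low L w))) e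

      #-class : ∀ c → # (λ v → class v ≡ᵇ c) ≡ count n c
      #-class c = sum-toℕ n (λ j → ⟦ j % R ≡ᵇ c ⟧)

      row : ∀ v → # (turán v) + count n (class v) ≡ n
      row v = begin
        # (turán v) + count n (class v)
          ≡⟨ cong (# (turán v) +_) (trans (#-cong λ w → ≡ᵇ-sym (class v) (class w)) (#-class (class v))) ⟨
        # (turán v) + # (λ w → class v ≡ᵇ class w)       ≡⟨ ∑-distrib-+ (λ w → ⟦ turán v w ⟧) _ ⟨
        sum (λ w → ⟦ turán v w ⟧ + ⟦ class v ≡ᵇ class w ⟧)
          ≡⟨ sum-cong-≗ (λ w → not-+ (class v ≡ᵇ class w)) ⟩
        sum {n} (const 1)                                ≡⟨ trans (sum-const n 1) (*-identityʳ n) ⟩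
        n                                                ∎
        where
        open ≡-Reasoning
        not-+ : ∀ b → ⟦ not b ⟧ + ⟦ b ⟧ ≡ 1
        not-+ false = refl
        not-+ true  = refl

      row-upper : ∀ v → R * # (turán v) ≤ r * n + r
      row-upper v = +-cancelʳ-≤ n _ _ (begin
        R * # (turán v) + n
          ≤⟨ +-monoʳ-≤ (R * # (turán v)) (proj₂ (balanced n (class v) (class<R v))) ⟩
        R * # (turán v) + (R * count n (class v) + r) ≡⟨ l₁ R (# (turán v)) (count n (class v)) r ⟩
        R * (# (turán v) + count n (class v)) + r    ≡⟨ cong (λ x → R * x + r) (row v) ⟩
        R * n + r                                    ≡⟨ l₂ r n ⟩
        r * n + r + n                                ∎)
        where
        open ≤-Reasoning
        l₁ : ∀ R x y r → R * x + (R * y + r) ≡ R * (x + y) + r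
        l₁ = solve-∀
        l₂ : ∀ r n → suc r * n + r ≡ r * n + r + n
        l₂ = solve-∀

      row-lower : ∀ v → r * n ≤ R * # (turán v) + r
      row-lower v = +-cancelʳ-≤ n _ _ (begin
        r * n + n                                    ≡⟨ +-comm (r * n) n ⟩
        R * n                                        ≡⟨ cong (R *_) (row v) ⟨
        R * (# (turán v) + count n (class v))        ≡⟨ *-distribˡ-+ R (# (turán v)) _ ⟩
        R * # (turán v) + R * count n (class v)
          ≤⟨ +-monoʳ-≤ (R * # (turán v)) (proj₁ (balanced n (class v) (class<R v))) ⟩
        R * # (turán v) + (n + r)                    ≡⟨ l (R * # (turán v)) n r ⟩
        R * # (turán v) + r + n                      ∎)
        where
        open ≤-Reasoning
        l : ∀ x n r → x + (n + r) ≡ x + r + n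
        l = solve-∀

      total-turán : R * total turán ≤ n * (r * n + r)
      total-turán = begin
        R * sum (λ v → # (turán v))     ≡⟨ *-distribˡ-sum R (λ v → # (turán v)) ⟩
        sum (λ v → R * # (turán v))     ≤⟨ sum-≤ (r * n + r) row-upper ⟩
        n * (r * n + r)                 ∎
        where open ≤-Reasoning

      -- A low vertex is joined in addition to the other low vertices of its own class, about L/R of
      -- them. In the error, one `r` rounds the multipartite degree and, for low vertices, another
      -- rounds the class size below `L`, and `R` pays for `v` not being its own neighbour.
      row⁺ : ∀ L → L ≤ n → ∀ v → r * n + ⟦ low L v ⟧ * L ≤ R * # (turán⁺ L v) + r + ⟦ low L v ⟧ * (R + r)
      row⁺ L L≤n v = cases (low L v) refl
        where
        open ≤-Reasoning
        cases : ∀ b → low L v ≡ b → r * n + ⟦ b ⟧ * L ≤ R * # (turán⁺ L v) + r + ⟦ b ⟧ * (R + r)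
        cases false _ = begin
          r * n + 0                           ≡⟨ +-identityʳ (r * n) ⟩
          r * n                               ≤⟨ row-lower v ⟩
          R * # (turán v) + r
            ≤⟨ +-monoˡ-≤ r (*-monoʳ-≤ R (#-mono {s = turán v} {turán⁺ L v} (turán-⊑ L v))) ⟩
          R * # (turán⁺ L v) + r              ≡⟨ +-identityʳ _ ⟨
          R * # (turán⁺ L v) + r + 0          ∎
        cases true v<L = begin
          r * n + (L + 0)
            ≤⟨ +-mono-≤ (row-lower v) (≤-trans (≤-reflexive (+-identityʳ L)) (proj₂ (balanced L (class v) (class<R v)))) ⟩
          R * # (turán v) + r + (R * count L (class v) + r)
            ≡⟨ l₁ R (# (turán v)) (count L (class v)) r ⟩
          R * (# (turán v) + count L (class v)) + (r + r)
            ≤⟨ +-monoˡ-≤ (r + r) (*-monoʳ-≤ R extra) ⟩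
          R * (# (turán⁺ L v) + 1) + (r + r)            ≡⟨ l₂ R (# (turán⁺ L v)) r ⟩
          R * # (turán⁺ L v) + r + (R + r + 0)          ∎
          where
          l₁ : ∀ R x y r → R * x + r + (R * y + r) ≡ R * (x + y) + (r + r)
          l₁ = solve-∀
          l₂ : ∀ R x r → R * (x + 1) + (r + r) ≡ R * x + r + (R + r + 0)
          l₂ = solve-∀
          near : Fin n → Bool
          near w = (class w ≡ᵇ class v) ∧ low L w
          few : count L (class v) ≤ # near
          few = begin
            count L (class v)
              ≡⟨ Σ<-cong L (λ j j<L → cong ⟦_⟧ (sym (trans (cong ((j % R ≡ᵇ class v) ∧_) (<⇒<ᵇ′ j<L)) (Bool.∧-identityʳ _)))) ⟩
            Σ< L (λ j → ⟦ (j % R ≡ᵇ class v) ∧ (j <ᵇ L) ⟧)  ≤⟨ Σ<-≤ _ L≤n ⟩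
            Σ< n (λ j → ⟦ (j % R ≡ᵇ class v) ∧ (j <ᵇ L) ⟧)  ≡⟨ sum-toℕ n _ ⟨
            # near                                          ∎
          pointwise : ∀ w → ⟦ turán v w ⟧ + ⟦ near w ⟧ ≤ ⟦ turán⁺ L v w ⟧ + ⟦ v == w ⟧
          pointwise w rewrite ≡ᵇ-sym (class w) (class v) | v<L with class v ≡ᵇ class w | v == w | low L w
          ... | false | _     | _     = m≤m+n 1 _
          ... | true  | false | false = z≤n
          ... | true  | false | true  = ≤-refl
          ... | true  | true  | b     = ⟦⟧≤1 b
          extra : # (turán v) + count L (class v) ≤ # (turán⁺ L v) + 1
          extra = begin
            # (turán v) + count L (class v)          ≤⟨ +-monoʳ-≤ (# (turán v)) few ⟩
            # (turán v) + # near
              ≡⟨ ∑-distrib-+ (λ w → ⟦ turán v w ⟧) (λ w → ⟦ near w ⟧) ⟨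
            sum (λ w → ⟦ turán v w ⟧ + ⟦ near w ⟧)   ≤⟨ sum-mono pointwise ⟩
            sum (λ w → ⟦ turán⁺ L v w ⟧ + ⟦ v == w ⟧)
              ≡⟨ ∑-distrib-+ (λ w → ⟦ turán⁺ L v w ⟧) (λ w → ⟦ v == w ⟧) ⟩
            # (turán⁺ L v) + # (v ==_)
              ≡⟨ cong (# (turán⁺ L v) +_) (trans (#-cong λ w → ==-sym v w) (#-singleton v)) ⟩
            # (turán⁺ L v) + 1                       ∎

      total-turán⁺ : ∀ L → L ≤ n → n * (r * n) + L * L ≤ R * total (turán⁺ L) + n * r + L * (R + r)
      total-turán⁺ L L≤n = begin
        n * (r * n) + L * L
          ≡⟨ cong₂ _+_ (sum-const n (r * n)) (cong (_* L) (#-below n L L≤n)) ⟨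
        sum {n} (const (r * n)) + # (low L) * L
          ≡⟨ cong (sum {n} (const (r * n)) +_) (*-distribʳ-sum L (λ v → ⟦ low L v ⟧)) ⟩
        sum {n} (const (r * n)) + sum (λ v → ⟦ low L v ⟧ * L)
          ≡⟨ ∑-distrib-+ {n} (const (r * n)) _ ⟨
        sum (λ v → r * n + ⟦ low L v ⟧ * L)
          ≤⟨ sum-mono (row⁺ L L≤n) ⟩
        sum (λ v → R * # (turán⁺ L v) + r + ⟦ low L v ⟧ * (R + r))
          ≡⟨ ∑-distrib-+ (λ v → R * # (turán⁺ L v) + r) _ ⟩
        sum (λ v → R * # (turán⁺ L v) + r) + sum (λ v → ⟦ low L v ⟧ * (R + r))
          ≡⟨ cong₂ _+_ (trans (∑-distrib-+ (λ v → R * # (turán⁺ L v)) (const r))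
               (cong₂ _+_ (sym (*-distribˡ-sum R (λ v → # (turán⁺ L v)))) (sum-const n r)))
               (trans (sym (*-distribʳ-sum (R + r) (λ v → ⟦ low L v ⟧))) (cong (_* (R + r)) (#-below n L L≤n))) ⟩
        R * total (turán⁺ L) + n * r + L * (R + r) ∎
        where
        open ≤-Reasoning

      -- Pigeonhole: if every class had less than the average share of `s`, adding the `R` strict
      -- inequalities would give R # s < R # s.
      crowded-class : ∀ (s : Fin n → Bool) → ∃[ c ] # s ≤ R * # (λ v → s v ∧ (class v ≡ᵇ c))
      crowded-class s with anyUpTo? (λ c → # s ≤? R * # (λ v → s v ∧ (class v ≡ᵇ c))) R
      ... | yes (c , _ , le) = c , le
      ... | no  none = contradiction (begin-strict
          R * # s                          <⟨ m<n+m (R * # s) {R * 1} z<s ⟩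
          R * 1 + R * # s
            ≡⟨ cong₂ _+_ (Σ<-const R 1) (trans (Σ<-* R R h) (cong (R *_) (sym split))) ⟨
          Σ< R (const 1) + Σ< R (λ c → R * h c) ≡⟨ Σ<-+ R (const 1) (λ c → R * h c) ⟨
          Σ< R (λ c → 1 + R * h c)         ≤⟨ Σ<-mono R (λ c c<R → ≰⇒> λ le → none (c , c<R , le)) ⟩
          Σ< R (const (# s))               ≡⟨ Σ<-const R (# s) ⟩
          R * # s                          ∎) (<-irrefl refl)
        where
        open ≤-Reasoning
        h : ℕ → ℕ
        h c = # (λ v → s v ∧ (class v ≡ᵇ c))
        split : # s ≡ Σ< R h
        split = trans (#-cong λ v → sym (trans (cong (s v ∧_) (<⇒<ᵇ′ (class<R v))) (Bool.∧-identityʳ (s v))))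
          (#-split s class R)

      -- `E` equals R N (p - r/R). If the crowded class of `S` is all low, it has at most `L`
      -- vertices and m <= R L. Otherwise it contains a vertex without neighbours in that class, of
      -- degree at most r m / R in `S`; comparing with the required p (m - 1) leaves E (m - 1) <= r
      -- N.
      full-order : ∀ N M E L → L ≤ n → r * N + E ≡ R * M → (a : Fin n → Fin n → Bool) → a ⊑ turán⁺ L →
        ∀ m → Full a N M m → m ≤ R * L ⊎ E * (m ∸ 1) ≤ r * N
      full-order N M E L L≤n E≡ a a⊑ m (S , ∣S∣≡m , 1≤m , min) = cases (crowded-class s)
        where
        open ≤-Reasoning
        s : Fin n → Bool
        s = lookup S
        #s≡m : # s ≡ m
        #s≡m = trans (sym (∣∣≡# S)) ∣S∣≡m
        cases : (∃[ c ] # s ≤ R * # (λ v → s v ∧ (class v ≡ᵇ c))) → _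
        cases (c , le) with Fin.any? (λ v → (s v ∧ (class v ≡ᵇ c) Bool.≟ true) ×-dec L ≤? toℕ v)
        ... | no none = inj₁ (begin
          m          ≡⟨ #s≡m ⟨
          # s        ≤⟨ le ⟩
          R * # (λ v → s v ∧ (class v ≡ᵇ c))
            ≤⟨ *-monoʳ-≤ R (#-mono {t = low L} λ v v∈ → <⇒<ᵇ′ (≰⇒> λ L≤v → none (v , v∈ , L≤v))) ⟩
          R * # (low L) ≡⟨ cong (R *_) (#-below n L L≤n) ⟩
          R * L      ∎)
        ... | yes (v , v∈ , L≤v) = inj₂ (+-cancelˡ-≤ (r * N * (m ∸ 1)) _ _ (begin
          r * N * (m ∸ 1) + E * (m ∸ 1)    ≡⟨ *-distribʳ-+ (m ∸ 1) (r * N) E ⟨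
          (r * N + E) * (m ∸ 1)            ≡⟨ cong (_* (m ∸ 1)) E≡ ⟩
          R * M * (m ∸ 1)                  ≡⟨ *-assoc R M (m ∸ 1) ⟩
          R * (M * (m ∸ 1))                ≤⟨ *-monoʳ-≤ R (min v (lookup⇒[]= v S v∈s)) ⟩
          R * (N * d)                      ≡⟨ l₁ R N d ⟩
          N * (R * d)                      ≤⟨ *-monoʳ-≤ N Rd≤rm ⟩
          N * (r * m)                      ≡⟨ cong (λ x → N * (r * x)) (m∸n+n≡m 1≤m) ⟨
          N * (r * (m ∸ 1 + 1))            ≡⟨ l₂ N r (m ∸ 1) ⟩
          r * N * (m ∸ 1) + r * N          ∎))
          where
          d = deg a s v
          h = # (λ w → s w ∧ (class w ≡ᵇ c))
          v∈s : s v ≡ true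
          v∈s with s v
          ... | true = refl
          class≡c : class v ≡ c
          class≡c with s v
          ... | true = ≡ᵇ⇒≡′ (class v) c v∈
          v≮L : low L v ≡ false
          v≮L with low L v in e
          ... | false = refl
          ... | true  = contradiction (<ᵇ⇒<′ (toℕ v) L e) (≤⇒≯ L≤v)
          l₁ : ∀ R N d → R * (N * d) ≡ N * (R * d)
          l₁ = solve-∀
          l₂ : ∀ N r m → N * (r * (m + 1)) ≡ r * N * m + r * N
          l₂ = solve-∀
          pointwise : ∀ w → ⟦ a v w ∧ s w ⟧ + ⟦ s w ∧ (class w ≡ᵇ c) ⟧ ≤ ⟦ s w ⟧
          pointwise w with s w | a v w in vw | class w ≡ᵇ c in wc
          ... | false | false | _     = z≤n
          ... | false | true  | _     = z≤n
          ... | true  | false | b     = ⟦⟧≤1 b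
          ... | true  | true  | false = ≤-refl
          ... | true  | true  | true  = contradiction (trans (sym (a⊑ v w vw)) nonadjacent) λ ()
            where
            nonadjacent : turán⁺ L v w ≡ false
            nonadjacent rewrite v≮L | class≡c | ≡ᵇ-sym c (class w) | wc = Bool.∧-zeroʳ (not (v == w))
          d+h≤m : d + h ≤ m
          d+h≤m = begin
            d + h
              ≡⟨ ∑-distrib-+ (λ w → ⟦ a v w ∧ s w ⟧) _ ⟨
            sum (λ w → ⟦ a v w ∧ s w ⟧ + ⟦ s w ∧ (class w ≡ᵇ c) ⟧)   ≤⟨ sum-mono pointwise ⟩
            # s                                                      ≡⟨ #s≡m ⟩
            m                                                        ∎
          Rd≤rm : R * d ≤ r * m
          Rd≤rm = +-cancelˡ-≤ m _ _ (begin
            m + R * d        ≡⟨ +-comm m (R * d) ⟩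
            R * d + m        ≤⟨ +-monoʳ-≤ (R * d) (≤-trans (≤-reflexive (sym #s≡m)) le) ⟩
            R * d + R * h    ≡⟨ *-distribˡ-+ R d h ⟨
            R * (d + h)      ≤⟨ *-monoʳ-≤ R d+h≤m ⟩
            m + r * m        ∎)

    -- The graph lies between `turán` and `turán⁺ L`. The hypothesis r n <= E absorbs the rounding
    -- in the edge number of `turán`, and `room` says that filling in the first `L` vertices
    -- supplies enough further edges to reach `M`.
    sparse-extremal : ∀ n M E L → L ≤ n → r * (n C 2) + E ≡ R * M → r * n ≤ E → 2 * E + L * (R + r) ≤ L * L →
      ∃[ G ] ∣E∣ {n} G ≡ M × (∀ m → Full (adj G) (n C 2) M m → m ≤ R * L ⊎ E * (m ∸ 1) ≤ r * (n C 2))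
    sparse-extremal n M E L L≤n E≡ rn≤E room = build (graph-between M turán (turán⁺ L) turán-graph (turán⁺-graph L)
        (turán-⊑ L) (*-cancelˡ-≤ R lo) (*-cancelˡ-≤ R hi))
      where
      open ≤-Reasoning
      N = n C 2
      build : (∃[ G ] ∣E∣ {n} G ≡ M × turán ⊑ adj G × adj G ⊑ turán⁺ L) → _
      build (G , G≡M , _ , G⊑) = G , G≡M , full-order N M E L L≤n E≡ (adj G) G⊑
      2RM : r * (n * n) + 2 * E ≡ R * (2 * M) + r * n
      2RM = begin-equality
        r * (n * n) + 2 * E                       ≡⟨ cong (λ x → r * x + 2 * E) (n²≡n[n-1]+n n) ⟩
        r * (n * (n ∸ 1) + n) + 2 * E             ≡⟨ cong (λ x → r * (x + n) + 2 * E) (2*nC2 n) ⟨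
        r * (2 * N + n) + 2 * E                   ≡⟨ l₁ r N n E ⟩
        2 * (r * N + E) + r * n                   ≡⟨ cong (λ x → 2 * x + r * n) E≡ ⟩
        2 * (R * M) + r * n                       ≡⟨ cong (_+ r * n) (l₂ R M) ⟩
        R * (2 * M) + r * n                       ∎
        where
        l₁ : ∀ r N n E → r * (2 * N + n) + 2 * E ≡ 2 * (r * N + E) + r * n
        l₁ = solve-∀
        l₂ : ∀ R M → 2 * (R * M) ≡ R * (2 * M)
        l₂ = solve-∀
      lo : R * total {n} turán ≤ R * (2 * M)
      lo = +-cancelʳ-≤ (r * n) _ _ (begin
        R * total {n} turán + r * n      ≤⟨ +-monoˡ-≤ (r * n) (total-turán {n}) ⟩
        n * (r * n + r) + r * n          ≡⟨ l n r ⟩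
        r * (n * n) + 2 * (r * n)        ≤⟨ +-monoʳ-≤ (r * (n * n)) (*-monoʳ-≤ 2 rn≤E) ⟩
        r * (n * n) + 2 * E              ≡⟨ 2RM ⟩
        R * (2 * M) + r * n              ∎)
        where
        l : ∀ n r → n * (r * n + r) + r * n ≡ r * (n * n) + 2 * (r * n)
        l = solve-∀
      hi : R * (2 * M) ≤ R * total {n} (turán⁺ L)
      hi = +-cancelʳ-≤ (r * n + L * (R + r)) _ _ (begin
        R * (2 * M) + (r * n + L * (R + r))              ≡⟨ +-assoc (R * (2 * M)) (r * n) _ ⟨
        R * (2 * M) + r * n + L * (R + r)                ≡⟨ cong (_+ L * (R + r)) 2RM ⟨
        r * (n * n) + 2 * E + L * (R + r)                ≡⟨ +-assoc (r * (n * n)) (2 * E) _ ⟩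
        r * (n * n) + (2 * E + L * (R + r))              ≤⟨ +-monoʳ-≤ (r * (n * n)) room ⟩
        r * (n * n) + L * L                              ≡⟨ cong (_+ L * L) (l r n) ⟩
        n * (r * n) + L * L                              ≤⟨ total-turán⁺ L L≤n ⟩
        R * total {n} (turán⁺ L) + n * r + L * (R + r)
          ≡⟨ l₂ (R * total {n} (turán⁺ L)) n r (L * (R + r)) ⟩
        R * total {n} (turán⁺ L) + (r * n + L * (R + r)) ∎)
        where
        l : ∀ r n → r * (n * n) ≡ n * (r * n)
        l = solve-∀
        l₂ : ∀ x n r y → x + n * r + y ≡ x + (r * n + y)
        l₂ = solve-∀

-- From real powers to inequalities between rational cubes

module Reals where

  open Partitions
  open Graphs
  open import Defs
  open import Data.Integer.Base as ℤ using (ℤ; +_; -[1+_])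
  open import Data.Nat.Base as ℕ using (ℕ; zero; suc; NonTrivial; NonZero)
  open import Data.Nat.Combinatorics using (_C_)
  import Data.Nat.Properties as ℕ
  open import Data.Product.Base using (_×_; _,_; ∃; ∃-syntax; proj₁; proj₂)
  open import Data.Rational.Base as ℚ
    using (ℚ; 0ℚ; 1ℚ; ½; _+_; _*_; _-_; -_; _/_; _≤_; _<_; _⊔_; ↥_; ↧ₙ_)
  import Data.Rational.Properties as ℚ
  open import Data.Rational.Solver using (module +-*-Solver)
  open import Relation.Binary.PropositionalEquality
  open import Relation.Nullary using (yes; no; contradiction)
  open import Algebra.Definitions.RawSemiring ℚ.+-*-rawSemiring using (_^_)
  open +-*-Solver using (solve; _:=_; _:+_; _:*_; :-_; _:-_; con)
  import Data.Nat.Tactic.RingSolver as ℕ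
  open import Data.Sum.Base using (_⊎_; inj₁; inj₂)

  0≤1 : 0ℚ ≤ 1ℚ
  0≤1 = ℚ.nonNegative⁻¹ 1ℚ

  *-pos : ∀ {a b} → 0ℚ < a → 0ℚ < b → 0ℚ < a * b
  *-pos {a} {b} 0<a 0<b = subst (_< a * b) (ℚ.*-zeroʳ a) (ℚ.*-monoʳ-<-pos a {{ℚ.positive 0<a}} 0<b)

  *-nonNeg : ∀ {a b} → 0ℚ ≤ a → 0ℚ ≤ b → 0ℚ ≤ a * b
  *-nonNeg {a} {b} 0≤a 0≤b = subst (_≤ a * b) (ℚ.*-zeroʳ a) (ℚ.*-monoˡ-≤-nonNeg a {{ℚ.nonNegative 0≤a}} 0≤b)

  *-mono-≤ : ∀ {a b c d} → 0ℚ ≤ a → 0ℚ ≤ d → a ≤ b → c ≤ d → a * c ≤ b * d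
  *-mono-≤ {a} {b} {c} {d} 0≤a 0≤d a≤b c≤d = ℚ.≤-trans
    (ℚ.*-monoˡ-≤-nonNeg a {{ℚ.nonNegative 0≤a}} c≤d) (ℚ.*-monoʳ-≤-nonNeg d {{ℚ.nonNegative 0≤d}} a≤b)

  ^-pos : ∀ {a} b → 0ℚ < a → 0ℚ < a ^ b
  ^-pos zero    _   = ℚ.positive⁻¹ 1ℚ
  ^-pos (suc b) 0<a = *-pos 0<a (^-pos b 0<a)

  ^-cancel-≤ : ∀ {a c} b → 0ℚ ≤ c → a ^ suc b ≤ c ^ suc b → a ≤ c
  ^-cancel-≤ {a} {c} b 0≤c le = ℚ.≮⇒≥ λ c<a → ℚ.<-irrefl refl (ℚ.<-≤-trans (strict c<a) le)
    where
    strict : c < a → c ^ suc b < a ^ suc b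
    strict c<a = ℚ.≤-<-trans (ℚ.*-monoˡ-≤-nonNeg c {{ℚ.nonNegative 0≤c}} (^-mono b 0≤c (ℚ.<⇒≤ c<a)))
      (ℚ.*-monoˡ-<-pos (a ^ b) {{ℚ.positive (^-pos b (ℚ.≤-<-trans 0≤c c<a))}} c<a)

  inv-inverse : ∀ {q} → 0ℚ < q → inv q * q ≡ 1ℚ
  inv-inverse {q} 0<q with q ℚ.≟ 0ℚ
  ... | yes refl = contradiction 0<q (ℚ.<-irrefl refl)
  ... | no  q≢0  = ℚ.*-inverseˡ q {{ℚ.≢-nonZero q≢0}}

  inv-nonNeg : ∀ {q} → 0ℚ ≤ q → 0ℚ ≤ inv q
  inv-nonNeg {q} 0≤q with q ℚ.≟ 0ℚ
  ... | yes _   = ℚ.≤-refl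
  ... | no  q≢0 = ℚ.<⇒≤ (ℚ.positive⁻¹ _ {{ℚ.1/pos⇒pos q {{0<q}}}})
    where
    0<q : ℚ.Positive q
    0<q = ℚ.nonNeg∧nonZero⇒pos q {{ℚ.nonNegative 0≤q}} {{ℚ.≢-nonZero q≢0}}

  -- All that is required of a root: its approximations bracket it within 1/(i+1), with the bracket
  -- expressed through b-th powers. Comparisons of roots thus become comparisons of rational powers.
  record IsRoot (b : ℕ) (q : ℚ) (ρ : ℝ) : Set where
    field
      0≤ρ   : ∀ i → 0ℚ ≤ seq ρ i
      below : ∀ i → seq ρ i ^ b ≤ q
      above : ∀ i → q < (seq ρ i + + 1 / suc i) ^ b

  root-isRoot : ∀ b .{{_ : ℕ.NonZero b}} {q} → 0ℚ ≤ q → IsRoot b q (root b q)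
  root-isRoot b {q} 0≤q = record
    { 0≤ρ   = λ i → 0≤/ (rootNum b q i) i
    ; below = λ i → subst (rootSeq b q i ^ b ≤_) eq (rootSeq-≤ b q i)
    ; above = λ i → subst₂ _<_ eq (cong (_^ b) (/-suc (rootNum b q i) i)) (<-rootSeq b q i)
    }
    where
    eq : q ⊔ 0ℚ ≡ q
    eq = ℚ.p≥q⇒p⊔q≡p 0≤q

  ^ᴿ-isRoot : ∀ x e → 0ℚ ≤ x ^ℤ ↥ e → IsRoot (↧ₙ e) (x ^ℤ ↥ e) (x ^ᴿ e)
  ^ᴿ-isRoot x e = root-isRoot (↧ₙ e)

  -- At an index where 1/(i+1) is smaller than the margin of the strict inequality, the upper end of
  -- the bracket is at most `p`.
  root-<ᴿ : ∀ {b q ρ} p → IsRoot b q ρ → ρ <ᴿ fromℚ p → q < p ^ b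
  root-<ᴿ {b} {ρ = ρ} p isRoot (ε , 0<ε , K , small) = ℚ.<-≤-trans (above i)
    (^-mono b (ℚ.+-mono-≤ (0≤ρ i) (0≤/ 1 i))
      (ℚ.≤-trans (ℚ.+-monoʳ-≤ (seq ρ i) (ℚ.<⇒≤ (archimedean 0<ε i (ℕ.m≤n⊔m K (↧ₙ ε)))))
        (small i (ℕ.m≤m⊔n K (↧ₙ ε)))))
    where
    open IsRoot isRoot
    i = K ℕ.⊔ ↧ₙ ε

  fromℕ-∸ : ∀ {m n} → m ℕ.≤ n → fromℕ (n ℕ.∸ m) ≡ fromℕ n - fromℕ m
  fromℕ-∸ {m} {n} m≤n = begin
    fromℕ (n ℕ.∸ m)
      ≡⟨ solve 2 (λ x y → x := (x :+ y) :- y) refl _ (fromℕ m) ⟩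
    fromℕ (n ℕ.∸ m) + fromℕ m - fromℕ m        ≡⟨ cong (_- fromℕ m) (fromℕ-+ (n ℕ.∸ m) m) ⟨
    fromℕ (n ℕ.∸ m ℕ.+ m) - fromℕ m            ≡⟨ cong (λ x → fromℕ x - fromℕ m) (ℕ.m∸n+n≡m m≤n) ⟩
    fromℕ n - fromℕ m                          ∎
    where open ≡-Reasoning

  fromℕ-cube : ∀ n → fromℕ (cube n) ≡ fromℕ n ^ 3
  fromℕ-cube n = trans (fromℕ-* n (n ℕ.* n)) (trans (cong (fromℕ n *_) (fromℕ-* n n))
    (cong (λ x → fromℕ n * (fromℕ n * x)) (sym (ℚ.*-identityʳ (fromℕ n)))))

  fromℕ-square : ∀ n → fromℕ (n ℕ.* n) ≡ fromℕ n ^ 2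
  fromℕ-square n = trans (fromℕ-* n n) (cong (fromℕ n *_) (sym (ℚ.*-identityʳ (fromℕ n))))

  module _ (n : ℕ) .{{_ : NonTrivial n}} (p : ℚ) (M : ℕ) (p≡ : p * fromℕ (n C 2) ≡ fromℕ M) where

    private
      N = n C 2
      x = fromℕ n

      0<n : 0 ℕ.< n
      0<n = ℕ.<-trans (ℕ.s≤s ℕ.z≤n) (ℕ.nonTrivial⇒n>1 n)

      0<N : 0 ℕ.< N
      0<N = ℕ.>-nonZero⁻¹ N {{nC2≢0 n}}

    M≤N : p ≤ 1ℚ → M ℕ.≤ N
    M≤N p≤1 = fromℕ-cancel-≤ (subst₂ _≤_ p≡ (ℚ.*-identityˡ (fromℕ N))
      (ℚ.*-monoʳ-≤-nonNeg (fromℕ N) {{fromℕ-nonNeg N}} p≤1))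

    M<N : p < 1ℚ → M ℕ.< N
    M<N p<1 = fromℕ-cancel-< (subst₂ _<_ p≡ (ℚ.*-identityˡ (fromℕ N))
      (ℚ.*-monoˡ-<-pos (fromℕ N) {{fromℕ-pos 0<N}} p<1))

    -- The cube of n^(-2/3) < p, multiplied by N³ n².
    cleared-< : inv x ^ 2 < p ^ 3 → cube N ℕ.< cube M ℕ.* (n ℕ.* n)
    cleared-< lt = fromℕ-cancel-< (subst₂ _<_ lhs rhs
      (ℚ.*-monoˡ-<-pos (fromℕ N ^ 3 * x ^ 2) {{ℚ.positive (*-pos (^-pos 3 0<N′) (^-pos 2 0<x))}} lt))
      where
      open ≡-Reasoning
      0<N′ : 0ℚ < fromℕ N
      0<N′ = fromℕ-mono-< {0} {N} 0<N
      0<x : 0ℚ < x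
      0<x = fromℕ-mono-< {0} {n} 0<n
      lhs : inv x ^ 2 * (fromℕ N ^ 3 * x ^ 2) ≡ fromℕ (cube N)
      lhs = begin
        inv x ^ 2 * (fromℕ N ^ 3 * x ^ 2)
          ≡⟨ solve 3 (λ i c x → i :* (i :* con 1ℚ) :* (c :* (x :* (x :* con 1ℚ))) := c :* ((i :* x) :* (i :* x)))
               refl (inv x) (fromℕ N ^ 3) x ⟩
        fromℕ N ^ 3 * ((inv x * x) * (inv x * x))
          ≡⟨ cong (λ y → fromℕ N ^ 3 * (y * y)) (inv-inverse 0<x) ⟩
        fromℕ N ^ 3 * 1ℚ
          ≡⟨ ℚ.*-identityʳ (fromℕ N ^ 3) ⟩
        fromℕ N ^ 3
          ≡⟨ fromℕ-cube N ⟨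
        fromℕ (cube N) ∎
      rhs : p ^ 3 * (fromℕ N ^ 3 * x ^ 2) ≡ fromℕ (cube M ℕ.* (n ℕ.* n))
      rhs = begin
        p ^ 3 * (fromℕ N ^ 3 * x ^ 2)
          ≡⟨ solve 3 (λ p N x² → p :* (p :* (p :* con 1ℚ)) :* (N :* (N :* (N :* con 1ℚ)) :* x²)
               := (p :* N) :* ((p :* N) :* ((p :* N) :* con 1ℚ)) :* x²) refl p (fromℕ N) (x ^ 2) ⟩
        (p * fromℕ N) ^ 3 * x ^ 2
          ≡⟨ cong (λ y → y ^ 3 * x ^ 2) p≡ ⟩
        fromℕ M ^ 3 * x ^ 2
          ≡⟨ cong₂ _*_ (fromℕ-cube M) (fromℕ-square n) ⟨
        fromℕ (cube M) * fromℕ (n ℕ.* n)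
          ≡⟨ fromℕ-* (cube M) (n ℕ.* n) ⟨
        fromℕ (cube M ℕ.* (n ℕ.* n)) ∎

    uncleared-≤ : ∀ k → M ℕ.≤ N →
      (N ℕ.∸ M) ℕ.* (N ℕ.∸ M) ℕ.* (n ℕ.* n) ℕ.≤ 64 ℕ.* cube (suc k) ℕ.* (N ℕ.* N) →
      (1ℚ - p) ^ 2 * x ^ 2 ≤ fromℕ 64 * fromℕ (suc k) ^ 3
    uncleared-≤ k M≤N le = ℚ.*-cancelʳ-≤-pos (fromℕ N ^ 2)
        {{ℚ.positive (^-pos 2 (fromℕ-mono-< {0} {N} 0<N))}} (subst₂ _≤_ lhs rhs (fromℕ-mono-≤ le))
      where
      open ≡-Reasoning
      R = N ℕ.∸ M
      R≡ : fromℕ R ≡ (1ℚ - p) * fromℕ N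
      R≡ = begin
        fromℕ R                    ≡⟨ fromℕ-∸ M≤N ⟩
        fromℕ N - fromℕ M          ≡⟨ cong (λ y → fromℕ N - y) p≡ ⟨
        fromℕ N - p * fromℕ N
          ≡⟨ solve 2 (λ p N → N :- p :* N := (con 1ℚ :- p) :* N) refl p (fromℕ N) ⟩
        (1ℚ - p) * fromℕ N         ∎
      lhs : fromℕ (R ℕ.* R ℕ.* (n ℕ.* n)) ≡ (1ℚ - p) ^ 2 * x ^ 2 * fromℕ N ^ 2
      lhs = begin
        fromℕ (R ℕ.* R ℕ.* (n ℕ.* n))           ≡⟨ fromℕ-* (R ℕ.* R) (n ℕ.* n) ⟩
        fromℕ (R ℕ.* R) * fromℕ (n ℕ.* n)       ≡⟨ cong₂ _*_ (fromℕ-square R) (fromℕ-square n) ⟩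
        fromℕ R ^ 2 * x ^ 2                     ≡⟨ cong (λ y → y ^ 2 * x ^ 2) R≡ ⟩
        ((1ℚ - p) * fromℕ N) ^ 2 * x ^ 2
          ≡⟨ solve 3 (λ q N x² → (q :* N) :* ((q :* N) :* con 1ℚ) :* x² := q :* (q :* con 1ℚ) :* x² :* (N :* (N :* con 1ℚ)))
               refl (1ℚ - p) (fromℕ N) (x ^ 2) ⟩
        (1ℚ - p) ^ 2 * x ^ 2 * fromℕ N ^ 2      ∎
      rhs : fromℕ (64 ℕ.* cube (suc k) ℕ.* (N ℕ.* N)) ≡ fromℕ 64 * fromℕ (suc k) ^ 3 * fromℕ N ^ 2
      rhs = trans (fromℕ-* (64 ℕ.* cube (suc k)) (N ℕ.* N)) (cong₂ _*_
        (trans (fromℕ-* 64 (cube (suc k))) (cong (fromℕ 64 *_) (fromℕ-cube (suc k)))) (fromℕ-square N))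

    f-lower : p < 1ℚ → inv x ^ 2 < p ^ 3 → ∀ k → f[_,_]≡_ n p k →
      (1ℚ - p) ^ 2 * x ^ 2 ≤ fromℕ 64 * fromℕ (suc k) ^ 3
    f-lower p<1 large k ((G , eq , fG) , _) = uncleared-≤ k (ℕ.<⇒≤ (M<N p<1))
      (subst (λ m → (N ℕ.∸ m) ℕ.* (N ℕ.∸ m) ℕ.* (n ℕ.* n) ℕ.≤ 64 ℕ.* cube (suc k) ℕ.* (N ℕ.* N)) E≡M
        (f-bound G k fG (subst (ℕ._< N) (sym E≡M) (M<N p<1))
          (subst (λ m → cube N ℕ.< cube m ℕ.* (n ℕ.* n)) (sym E≡M) (cleared-< large))))
      where
      E≡M : ∣E∣ G ≡ M
      E≡M = fromℕ-injective {∣E∣ G} {M} (trans eq p≡)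

    f-defined : p ≤ 1ℚ → ∃ (f[_,_]≡_ n p)
    f-defined p≤1 = let G , E≡M = graph-with n M (M≤N p≤1) in fₙ-exists p M p≡ G E≡M

  -- The factor 1/4 is the cube root of 1/64. Only lower approximations `a` and `b` to the cube
  -- roots of `q` and `y` occur, so their cubes can be bounded directly.
  roots-≤ : ∀ {q y z} a b → 0ℚ ≤ a → 0ℚ ≤ b → 0ℚ ≤ z → a ^ 3 ≤ q → b ^ 3 ≤ y →
    q * y ≤ fromℕ 64 * z ^ 3 → (+ 1 / 4) * a * b ≤ z
  roots-≤ {q} {y} {z} a b 0≤a 0≤b 0≤z a³≤q b³≤y le = ^-cancel-≤ 2 0≤z (begin
    ((+ 1 / 4) * a * b) ^ 3
      ≡⟨ solve 2 (λ a b → (con (+ 1 / 4) :* a :* b) :* ((con (+ 1 / 4) :* a :* b) :* ((con (+ 1 / 4) :* a :* b) :* con 1ℚ))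
           := con 1/64 :* ((a :* (a :* (a :* con 1ℚ))) :* (b :* (b :* (b :* con 1ℚ))))) refl a b ⟩
    1/64 * (a ^ 3 * b ^ 3)
      ≤⟨ ℚ.*-monoˡ-≤-nonNeg 1/64 (*-mono-≤ (^-nonNeg 3 0≤a) (ℚ.≤-trans (^-nonNeg 3 0≤b) b³≤y) a³≤q b³≤y) ⟩
    1/64 * (q * y)
      ≤⟨ ℚ.*-monoˡ-≤-nonNeg 1/64 le ⟩
    1/64 * (fromℕ 64 * z ^ 3)
      ≡⟨ ℚ.*-assoc 1/64 (fromℕ 64) (z ^ 3) ⟨
    1ℚ * z ^ 3
      ≡⟨ ℚ.*-identityˡ (z ^ 3) ⟩
    z ^ 3 ∎)
    where
    open ℚ.≤-Reasoning
    1/64 = + 1 / 64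

  isRoots-≤ : ∀ {q y A B z} → IsRoot 3 q A → IsRoot 3 y B → 0ℚ ≤ z → q * y ≤ fromℕ 64 * z ^ 3 →
    ∀ i → (+ 1 / 4) * seq A i * seq B i ≤ z
  isRoots-≤ {A = A} {B} isA isB 0≤z le i =
    roots-≤ (seq A i) (seq B i) (P.0≤ρ i) (Q.0≤ρ i) 0≤z (P.below i) (Q.below i) le
    where
    module P = IsRoot isA
    module Q = IsRoot isB

  <ᴿ-1-⇒<1 : ∀ p (ρ : ℝ) → (∀ i → 0ℚ ≤ seq ρ i) → fromℚ p <ᴿ fromℚ 1ℚ -ᴿ ρ → p < 1ℚ
  <ᴿ-1-⇒<1 p ρ 0≤ρ (ε , 0<ε , K , small) =
    ℚ.<-≤-trans (subst (_< p + ε) (ℚ.+-identityʳ p) (ℚ.+-monoʳ-< p 0<ε))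
      (ℚ.≤-trans (small K ℕ.≤-refl) (subst (1ℚ - seq ρ K ≤_) (ℚ.+-identityʳ 1ℚ)
        (ℚ.+-monoʳ-≤ 1ℚ (ℚ.neg-antimono-≤ (0≤ρ K)))))

  *ᴿ-1-≤ᴿ : ∀ c (A B : ℝ) k → (∀ i → c * seq A i * seq B i ≤ fromℕ (suc k)) →
    fromℚ c *ᴿ A *ᴿ B -ᴿ fromℚ 1ℚ ≤ᴿ fromℚ (fromℕ k)
  *ᴿ-1-≤ᴿ c A B k bound ε 0<ε = 0 , λ i _ →
    ℚ.≤-trans (ℚ.≤-trans (ℚ.+-monoˡ-≤ (- 1ℚ) (bound i)) (ℚ.≤-reflexive shift))
      (subst (_≤ fromℕ k + ε) (ℚ.+-identityʳ (fromℕ k)) (ℚ.+-monoʳ-≤ (fromℕ k) (ℚ.<⇒≤ 0<ε)))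
    where
    shift : fromℕ (suc k) - 1ℚ ≡ fromℕ k
    shift = trans (cong (_- 1ℚ) (fromℕ-+ 1 k)) (solve 1 (λ y → (con 1ℚ :+ y) :- con 1ℚ := y) refl (fromℕ k))

  lower-bound : (n : ℕ) .{{_ : NonTrivial n}} (p : ℚ) →
    (∃[ m ] p * fromℕ (n C 2) ≡ fromℕ m) →
    fromℕ n ^ᴿ (-[1+ 1 ] / 3) <ᴿ fromℚ p →
    fromℚ p <ᴿ fromℚ 1ℚ -ᴿ fromℕ n ^ᴿ (-[1+ 0 ] / 7) →
    ∃ λ k → (f[_,_]≡_ n p k) ×
      (fromℚ (+ 1 / 4) *ᴿ (1ℚ - p) ^ᴿ (+ 2 / 3) *ᴿ fromℕ n ^ᴿ (+ 2 / 3) -ᴿ fromℚ 1ℚ ≤ᴿ fromℚ (fromℕ k))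
  lower-bound n p (M , p≡) p-large p-small = conclude (f-defined n p M p≡ (ℚ.<⇒≤ p<1))
    where
    0≤n : 0ℚ ≤ fromℕ n
    0≤n = fromℕ-mono-≤ {0} {n} ℕ.z≤n
    0≤inv : 0ℚ ≤ inv (fromℕ n)
    0≤inv = inv-nonNeg 0≤n
    isRoot₇ : IsRoot 7 (inv (fromℕ n) ^ 1) (fromℕ n ^ᴿ (-[1+ 0 ] / 7))
    isRoot₇ = ^ᴿ-isRoot (fromℕ n) (-[1+ 0 ] / 7) (^-nonNeg 1 0≤inv)
    module S = IsRoot isRoot₇
    p<1 : p < 1ℚ
    p<1 = <ᴿ-1-⇒<1 p (fromℕ n ^ᴿ (-[1+ 0 ] / 7)) S.0≤ρ p-small
    0≤1-p : 0ℚ ≤ 1ℚ - p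
    0≤1-p = subst (_≤ 1ℚ - p) (ℚ.+-inverseʳ p) (ℚ.+-monoˡ-≤ (- p) (ℚ.<⇒≤ p<1))
    isP : IsRoot 3 ((1ℚ - p) ^ 2) ((1ℚ - p) ^ᴿ (+ 2 / 3))
    isP = ^ᴿ-isRoot (1ℚ - p) (+ 2 / 3) (^-nonNeg 2 0≤1-p)
    isQ : IsRoot 3 (fromℕ n ^ 2) (fromℕ n ^ᴿ (+ 2 / 3))
    isQ = ^ᴿ-isRoot (fromℕ n) (+ 2 / 3) (^-nonNeg 2 0≤n)
    p³ : inv (fromℕ n) ^ 2 < p ^ 3
    p³ = root-<ᴿ p (^ᴿ-isRoot (fromℕ n) (-[1+ 1 ] / 3) (^-nonNeg 2 0≤inv)) p-large
    conclude : ∃ (f[_,_]≡_ n p) → _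
    conclude (k , fk) = k , fk , *ᴿ-1-≤ᴿ (+ 1 / 4) ((1ℚ - p) ^ᴿ (+ 2 / 3)) (fromℕ n ^ᴿ (+ 2 / 3)) k
      (isRoots-≤ {A = (1ℚ - p) ^ᴿ (+ 2 / 3)} {fromℕ n ^ᴿ (+ 2 / 3)} isP isQ (fromℕ-mono-≤ {0} {suc k} ℕ.z≤n)
        (f-lower n p M p≡ p<1 p³ k fk))

  -- The excess of p over r/(r+1) at scale n^(-2/3)

  p≤∣p∣ : ∀ p → p ≤ ℚ.∣ p ∣
  p≤∣p∣ p with ℚ.≤-total 0ℚ p
  ... | inj₁ 0≤p = ℚ.≤-reflexive (sym (ℚ.0≤p⇒∣p∣≡p 0≤p))
  ... | inj₂ p≤0 = ℚ.≤-trans p≤0 (ℚ.0≤∣p∣ p)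

  ^-distrib-* : ∀ a b k → (a * b) ^ k ≡ a ^ k * b ^ k
  ^-distrib-* a b zero    = refl
  ^-distrib-* a b (suc k) rewrite ^-distrib-* a b k =
    solve 4 (λ a b x y → (a :* b) :* (x :* y) := (a :* x) :* (b :* y)) refl a b (a ^ k) (b ^ k)

  two : ℚ
  two = fromℕ 2

  -- With c >= 3/4 and ε <= ρ/6, 2 (c ρ - ε) is at least 3ρ/2 - 2ε, hence at least ρ + ε. The slack
  -- 1/4 in `c` is the accuracy at which c >= 1 is read off from the approximations.
  approx-lower : ∀ {c ρ ε η d} → 0ℚ ≤ ρ → 1ℚ ≤ c + + 1 / 4 → fromℕ 6 * ε ≤ ρ → η ≤ ε →
    c * ρ - ε ≤ d → ρ + η ≤ two * d
  approx-lower {c} {ρ} {ε} {η} {d} 0≤ρ 1≤c 6ε≤ρ η≤ε le = begin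
    ρ + η                                  ≤⟨ ℚ.+-monoʳ-≤ ρ η≤ε ⟩
    ρ + ε
      ≡⟨ solve 2 (λ ρ ε → ρ :+ ε := ρ :+ con ½ :* (con (fromℕ 6) :* ε) :- con two :* ε) refl ρ ε ⟩
    ρ + ½ * (fromℕ 6 * ε) - two * ε
      ≤⟨ ℚ.+-monoˡ-≤ (- (two * ε)) (ℚ.+-monoʳ-≤ ρ (ℚ.*-monoˡ-≤-nonNeg ½ 6ε≤ρ)) ⟩
    ρ + ½ * ρ - two * ε
      ≡⟨ solve 2 (λ ρ ε → ρ :+ con ½ :* ρ :- con two :* ε := con two :* (con 1ℚ :* ρ :- con (+ 1 / 4) :* ρ :- ε)) refl ρ ε ⟩
    two * (1ℚ * ρ - + 1 / 4 * ρ - ε)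
      ≤⟨ ℚ.*-monoˡ-≤-nonNeg two (ℚ.+-monoˡ-≤ (- ε) (ℚ.+-monoˡ-≤ (- (+ 1 / 4 * ρ)) (ℚ.*-monoʳ-≤-nonNeg ρ {{ℚ.nonNegative 0≤ρ}} 1≤c))) ⟩
    two * ((c + + 1 / 4) * ρ - + 1 / 4 * ρ - ε)
      ≡⟨ solve 3 (λ c ρ ε → con two :* ((c :+ con (+ 1 / 4)) :* ρ :- con (+ 1 / 4) :* ρ :- ε) := con two :* (c :* ρ :- ε)) refl c ρ ε ⟩
    two * (c * ρ - ε)                      ≤⟨ ℚ.*-monoˡ-≤-nonNeg two le ⟩
    two * d                                ∎
    where open ℚ.≤-Reasoning

  approx-upper : ∀ {c ρ ε B d} → 0ℚ ≤ ρ → c ≤ B → ε ≤ ρ → d ≤ c * ρ + ε → d ≤ (B + 1ℚ) * ρ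
  approx-upper {c} {ρ} {ε} {B} {d} 0≤ρ c≤B ε≤ρ le = begin
    d              ≤⟨ le ⟩
    c * ρ + ε      ≤⟨ ℚ.+-mono-≤ (ℚ.*-monoʳ-≤-nonNeg ρ {{ℚ.nonNegative 0≤ρ}} c≤B) ε≤ρ ⟩
    B * ρ + ρ      ≡⟨ solve 2 (λ B ρ → B :* ρ :+ ρ := (B :+ con 1ℚ) :* ρ) refl B ρ ⟩
    (B + 1ℚ) * ρ   ∎
    where open ℚ.≤-Reasoning

  module _ {y B : ℚ} (c ρ : ℝ) (p s : ℚ) (0<y : 0ℚ < y) (y≤1 : y ≤ 1ℚ) (isRoot : IsRoot 3 (y ^ 2) ρ)
    (1≤c : fromℚ 1ℚ ≤ᴿ c) (0<B : 0ℚ < B) (K₃ : ℕ) (c<B : ∀ i → K₃ ℕ.≤ i → ℚ.∣ seq c i ∣ < B)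
    (p≈ : fromℚ p ≈ᴿ fromℚ s +ᴿ c *ᴿ ρ) where

    private
      open IsRoot isRoot
      -- The accuracy has to be a rational at most a sixth of the root. As y <= 1, `y` is below
      -- y^(2/3); of the seven ε in `y`, one covers the distance 1/(i+1) between approximation and
      -- root and six remain.
      ε = + 1 / 7 * y
      0<ε : 0ℚ < ε
      0<ε = *-pos {+ 1 / 7} (ℚ.positive⁻¹ (+ 1 / 7)) 0<y

    -- For δ = p - s this is y^(2/3)/2 < δ <= (B + 1) y^(2/3) in cubed form. Everything is read off
    -- at one index, large enough for c >= 1, for the closeness of `p`, for the bound on `c` and for
    -- 1/(i+1) <= ε.
    excess-bounds : y ^ 2 < (two * (p - s)) ^ 3 × (p - s) ^ 3 ≤ (B + 1ℚ) ^ 3 * y ^ 2 × 0ℚ ≤ p - s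
    excess-bounds with 1≤c (+ 1 / 4) (ℚ.positive⁻¹ (+ 1 / 4)) | p≈ ε 0<ε
    ... | K₁ , large | K₂ , close = lower , upper , 0≤δ
      where
      δ = p - s
      i = (K₁ ℕ.⊔ K₂) ℕ.⊔ (K₃ ℕ.⊔ ↧ₙ ε)
      K₁≤i : K₁ ℕ.≤ i
      K₁≤i = ℕ.≤-trans (ℕ.m≤m⊔n K₁ K₂) (ℕ.m≤m⊔n (K₁ ℕ.⊔ K₂) _)
      K₂≤i : K₂ ℕ.≤ i
      K₂≤i = ℕ.≤-trans (ℕ.m≤n⊔m K₁ K₂) (ℕ.m≤m⊔n (K₁ ℕ.⊔ K₂) _)
      K₃≤i : K₃ ℕ.≤ i
      K₃≤i = ℕ.≤-trans (ℕ.m≤m⊔n K₃ (↧ₙ ε)) (ℕ.m≤n⊔m (K₁ ℕ.⊔ K₂) _)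
      η = + 1 / suc i
      η≤ε : η ≤ ε
      η≤ε = ℚ.<⇒≤ (archimedean 0<ε i (ℕ.≤-trans (ℕ.m≤n⊔m K₃ (↧ₙ ε)) (ℕ.m≤n⊔m (K₁ ℕ.⊔ K₂) _)))
      x = seq ρ i
      cᵢ = seq c i
      0≤x : 0ℚ ≤ x
      0≤x = 0≤ρ i
      0≤y : 0ℚ ≤ y
      0≤y = ℚ.<⇒≤ 0<y
      y≤x+η : y ≤ x + η
      y≤x+η = ^-cancel-≤ 2 (ℚ.+-mono-≤ 0≤x (0≤/ 1 i)) (ℚ.≤-trans
        (subst (y ^ 3 ≤_) (ℚ.*-identityˡ (y ^ 2)) (ℚ.*-monoʳ-≤-nonNeg (y ^ 2) {{ℚ.nonNegative (^-nonNeg 2 0≤y)}} y≤1))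
        (ℚ.<⇒≤ (above i)))
      6ε≤x : fromℕ 6 * ε ≤ x
      6ε≤x = begin
        fromℕ 6 * (+ 1 / 7 * y)
          ≡⟨ solve 1 (λ y → con (fromℕ 6) :* (con (+ 1 / 7) :* y) := y :- con (+ 1 / 7) :* y) refl y ⟩
        y - ε            ≤⟨ ℚ.+-mono-≤ y≤x+η (ℚ.neg-antimono-≤ η≤ε) ⟩
        x + η - η        ≡⟨ solve 2 (λ x η → x :+ η :- η := x) refl x η ⟩
        x                ∎
        where open ℚ.≤-Reasoning
      ε≤x : ε ≤ x
      ε≤x = ℚ.≤-trans (subst (_≤ fromℕ 6 * ε) (ℚ.*-identityˡ ε)
        (ℚ.*-monoʳ-≤-nonNeg ε {{ℚ.nonNegative (ℚ.<⇒≤ 0<ε)}} (fromℕ-mono-≤ {1} {6} (ℕ.s≤s ℕ.z≤n)))) 6ε≤x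
      near : ℚ.∣ p - (s + cᵢ * x) ∣ ≤ ε
      near = ℚ.<⇒≤ (close i K₂≤i)
      δ≤ : δ ≤ cᵢ * x + ε
      δ≤ = begin
        δ
          ≡⟨ solve 3 (λ p s z → p :- s := z :+ (p :- (s :+ z))) refl p s (cᵢ * x) ⟩
        cᵢ * x + (p - (s + cᵢ * x))
          ≤⟨ ℚ.+-monoʳ-≤ (cᵢ * x) (ℚ.≤-trans (p≤∣p∣ (p - (s + cᵢ * x))) near) ⟩
        cᵢ * x + ε                         ∎
        where open ℚ.≤-Reasoning
      δ≥ : cᵢ * x - ε ≤ δ
      δ≥ = begin
        cᵢ * x - ε                         ≤⟨ ℚ.+-monoʳ-≤ (cᵢ * x) (ℚ.neg-antimono-≤ (ℚ.≤-trans
                                                (subst (- w ≤_) (ℚ.∣-p∣≡∣p∣ w) (p≤∣p∣ (- w))) near)) ⟩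
        cᵢ * x - (- w)
          ≡⟨ solve 3 (λ p s z → z :- (:- (p :- (s :+ z))) := p :- s) refl p s (cᵢ * x) ⟩
        δ                                  ∎
        where
        open ℚ.≤-Reasoning
        w = p - (s + cᵢ * x)
      twice : x + η ≤ two * δ
      twice = approx-lower {c = cᵢ} 0≤x (large i K₁≤i) 6ε≤x η≤ε δ≥
      lower : y ^ 2 < (two * δ) ^ 3
      lower = ℚ.<-≤-trans (above i) (^-mono 3 (ℚ.+-mono-≤ 0≤x (0≤/ 1 i)) twice)
      0≤δ : 0ℚ ≤ δ
      0≤δ = ℚ.*-cancelˡ-≤-pos two (ℚ.≤-trans (ℚ.+-mono-≤ 0≤x (0≤/ 1 i)) twice)
      0≤B+1 : 0ℚ ≤ B + 1ℚ
      0≤B+1 = ℚ.+-mono-≤ (ℚ.<⇒≤ 0<B) 0≤1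
      upper : δ ^ 3 ≤ (B + 1ℚ) ^ 3 * y ^ 2
      upper = begin
        δ ^ 3
          ≤⟨ ^-mono 3 0≤δ (approx-upper 0≤x (ℚ.≤-trans (p≤∣p∣ cᵢ) (ℚ.<⇒≤ (c<B i K₃≤i))) ε≤x δ≤) ⟩
        ((B + 1ℚ) * x) ^ 3          ≡⟨ ^-distrib-* (B + 1ℚ) x 3 ⟩
        (B + 1ℚ) ^ 3 * x ^ 3
          ≤⟨ ℚ.*-monoˡ-≤-nonNeg ((B + 1ℚ) ^ 3) {{ℚ.nonNegative (^-nonNeg 3 0≤B+1)}} (below i) ⟩
        (B + 1ℚ) ^ 3 * y ^ 2        ∎
        where open ℚ.≤-Reasoning

  -- From n <= 2 (n - 1) the left side is at most 256 (n - 1)². It serves `rn≤E`, where δ >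
  -- n^(-2/3)/2 has to give δ (n - 1) >= 2.
  64n²≤ : ∀ n → 512 ℕ.≤ n → 64 ℕ.* (n ℕ.* n) ℕ.≤ cube (n ℕ.∸ 1)
  64n²≤ (suc m) (ℕ.s≤s 511≤m) = begin
    64 ℕ.* (suc m ℕ.* suc m)                    ≤⟨ ℕ.*-monoʳ-≤ 64 (ℕ.*-mono-≤ 1+m≤2m 1+m≤2m) ⟩
    64 ℕ.* (2 ℕ.* m ℕ.* (2 ℕ.* m))              ≡⟨ ring m ⟩
    256 ℕ.* (m ℕ.* m)
      ≤⟨ ℕ.*-monoˡ-≤ (m ℕ.* m) (ℕ.≤-trans (ℕ.m≤m+n 256 255) 511≤m) ⟩
    cube m                                      ∎
    where
    open ℕ.≤-Reasoning
    1+m≤2m : suc m ℕ.≤ 2 ℕ.* m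
    1+m≤2m = ℕ.≤-trans (ℕ.+-monoˡ-≤ m (ℕ.≤-trans (ℕ.s≤s ℕ.z≤n) 511≤m)) (ℕ.≤-reflexive (cong (m ℕ.+_) (sym (ℕ.+-identityʳ m))))
    ring : ∀ m → 64 ℕ.* (2 ℕ.* m ℕ.* (2 ℕ.* m)) ≡ 256 ℕ.* (m ℕ.* m)
    ring = ℕ.solve-∀

  -- The upper bound: sizes in the extremal construction

  module _ (r n : ℕ) .{{_ : NonTrivial n}} (p : ℚ) (M D : ℕ) (p≡ : p * fromℕ (n C 2) ≡ fromℕ M)
    (0≤δ : 0ℚ ≤ p - + r / suc r)
    (δ-large : inv (fromℕ n) ^ 2 < (two * (p - + r / suc r)) ^ 3)
    (δ-small : (p - + r / suc r) ^ 3 ≤ fromℕ D ^ 3 * inv (fromℕ n) ^ 2)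
    where

    private
      R = suc r
      N = n C 2
      x = fromℕ n
      s = + r / R
      δ = p - s

      0<x : 0ℚ < x
      0<x = fromℕ-mono-< {0} {n} (ℕ.<-trans (ℕ.s≤s ℕ.z≤n) (ℕ.nonTrivial⇒n>1 n))
      0<x² : 0ℚ < x ^ 2
      0<x² = ^-pos 2 0<x
      0<N : 0ℚ < fromℕ N
      0<N = fromℕ-mono-< {0} {N} (ℕ.>-nonZero⁻¹ N {{nC2≢0 n}})
      0<R : 0ℚ < fromℕ R
      0<R = fromℕ-mono-< {0} {R} (ℕ.s≤s ℕ.z≤n)

      y²x²≡1 : inv x ^ 2 * x ^ 2 ≡ 1ℚ
      y²x²≡1 = trans (sym (^-distrib-* (inv x) x 2)) (cong (_^ 2) (inv-inverse 0<x))

      -- `α` and `β` are the two bounds on δ multiplied by n², which frees them from `inv`.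
      α : 1ℚ < (two * δ) ^ 3 * x ^ 2
      α = subst (_< (two * δ) ^ 3 * x ^ 2) y²x²≡1 (ℚ.*-monoˡ-<-pos (x ^ 2) {{ℚ.positive 0<x²}} δ-large)

      β : δ ^ 3 * x ^ 2 ≤ fromℕ D ^ 3
      β = subst (δ ^ 3 * x ^ 2 ≤_)
        (trans (ℚ.*-assoc (fromℕ D ^ 3) (inv x ^ 2) (x ^ 2))
          (trans (cong (fromℕ D ^ 3 *_) y²x²≡1) (ℚ.*-identityʳ (fromℕ D ^ 3))))
        (ℚ.*-monoʳ-≤-nonNeg (x ^ 2) {{ℚ.nonNegative (ℚ.<⇒≤ 0<x²)}} δ-small)

      sR≡r : s * fromℕ R ≡ fromℕ r
      sR≡r = /-cancel r R

      -- Equal to R δ N; `rN≤RM` shows that the truncated subtraction is exact.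
      E : ℕ
      E = R ℕ.* M ℕ.∸ r ℕ.* N

      rN≤RM : r ℕ.* N ℕ.≤ R ℕ.* M
      rN≤RM = fromℕ-cancel-≤ (begin
        fromℕ (r ℕ.* N)                ≡⟨ fromℕ-* r N ⟩
        fromℕ r * fromℕ N              ≡⟨ cong (_* fromℕ N) sR≡r ⟨
        s * fromℕ R * fromℕ N
          ≤⟨ ℚ.*-monoʳ-≤-nonNeg (fromℕ N) {{fromℕ-nonNeg N}} (ℚ.*-monoʳ-≤-nonNeg (fromℕ R) {{fromℕ-nonNeg R}} s≤p) ⟩
        p * fromℕ R * fromℕ N
          ≡⟨ solve 3 (λ p R N → p :* R :* N := R :* (p :* N)) refl p (fromℕ R) (fromℕ N) ⟩
        fromℕ R * (p * fromℕ N)        ≡⟨ cong (fromℕ R *_) p≡ ⟩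
        fromℕ R * fromℕ M              ≡⟨ fromℕ-* R M ⟨
        fromℕ (R ℕ.* M)                ∎)
        where
        open ℚ.≤-Reasoning
        s≤p : s ≤ p
        s≤p = subst₂ _≤_ (ℚ.+-identityʳ s) (solve 2 (λ s p → s :+ (p :- s) := p) refl s p) (ℚ.+-monoʳ-≤ s 0≤δ)

      E≡ : fromℕ E ≡ fromℕ R * δ * fromℕ N
      E≡ = begin
        fromℕ E                                      ≡⟨ fromℕ-∸ rN≤RM ⟩
        fromℕ (R ℕ.* M) - fromℕ (r ℕ.* N)            ≡⟨ cong₂ _-_ (fromℕ-* R M) (fromℕ-* r N) ⟩
        fromℕ R * fromℕ M - fromℕ r * fromℕ N
          ≡⟨ cong₂ (λ a b → fromℕ R * a - b * fromℕ N) p≡ sR≡r ⟨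
        fromℕ R * (p * fromℕ N) - s * fromℕ R * fromℕ N
          ≡⟨ solve 4 (λ R p N s → R :* (p :* N) :- s :* R :* N := R :* (p :- s) :* N) refl (fromℕ R) p (fromℕ N) s ⟩
        fromℕ R * δ * fromℕ N                        ∎
        where open ≡-Reasoning

      2E≡ : fromℕ (2 ℕ.* E) ≡ fromℕ R * (δ * (x * fromℕ (n ℕ.∸ 1)))
      2E≡ = begin
        fromℕ (2 ℕ.* E)                      ≡⟨ fromℕ-* 2 E ⟩
        two * fromℕ E                        ≡⟨ cong (two *_) E≡ ⟩
        two * (fromℕ R * δ * fromℕ N)
          ≡⟨ solve 4 (λ t R d N → t :* (R :* d :* N) := R :* (d :* (t :* N))) refl two (fromℕ R) δ (fromℕ N) ⟩
        fromℕ R * (δ * (two * fromℕ N))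
          ≡⟨ cong (λ z → fromℕ R * (δ * z)) (trans (sym (fromℕ-* 2 N)) (trans (cong fromℕ (2*nC2 n)) (fromℕ-* n (n ℕ.∸ 1)))) ⟩
        fromℕ R * (δ * (x * fromℕ (n ℕ.∸ 1))) ∎
        where open ≡-Reasoning

      rn≤E : 512 ℕ.≤ n → r ℕ.* n ℕ.≤ E
      rn≤E 512≤n = ℕ.*-cancelˡ-≤ 2 (fromℕ-cancel-≤ (begin
        fromℕ (2 ℕ.* (r ℕ.* n))
          ≤⟨ fromℕ-mono-≤ (ℕ.*-monoʳ-≤ 2 (ℕ.*-monoˡ-≤ n (ℕ.n≤1+n r))) ⟩
        fromℕ (2 ℕ.* (R ℕ.* n))
          ≡⟨ trans (fromℕ-* 2 (R ℕ.* n)) (cong (two *_) (fromℕ-* R n)) ⟩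
        two * (fromℕ R * x)
          ≤⟨ ℚ.*-monoʳ-≤-nonNeg (fromℕ R * x) {{ℚ.nonNegative (*-nonNeg (ℚ.<⇒≤ 0<R) (ℚ.<⇒≤ 0<x))}} 2≤δt ⟩
        δ * t * (fromℕ R * x)
          ≡⟨ solve 4 (λ d t R x → d :* t :* (R :* x) := R :* (d :* (x :* t))) refl δ t (fromℕ R) x ⟩
        fromℕ R * (δ * (x * t))              ≡⟨ 2E≡ ⟨
        fromℕ (2 ℕ.* E)                      ∎))
        where
        open ℚ.≤-Reasoning
        t = fromℕ (n ℕ.∸ 1)
        0≤t : 0ℚ ≤ t
        0≤t = fromℕ-mono-≤ {0} {n ℕ.∸ 1} ℕ.z≤n
        2≤δt : two ≤ δ * t
        2≤δt = ^-cancel-≤ 2 (*-nonNeg 0≤δ 0≤t) (ℚ.*-cancelʳ-≤-pos (fromℕ 8 * x ^ 2)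
          {{ℚ.positive (*-pos {fromℕ 8} (ℚ.positive⁻¹ (fromℕ 8)) 0<x²)}} (begin
          two ^ 3 * (fromℕ 8 * x ^ 2)            ≡⟨ ℚ.*-assoc (two ^ 3) (fromℕ 8) (x ^ 2) ⟨
          fromℕ 64 * x ^ 2
            ≡⟨ trans (fromℕ-* 64 (n ℕ.* n)) (cong (fromℕ 64 *_) (fromℕ-square n)) ⟨
          fromℕ (64 ℕ.* (n ℕ.* n))               ≤⟨ fromℕ-mono-≤ (64n²≤ n 512≤n) ⟩
          fromℕ (cube (n ℕ.∸ 1))                 ≡⟨ fromℕ-cube (n ℕ.∸ 1) ⟩
          t ^ 3                                  ≡⟨ ℚ.*-identityˡ (t ^ 3) ⟨
          1ℚ * t ^ 3
            ≤⟨ ℚ.*-monoʳ-≤-nonNeg (t ^ 3) {{ℚ.nonNegative (^-nonNeg 3 0≤t)}} (ℚ.<⇒≤ α) ⟩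
          (two * δ) ^ 3 * x ^ 2 * t ^ 3
            ≡⟨ cong (λ z → z * x ^ 2 * t ^ 3) (^-distrib-* two δ 3) ⟩
          fromℕ 8 * δ ^ 3 * x ^ 2 * t ^ 3
            ≡⟨ solve 4 (λ e d x t → e :* d :* x :* t := d :* t :* (e :* x)) refl (fromℕ 8) (δ ^ 3) (x ^ 2) (t ^ 3) ⟩
          δ ^ 3 * t ^ 3 * (fromℕ 8 * x ^ 2)
            ≡⟨ cong (_* (fromℕ 8 * x ^ 2)) (^-distrib-* δ t 3) ⟨
          (δ * t) ^ 3 * (fromℕ 8 * x ^ 2)        ∎))

      -- 2 E is at most R δ n², and δ n² <= D n^(4/3) <= D w²; the last chain is verified after
      -- cubing.
      2E≤ : ∀ w → n ℕ.* n ℕ.≤ cube w → 2 ℕ.* E ℕ.≤ R ℕ.* (D ℕ.* (w ℕ.* w))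
      2E≤ w n²≤w³ = fromℕ-cancel-≤ (begin
        fromℕ (2 ℕ.* E)                        ≡⟨ 2E≡ ⟩
        fromℕ R * (δ * (x * fromℕ (n ℕ.∸ 1)))
          ≤⟨ ℚ.*-monoˡ-≤-nonNeg (fromℕ R) {{fromℕ-nonNeg R}} (ℚ.*-monoˡ-≤-nonNeg δ {{ℚ.nonNegative 0≤δ}}
               (ℚ.*-monoˡ-≤-nonNeg x {{fromℕ-nonNeg n}} (fromℕ-mono-≤ (ℕ.m∸n≤m n 1)))) ⟩
        fromℕ R * (δ * (x * x))
          ≤⟨ ℚ.*-monoˡ-≤-nonNeg (fromℕ R) {{fromℕ-nonNeg R}} δx²≤ ⟩
        fromℕ R * (fromℕ D * (v * v))
          ≡⟨ cong (λ z → fromℕ R * (fromℕ D * z)) (fromℕ-* w w) ⟨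
        fromℕ R * (fromℕ D * fromℕ (w ℕ.* w))  ≡⟨ cong (fromℕ R *_) (fromℕ-* D (w ℕ.* w)) ⟨
        fromℕ R * fromℕ (D ℕ.* (w ℕ.* w))      ≡⟨ fromℕ-* R (D ℕ.* (w ℕ.* w)) ⟨
        fromℕ (R ℕ.* (D ℕ.* (w ℕ.* w)))        ∎)
        where
        open ℚ.≤-Reasoning
        v = fromℕ w
        0≤v : 0ℚ ≤ v
        0≤v = fromℕ-mono-≤ {0} {w} ℕ.z≤n
        0≤D : 0ℚ ≤ fromℕ D
        0≤D = fromℕ-mono-≤ {0} {D} ℕ.z≤n
        x²≤v³ : x ^ 2 ≤ v ^ 3
        x²≤v³ = subst₂ _≤_ (fromℕ-square n) (fromℕ-cube w) (fromℕ-mono-≤ n²≤w³)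
        δx²≤ : δ * (x * x) ≤ fromℕ D * (v * v)
        δx²≤ = ^-cancel-≤ 2 (*-nonNeg 0≤D (*-nonNeg 0≤v 0≤v)) (begin
          (δ * (x * x)) ^ 3
            ≡⟨ solve 2 (λ d x → d :* (x :* x) :* (d :* (x :* x) :* (d :* (x :* x) :* con 1ℚ)) :=
                 d :* (d :* (d :* con 1ℚ)) :* (x :* (x :* con 1ℚ)) :* ((x :* (x :* con 1ℚ)) :* (x :* (x :* con 1ℚ)))) refl δ x ⟩
          δ ^ 3 * x ^ 2 * (x ^ 2 * x ^ 2)
            ≤⟨ *-mono-≤ (*-nonNeg (^-nonNeg 3 0≤δ) (ℚ.<⇒≤ 0<x²)) (*-nonNeg (^-nonNeg 3 0≤v) (^-nonNeg 3 0≤v)) β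
                 (*-mono-≤ (ℚ.<⇒≤ 0<x²) (^-nonNeg 3 0≤v) x²≤v³ x²≤v³) ⟩
          fromℕ D ^ 3 * (v ^ 3 * v ^ 3)
            ≡⟨ solve 2 (λ d x → d :* (d :* (d :* con 1ℚ)) :* ((x :* (x :* (x :* con 1ℚ))) :* (x :* (x :* (x :* con 1ℚ)))) :=
                 d :* (x :* x) :* (d :* (x :* x) :* (d :* (x :* x) :* con 1ℚ))) refl (fromℕ D) v ⟩
          (fromℕ D * (v * v)) ^ 3 ∎)

      -- Dividing the hypothesis on `j` by R N gives δ j <= 1, while 2 δ > n^(-2/3) >= 1/w.
      few : ∀ w j → n ℕ.* n ℕ.≤ cube w → E ℕ.* j ℕ.≤ r ℕ.* N → j ℕ.≤ 2 ℕ.* w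
      few w j n²≤w³ Ej≤rN = fromℕ-cancel-≤ (^-cancel-≤ 2 (fromℕ-mono-≤ {0} {2 ℕ.* w} ℕ.z≤n) (begin
        t ^ 3                                ≡⟨ ℚ.*-identityˡ (t ^ 3) ⟨
        1ℚ * t ^ 3
          ≤⟨ ℚ.*-monoʳ-≤-nonNeg (t ^ 3) {{ℚ.nonNegative (^-nonNeg 3 0≤t)}} (ℚ.<⇒≤ α) ⟩
        (two * δ) ^ 3 * x ^ 2 * t ^ 3
          ≡⟨ cong (λ z → z * x ^ 2 * t ^ 3) (^-distrib-* two δ 3) ⟩
        fromℕ 8 * δ ^ 3 * x ^ 2 * t ^ 3
          ≡⟨ solve 4 (λ e d x t → e :* d :* x :* t := d :* t :* (e :* x)) refl (fromℕ 8) (δ ^ 3) (x ^ 2) (t ^ 3) ⟩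
        δ ^ 3 * t ^ 3 * (fromℕ 8 * x ^ 2)    ≡⟨ cong (_* (fromℕ 8 * x ^ 2)) (^-distrib-* δ t 3) ⟨
        (δ * t) ^ 3 * (fromℕ 8 * x ^ 2)
          ≤⟨ ℚ.*-monoʳ-≤-nonNeg (fromℕ 8 * x ^ 2) {{ℚ.nonNegative (*-nonNeg {fromℕ 8} (fromℕ-mono-≤ {0} {8} ℕ.z≤n) (ℚ.<⇒≤ 0<x²))}}
               (^-mono 3 (*-nonNeg 0≤δ 0≤t) δt≤1) ⟩
        1ℚ ^ 3 * (fromℕ 8 * x ^ 2)           ≡⟨ ℚ.*-identityˡ (fromℕ 8 * x ^ 2) ⟩
        fromℕ 8 * x ^ 2
          ≡⟨ trans (fromℕ-* 8 (n ℕ.* n)) (cong (fromℕ 8 *_) (fromℕ-square n)) ⟨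
        fromℕ (8 ℕ.* (n ℕ.* n))              ≤⟨ fromℕ-mono-≤ (ℕ.*-monoʳ-≤ 8 n²≤w³) ⟩
        fromℕ (8 ℕ.* cube w)                 ≡⟨ cong fromℕ (ring w) ⟩
        fromℕ (cube (2 ℕ.* w))               ≡⟨ fromℕ-cube (2 ℕ.* w) ⟩
        fromℕ (2 ℕ.* w) ^ 3                  ∎))
        where
        open ℚ.≤-Reasoning
        t = fromℕ j
        0≤t : 0ℚ ≤ t
        0≤t = fromℕ-mono-≤ {0} {j} ℕ.z≤n
        ring : ∀ w → 8 ℕ.* (w ℕ.* (w ℕ.* w)) ≡ 2 ℕ.* w ℕ.* (2 ℕ.* w ℕ.* (2 ℕ.* w))
        ring = ℕ.solve-∀
        δt≤1 : δ * t ≤ 1ℚ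
        δt≤1 = ℚ.*-cancelʳ-≤-pos (fromℕ R * fromℕ N) {{ℚ.positive (*-pos 0<R 0<N)}} (begin
          δ * t * (fromℕ R * fromℕ N)
            ≡⟨ solve 4 (λ d t R N → d :* t :* (R :* N) := R :* d :* N :* t) refl δ t (fromℕ R) (fromℕ N) ⟩
          fromℕ R * δ * fromℕ N * t          ≡⟨ cong (_* t) E≡ ⟨
          fromℕ E * t                        ≡⟨ fromℕ-* E j ⟨
          fromℕ (E ℕ.* j)
            ≤⟨ fromℕ-mono-≤ (ℕ.≤-trans Ej≤rN (ℕ.*-monoˡ-≤ N (ℕ.n≤1+n r))) ⟩
          fromℕ (R ℕ.* N)                    ≡⟨ fromℕ-* R N ⟩
          fromℕ R * fromℕ N                  ≡⟨ ℚ.*-identityˡ (fromℕ R * fromℕ N) ⟨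
          1ℚ * (fromℕ R * fromℕ N)           ∎)

    -- 1 - r/R is 1/R, and for such `n` the excess δ uses up at most half of it. This keeps 1 - p
    -- bounded away from 0.
    1≤2R[1-p] : cube (2 ℕ.* R ℕ.* D) ℕ.≤ n → 1ℚ ≤ fromℕ (2 ℕ.* R) * (1ℚ - p)
    1≤2R[1-p] big = begin
      1ℚ                                 ≡⟨⟩
      two - 1ℚ                           ≤⟨ ℚ.+-monoʳ-≤ two (ℚ.neg-antimono-≤ 2Rδ≤1) ⟩
      two - fromℕ (2 ℕ.* R) * δ          ≡⟨ cong (λ z → z - fromℕ (2 ℕ.* R) * δ) two≡ ⟩
      fromℕ (2 ℕ.* R) - two * (s * fromℕ R) - fromℕ (2 ℕ.* R) * δ
        ≡⟨ cong (λ z → z - two * (s * fromℕ R) - z * δ) (fromℕ-* 2 R) ⟩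
      two * fromℕ R - two * (s * fromℕ R) - two * fromℕ R * δ
        ≡⟨ solve 4 (λ t R s p → t :* R :- t :* (s :* R) :- t :* R :* (p :- s) := t :* R :* (con 1ℚ :- p)) refl two (fromℕ R) s p ⟩
      two * fromℕ R * (1ℚ - p)           ≡⟨ cong (_* (1ℚ - p)) (fromℕ-* 2 R) ⟨
      fromℕ (2 ℕ.* R) * (1ℚ - p)         ∎
      where
      open ℚ.≤-Reasoning
      two≡ : two ≡ fromℕ (2 ℕ.* R) - two * (s * fromℕ R)
      two≡ = begin-equality
        two
          ≡⟨ solve 2 (λ t r → t := t :* (con 1ℚ :+ r) :- t :* r) refl two (fromℕ r) ⟩
        two * (1ℚ + fromℕ r) - two * fromℕ r
          ≡⟨ cong₂ (λ a b → two * a - two * b) (fromℕ-+ 1 r) sR≡r ⟨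
        two * fromℕ R - two * (s * fromℕ R)
          ≡⟨ cong (_- two * (s * fromℕ R)) (fromℕ-* 2 R) ⟨
        fromℕ (2 ℕ.* R) - two * (s * fromℕ R)        ∎
      c = fromℕ (2 ℕ.* R)
      0≤c : 0ℚ ≤ c
      0≤c = fromℕ-mono-≤ {0} {2 ℕ.* R} ℕ.z≤n
      2Rδ≤1 : c * δ ≤ 1ℚ
      2Rδ≤1 = ^-cancel-≤ 2 0≤1 (ℚ.*-cancelʳ-≤-pos (x ^ 2) {{ℚ.positive 0<x²}} (begin
        (c * δ) ^ 3 * x ^ 2            ≡⟨ cong (_* x ^ 2) (^-distrib-* c δ 3) ⟩
        c ^ 3 * δ ^ 3 * x ^ 2          ≡⟨ ℚ.*-assoc (c ^ 3) (δ ^ 3) (x ^ 2) ⟩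
        c ^ 3 * (δ ^ 3 * x ^ 2)
          ≤⟨ ℚ.*-monoˡ-≤-nonNeg (c ^ 3) {{ℚ.nonNegative (^-nonNeg 3 0≤c)}} β ⟩
        c ^ 3 * fromℕ D ^ 3            ≡⟨ ^-distrib-* c (fromℕ D) 3 ⟨
        (c * fromℕ D) ^ 3              ≡⟨ cong (_^ 3) (fromℕ-* (2 ℕ.* R) D) ⟨
        fromℕ (2 ℕ.* R ℕ.* D) ^ 3      ≡⟨ fromℕ-cube (2 ℕ.* R ℕ.* D) ⟨
        fromℕ (cube (2 ℕ.* R ℕ.* D))   ≤⟨ fromℕ-mono-≤ (ℕ.≤-trans big n≤n²) ⟩
        fromℕ (n ℕ.* n)                ≡⟨ fromℕ-square n ⟩
        x ^ 2                          ≡⟨ ℚ.*-identityˡ (x ^ 2) ⟨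
        1ℚ ^ 3 * x ^ 2                 ∎))
        where
        n≤n² : n ℕ.≤ n ℕ.* n
        n≤n² = ℕ.m≤m*n n n {{ℕ.nonTrivial⇒nonZero n}}

    upper : ∀ w → 0 ℕ.< w → n ℕ.* n ℕ.≤ cube w → 512 ℕ.≤ n → (R ℕ.* D ℕ.+ (R ℕ.+ r)) ℕ.* w ℕ.≤ n →
      ∀ k → f[_,_]≡_ n p k → k ℕ.≤ (R ℕ.* (R ℕ.* D ℕ.+ (R ℕ.+ r)) ℕ.+ 3) ℕ.* w
    upper w 0<w n²≤w³ 512≤n L≤n k (_ , least) =
      build (Residues.sparse-extremal r n M E L L≤n (ℕ.m+[n∸m]≡n rN≤RM) (rn≤E 512≤n) room)
      where
      -- With L = A w, L² splits into L R D w, which covers 2 E, and L (R + r) w, which covers the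
      -- rounding term L (R + r).
      A = R ℕ.* D ℕ.+ (R ℕ.+ r)
      L = A ℕ.* w
      open ℕ.≤-Reasoning
      room : 2 ℕ.* E ℕ.+ L ℕ.* (R ℕ.+ r) ℕ.≤ L ℕ.* L
      room = begin
        2 ℕ.* E ℕ.+ L ℕ.* (R ℕ.+ r)
          ≤⟨ ℕ.+-mono-≤ (2E≤ w n²≤w³) (ℕ.*-monoʳ-≤ L (ℕ.m≤m*n (R ℕ.+ r) w {{ℕ.>-nonZero 0<w}})) ⟩
        R ℕ.* (D ℕ.* (w ℕ.* w)) ℕ.+ L ℕ.* ((R ℕ.+ r) ℕ.* w)
          ≤⟨ ℕ.+-monoˡ-≤ (L ℕ.* ((R ℕ.+ r) ℕ.* w)) (ℕ.≤-trans (ℕ.≤-reflexive (l₁ R D w)) (ℕ.*-monoˡ-≤ (R ℕ.* D ℕ.* w) w≤L)) ⟩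
        L ℕ.* (R ℕ.* D ℕ.* w) ℕ.+ L ℕ.* ((R ℕ.+ r) ℕ.* w)   ≡⟨ l₂ L (R ℕ.* D) (R ℕ.+ r) w ⟩
        L ℕ.* L                                             ∎
        where
        w≤L : w ℕ.≤ L
        w≤L = ℕ.m≤n*m w A {{ℕ.>-nonZero (ℕ.<-≤-trans (ℕ.s≤s ℕ.z≤n) (ℕ.m≤n+m (R ℕ.+ r) (R ℕ.* D)))}}
        l₁ : ∀ R D w → R ℕ.* (D ℕ.* (w ℕ.* w)) ≡ w ℕ.* (R ℕ.* D ℕ.* w)
        l₁ = ℕ.solve-∀
        l₂ : ∀ L a b w → L ℕ.* (a ℕ.* w) ℕ.+ L ℕ.* (b ℕ.* w) ≡ L ℕ.* ((a ℕ.+ b) ℕ.* w)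
        l₂ = ℕ.solve-∀
      cases : ∀ j → j ℕ.≤ R ℕ.* (A ℕ.* w) ⊎ E ℕ.* (j ℕ.∸ 1) ℕ.≤ r ℕ.* N → j ℕ.≤ (R ℕ.* A ℕ.+ 3) ℕ.* w
      cases j (inj₁ le) = begin
        j                                  ≤⟨ le ⟩
        R ℕ.* (A ℕ.* w)                    ≡⟨ ℕ.*-assoc R A w ⟨
        R ℕ.* A ℕ.* w                      ≤⟨ ℕ.*-monoˡ-≤ w (ℕ.m≤m+n (R ℕ.* A) 3) ⟩
        (R ℕ.* A ℕ.+ 3) ℕ.* w              ∎
      cases j (inj₂ le) = begin
        j                                  ≤⟨ ℕ.m≤n+m∸n j 1 ⟩
        1 ℕ.+ (j ℕ.∸ 1)                    ≤⟨ ℕ.+-mono-≤ 0<w (few w (j ℕ.∸ 1) n²≤w³ le) ⟩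
        3 ℕ.* w                            ≤⟨ ℕ.*-monoˡ-≤ w (ℕ.m≤n+m 3 (R ℕ.* A)) ⟩
        (R ℕ.* A ℕ.+ 3) ℕ.* w              ∎
      conclude : ∀ G → ∣E∣ {n} G ≡ M →
        (∀ m → Full (adj G) N M m → m ℕ.≤ R ℕ.* L ⊎ E ℕ.* (m ℕ.∸ 1) ℕ.≤ r ℕ.* N) →
        (∃[ j ] f[ G ]≡ j) → k ℕ.≤ (R ℕ.* A ℕ.+ 3) ℕ.* w
      conclude G G≡M small (j , fG) = ℕ.≤-trans (least j (G , trans (cong fromℕ G≡M) (sym p≡) , fG))
        (cases j (small j (subst (λ m → Full (adj G) N m j) G≡M (proj₁ (greatest-f G fG)))))
      build : (∃[ G ] ∣E∣ {n} G ≡ M ×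
        (∀ m → Full (adj G) N M m → m ℕ.≤ R ℕ.* L ⊎ E ℕ.* (m ℕ.∸ 1) ℕ.≤ r ℕ.* N)) → k ℕ.≤ (R ℕ.* A ℕ.+ 3) ℕ.* w
      build (G , G≡M , small) = conclude G G≡M small (f-exists G)

  -- From index 1 on, the error 1/(i+1) is at most 1/2 and hence at most w / 2; at index 0 it would
  -- be 1.
  half-below : ∀ {q ρ} w → 1 ℕ.≤ w → IsRoot 3 q ρ → fromℕ w ^ 3 ≤ q → ∀ i → 1 ℕ.≤ i → fromℕ w ≤ two * seq ρ i
  half-below {ρ = ρ} w 1≤w isRoot w³≤q i 1≤i = begin
    v                        ≡⟨ solve 1 (λ v → v := con two :* (v :- con ½ :* v)) refl v ⟩
    two * (v - ½ * v)        ≤⟨ ℚ.*-monoˡ-≤-nonNeg two (ℚ.+-mono-≤ v≤x+η (ℚ.neg-antimono-≤ η≤½v)) ⟩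
    two * (x + η - η)        ≡⟨ solve 3 (λ t x e → t :* (x :+ e :- e) := t :* x) refl two x η ⟩
    two * x                  ∎
    where
    open ℚ.≤-Reasoning
    open IsRoot isRoot
    v = fromℕ w
    x = seq ρ i
    η = + 1 / suc i
    v≤x+η : v ≤ x + η
    v≤x+η = ^-cancel-≤ 2 (ℚ.+-mono-≤ (0≤ρ i) (0≤/ 1 i)) (ℚ.≤-trans w³≤q (ℚ.<⇒≤ (above i)))
    η≤½v : η ≤ ½ * v
    η≤½v = ℚ.≤-trans (/-≤ (+ 1) i (+ 1) 1 (ℤ.+≤+ (ℕ.*-monoʳ-≤ 1 (ℕ.s≤s 1≤i))))
      (subst (_≤ ½ * v) (ℚ.*-identityʳ ½) (ℚ.*-monoˡ-≤-nonNeg ½ (fromℕ-mono-≤ {1} {w} 1≤w)))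

  fromℚ-*ᴿ-≤ᴿ : ∀ c ρ k → (∀ i → c * seq ρ i ≤ fromℕ k) → fromℚ c *ᴿ ρ ≤ᴿ fromℚ (fromℕ k)
  fromℚ-*ᴿ-≤ᴿ c ρ k le ε 0<ε = 0 , λ i _ → ℚ.≤-trans (le i)
    (subst (_≤ fromℕ k + ε) (ℚ.+-identityʳ (fromℕ k)) (ℚ.+-monoʳ-≤ (fromℕ k) (ℚ.<⇒≤ 0<ε)))

  ≤ᴿ-fromℚ-*ᴿ : ∀ c ρ k → (∀ i → 1 ℕ.≤ i → fromℕ k ≤ c * seq ρ i) → fromℚ (fromℕ k) ≤ᴿ fromℚ c *ᴿ ρ
  ≤ᴿ-fromℚ-*ᴿ c ρ k le ε 0<ε = 1 , λ i 1≤i → ℚ.≤-trans (le i 1≤i)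
    (subst (_≤ c * seq ρ i + ε) (ℚ.+-identityʳ (c * seq ρ i)) (ℚ.+-monoʳ-≤ (c * seq ρ i) (ℚ.<⇒≤ 0<ε)))

  0<fromℚ : ∀ {c} → 0ℚ < c → fromℚ 0ℚ <ᴿ fromℚ c
  0<fromℚ {c} 0<c = c , 0<c , 0 , λ _ _ → ℚ.≤-reflexive (ℚ.+-identityˡ c)

  natural : ∀ {q} z → 0ℚ ≤ q → q ≡ z / 1 → ∃[ M ] q ≡ fromℕ M
  natural (+ M)      _   eq = M , eq
  natural -[1+ m ] 0≤q refl = contradiction (ℚ.≤-<-trans 0≤q
    (ℚ.neg-antimono-< (fromℕ-mono-< {0} {suc m} (ℕ.s≤s ℕ.z≤n)))) (ℚ.<-irrefl refl)

  f-positive : ∀ n .{{_ : NonTrivial n}} {p k} → f[_,_]≡_ n p k → 1 ℕ.≤ k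
  f-positive n ((G , _ , fG) , _) = proj₂ (greatest-f G fG) 1 (Full-1 G)

  -- 1 + w is n^(2/3) rounded up.
  cube-root : ∀ n → 2 ℕ.≤ n → ∃[ w ] 1 ℕ.≤ w × cube w ℕ.≤ n ℕ.* n × n ℕ.* n ℕ.≤ cube (suc w) ×
    (∀ A → cube (2 ℕ.* A) ℕ.≤ n → A ℕ.* suc w ℕ.≤ n)
  cube-root n 2≤n with least (λ w → n ℕ.* n ℕ.≤? cube w) (n ℕ.* n , ℕ.≤-trans
      (ℕ.m≤m*n (n ℕ.* n) (n ℕ.* n) {{nz}}) (ℕ.*-monoʳ-≤ (n ℕ.* n) (ℕ.m≤m*n (n ℕ.* n) (n ℕ.* n) {{nz}})))
    where
    nz : NonZero (n ℕ.* n)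
    nz = ℕ.>-nonZero (ℕ.*-mono-< {0} {n} (ℕ.<-≤-trans (ℕ.s≤s ℕ.z≤n) 2≤n) (ℕ.<-≤-trans (ℕ.s≤s ℕ.z≤n) 2≤n))
  ... | zero , le , _ = contradiction (ℕ.≤-trans (ℕ.*-mono-≤ 2≤n 2≤n) le) λ ()
  ... | suc zero , le , _ = contradiction (ℕ.≤-trans (ℕ.*-mono-≤ 2≤n 2≤n) le) λ { (ℕ.s≤s ()) }
  -- The values 0 and 1 are excluded by n² >= 4. If A (1 + w) exceeded `n`, then n < 2 A w, and
  -- cubing gives n³ <= (2A)³ w³ <= n w³ < n³.
  ... | suc w@(suc _) , le , min = w , ℕ.s≤s ℕ.z≤n , ℕ.<⇒≤ w³<n² , le , λ A small → ℕ.≮⇒≥ λ n<Aw →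
      contradiction (begin-strict
        cube n
          ≤⟨ cube-mono (ℕ.≤-trans (ℕ.<⇒≤ n<Aw) (ℕ.*-monoʳ-≤ A 1+w≤2w)) ⟩
        cube (A ℕ.* (2 ℕ.* w))              ≡⟨ ring A w ⟩
        cube (2 ℕ.* A) ℕ.* cube w           ≤⟨ ℕ.*-monoˡ-≤ (cube w) small ⟩
        n ℕ.* cube w
          <⟨ ℕ.*-monoʳ-< n {{ℕ.>-nonZero (ℕ.<-≤-trans (ℕ.s≤s ℕ.z≤n) 2≤n)}} w³<n² ⟩
        cube n                              ∎) (ℕ.<-irrefl refl)
    where
    open ℕ.≤-Reasoning
    w³<n² : cube w ℕ.< n ℕ.* n
    w³<n² = ℕ.≰⇒> λ n²≤w³ → ℕ.<-irrefl refl (min w n²≤w³)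
    1+w≤2w : suc w ℕ.≤ 2 ℕ.* w
    1+w≤2w = ℕ.≤-trans (ℕ.+-monoˡ-≤ w (ℕ.s≤s ℕ.z≤n)) (ℕ.≤-reflexive (cong (w ℕ.+_) (sym (ℕ.+-identityʳ w))))
    ring : ∀ A w → A ℕ.* (2 ℕ.* w) ℕ.* (A ℕ.* (2 ℕ.* w) ℕ.* (A ℕ.* (2 ℕ.* w))) ≡
      2 ℕ.* A ℕ.* (2 ℕ.* A ℕ.* (2 ℕ.* A)) ℕ.* (w ℕ.* (w ℕ.* w))
    ring = ℕ.solve-∀

  half≤r/1+r : ∀ r .{{_ : NonZero r}} → ½ ≤ + r / suc r
  half≤r/1+r r@(suc _) = /-≤ (+ 1) 1 (+ r) r (ℤ.+≤+ (begin
    1 ℕ.* suc r        ≡⟨ ℕ.*-identityˡ (suc r) ⟩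
    suc r              ≤⟨ ℕ.+-monoˡ-≤ r (ℕ.s≤s ℕ.z≤n) ⟩
    r ℕ.+ r            ≡⟨ cong (r ℕ.+_) (sym (ℕ.+-identityʳ r)) ⟩
    2 ℕ.* r            ≡⟨ ℕ.*-comm 2 r ⟩
    r ℕ.* 2            ∎))
    where open ℕ.≤-Reasoning

  -- The order of magnitude of f at p = r/(r+1) + c n^(-2/3)

  module _ (c : ℝ) (1≤c : fromℚ 1ℚ ≤ᴿ c) (r : ℕ) .{{_ : NonZero r}}
    (B : ℚ) (0<B : 0ℚ < B) (K : ℕ) (c<B : ∀ i → K ℕ.≤ i → ℚ.∣ seq c i ∣ < B)
    (D : ℕ) (B+1≤D : B + 1ℚ ≤ fromℕ D)
    (a : ℚ) (a≡ : a * fromℕ (2 ℕ.* suc r) ≡ 1ℚ) (0<a : 0ℚ < a) (a≤1 : a ≤ 1ℚ)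
    (n : ℕ) .{{_ : NonTrivial n}} (512≤n : 512 ℕ.≤ n) (n-large₁ : cube (2 ℕ.* suc r ℕ.* D) ℕ.≤ n)
    (n-large₂ : cube (2 ℕ.* (suc r ℕ.* D ℕ.+ (suc r ℕ.+ r))) ℕ.≤ n)
    (p : ℚ) (p≈ : fromℚ p ≈ᴿ fromℚ (+ r / suc r) +ᴿ c *ᴿ fromℕ n ^ᴿ (-[1+ 1 ] / 3))
    where

    private
      Γ : ℕ
      Γ = suc r ℕ.* (suc r ℕ.* D ℕ.+ (suc r ℕ.+ r)) ℕ.+ 3
      x = fromℕ n
      y = inv x
      0≤x : 0ℚ ≤ x
      0≤x = fromℕ-mono-≤ {0} {n} ℕ.z≤n
      1≤n : 1 ℕ.≤ n
      1≤n = ℕ.≤-trans (ℕ.s≤s ℕ.z≤n) 512≤n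
      0<x : 0ℚ < x
      0<x = fromℕ-mono-< {0} {n} 1≤n
      0≤y : 0ℚ ≤ y
      0≤y = inv-nonNeg 0≤x
      yx≡1 : y * x ≡ 1ℚ
      yx≡1 = inv-inverse 0<x
      0<y : 0ℚ < y
      0<y = ℚ.≰⇒> λ y≤0 → ℚ.<-irrefl refl (ℚ.<-≤-trans (ℚ.positive⁻¹ 1ℚ)
        (subst₂ _≤_ yx≡1 (ℚ.*-zeroˡ x) (ℚ.*-monoʳ-≤-nonNeg x {{ℚ.nonNegative 0≤x}} y≤0)))
      y≤1 : y ≤ 1ℚ
      y≤1 = subst₂ _≤_ (ℚ.*-identityʳ y) yx≡1 (ℚ.*-monoˡ-≤-nonNeg y {{ℚ.nonNegative 0≤y}} (fromℕ-mono-≤ {1} {n} 1≤n))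
      δ = p - + r / suc r

      bounds : y ^ 2 < (two * (p - + r / suc r)) ^ 3 ×
        (p - + r / suc r) ^ 3 ≤ (B + 1ℚ) ^ 3 * y ^ 2 × 0ℚ ≤ p - + r / suc r
      bounds = excess-bounds c (fromℕ n ^ᴿ (-[1+ 1 ] / 3)) p (+ r / suc r) 0<y y≤1
        (^ᴿ-isRoot (fromℕ n) (-[1+ 1 ] / 3) (^-nonNeg 2 0≤y)) 1≤c 0<B K c<B p≈
      δ-large = proj₁ bounds
      0≤δ = proj₂ (proj₂ bounds)
      δ-small : (p - + r / suc r) ^ 3 ≤ fromℕ D ^ 3 * inv (fromℕ n) ^ 2
      δ-small = ℚ.≤-trans (proj₁ (proj₂ bounds)) (ℚ.*-monoʳ-≤-nonNeg (y ^ 2) {{ℚ.nonNegative (^-nonNeg 2 0≤y)}}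
        (^-mono 3 (ℚ.+-mono-≤ (ℚ.<⇒≤ 0<B) 0≤1) B+1≤D))

    ½≤p : ½ ≤ p
    ½≤p = ℚ.≤-trans (half≤r/1+r r) (subst₂ _≤_ (ℚ.+-identityʳ (+ r / suc r))
      (solve 2 (λ s p → s :+ (p :- s) := p) refl (+ r / suc r) p) (ℚ.+-monoʳ-≤ (+ r / suc r) 0≤δ))

    private
      y²<p³ : inv (fromℕ n) ^ 2 < p ^ 3
      -- The lower bound applies because p >= 1/2 and n² > 8.
      y²<p³ = ℚ.<-≤-trans (ℚ.*-cancelʳ-<-nonNeg (x ^ 2) {{ℚ.nonNegative (^-nonNeg 2 0≤x)}} (begin-strict
        y ^ 2 * x ^ 2              ≡⟨ ^-distrib-* y x 2 ⟨
        (y * x) ^ 2                ≡⟨ cong (_^ 2) yx≡1 ⟩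
        + 1 / 8 * fromℕ 8          <⟨ ℚ.*-monoʳ-<-pos (+ 1 / 8) (fromℕ-mono-< {8} {n ℕ.* n}
                                        (ℕ.≤-trans (ℕ.≤-trans (ℕ.m≤m+n 9 503) 512≤n) (ℕ.m≤m*n n n {{ℕ.>-nonZero 1≤n}}))) ⟩
        + 1 / 8 * fromℕ (n ℕ.* n)  ≡⟨ cong (+ 1 / 8 *_) (fromℕ-square n) ⟩
        ½ ^ 3 * x ^ 2              ∎)) (^-mono 3 (ℚ.nonNegative⁻¹ ½) ½≤p)
        where open ℚ.≤-Reasoning

    module _ (M : ℕ) (p≡ : p * fromℕ (n C 2) ≡ fromℕ M) where

      private
        a≤1-p : a ≤ 1ℚ - p
        a≤1-p = begin
          a                                          ≡⟨ ℚ.*-identityʳ a ⟨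
          a * 1ℚ
            ≤⟨ ℚ.*-monoˡ-≤-nonNeg a {{ℚ.nonNegative (ℚ.<⇒≤ 0<a)}}
                                                          (1≤2R[1-p] r n p M D p≡ 0≤δ δ-large δ-small n-large₁) ⟩
          a * (fromℕ (2 ℕ.* suc r) * (1ℚ - p))       ≡⟨ ℚ.*-assoc a (fromℕ (2 ℕ.* suc r)) (1ℚ - p) ⟨
          a * fromℕ (2 ℕ.* suc r) * (1ℚ - p)         ≡⟨ cong (_* (1ℚ - p)) a≡ ⟩
          1ℚ * (1ℚ - p)                              ≡⟨ ℚ.*-identityˡ (1ℚ - p) ⟩
          1ℚ - p                                     ∎
          where open ℚ.≤-Reasoning
        p<1 : p < 1ℚ
        p<1 = subst₂ _<_ (ℚ.+-identityʳ p) (solve 1 (λ p → p :+ (con 1ℚ :- p) := con 1ℚ) refl p)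
          (ℚ.+-monoʳ-< p (ℚ.<-≤-trans 0<a a≤1-p))
        -- The rational `a` stands in for (1-p)^(2/3): a <= 1 gives a³ <= a² <= (1-p)², so no root
        -- of 1 - p has to be taken.
        a³≤ : a ^ 3 ≤ (1ℚ - p) ^ 2
        a³≤ = ℚ.≤-trans (subst (a ^ 3 ≤_) (ℚ.*-identityˡ (a ^ 2))
          (ℚ.*-monoʳ-≤-nonNeg (a ^ 2) {{ℚ.nonNegative (^-nonNeg 2 (ℚ.<⇒≤ 0<a))}} a≤1)) (^-mono 2 (ℚ.<⇒≤ 0<a) a≤1-p)

      -- Below, a ρ / 4 <= k + 1 <= 2 k turns the additive 1 into a factor 1/2, using k >= 1. Above,
      -- k <= Γ (1 + w) <= 2 Γ w and w <= 2 ρ give the factor 4 Γ.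
      order-Θ : ∀ ρ → IsRoot 3 (fromℕ n ^ 2) ρ → ∃ λ k → (f[_,_]≡_ n p k) ×
        (∀ i → ½ * (+ 1 / 4 * a) * seq ρ i ≤ fromℕ k) ×
        (∀ i → 1 ℕ.≤ i → fromℕ k ≤ fromℕ (4 ℕ.* Γ) * seq ρ i)
      order-Θ ρ isRoot = conclude (f-defined n p M p≡ (ℚ.<⇒≤ p<1)) (cube-root n (ℕ.≤-trans (ℕ.s≤s (ℕ.s≤s ℕ.z≤n)) 512≤n))
        where
        open IsRoot isRoot
        conclude : ∃ (f[_,_]≡_ n p) → (∃[ w ] 1 ℕ.≤ w × cube w ℕ.≤ n ℕ.* n × n ℕ.* n ℕ.≤ cube (suc w) ×
            (∀ A → cube (2 ℕ.* A) ℕ.≤ n → A ℕ.* suc w ℕ.≤ n)) →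
          ∃ λ k → (f[_,_]≡_ n p k) × (∀ i → ½ * (+ 1 / 4 * a) * seq ρ i ≤ fromℕ k) ×
            (∀ i → 1 ℕ.≤ i → fromℕ k ≤ fromℕ (4 ℕ.* Γ) * seq ρ i)
        conclude (k , fk) (w , 1≤w , w³≤n² , n²≤w³ , fits) = k , fk , low , high
          where
          open ℚ.≤-Reasoning
          k+1≤2k : suc k ℕ.≤ 2 ℕ.* k
          k+1≤2k = ℕ.≤-trans (ℕ.+-monoˡ-≤ k (f-positive n {p} {k} fk)) (ℕ.≤-reflexive (cong (k ℕ.+_) (sym (ℕ.+-identityʳ k))))
          low : ∀ i → ½ * (+ 1 / 4 * a) * seq ρ i ≤ fromℕ k
          low i = begin
            ½ * (+ 1 / 4 * a) * seq ρ i          ≡⟨ ℚ.*-assoc ½ (+ 1 / 4 * a) (seq ρ i) ⟩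
            ½ * (+ 1 / 4 * a * seq ρ i)
              ≤⟨ ℚ.*-monoˡ-≤-nonNeg ½ (roots-≤ a (seq ρ i) (ℚ.<⇒≤ 0<a) (0≤ρ i) (fromℕ-mono-≤ {0} {suc k} ℕ.z≤n) a³≤ (below i)
                   (f-lower n p M p≡ p<1 y²<p³ k fk)) ⟩
            ½ * fromℕ (suc k)                    ≤⟨ ℚ.*-monoˡ-≤-nonNeg ½ (fromℕ-mono-≤ k+1≤2k) ⟩
            ½ * fromℕ (2 ℕ.* k)                  ≡⟨ cong (½ *_) (fromℕ-* 2 k) ⟩
            ½ * (two * fromℕ k)
              ≡⟨ solve 1 (λ k → con ½ :* (con two :* k) := k) refl (fromℕ k) ⟩
            fromℕ k                              ∎
          w+1≤2w : suc w ℕ.≤ 2 ℕ.* w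
          w+1≤2w = ℕ.≤-trans (ℕ.+-monoˡ-≤ w 1≤w) (ℕ.≤-reflexive (cong (w ℕ.+_) (sym (ℕ.+-identityʳ w))))
          k≤ : k ℕ.≤ Γ ℕ.* (2 ℕ.* w)
          k≤ = ℕ.≤-trans (upper r n p M D p≡ 0≤δ δ-large δ-small (suc w) (ℕ.s≤s ℕ.z≤n) n²≤w³ 512≤n
            (fits (suc r ℕ.* D ℕ.+ (suc r ℕ.+ r)) n-large₂) k fk) (ℕ.*-monoʳ-≤ Γ w+1≤2w)
          w≤2ρ : ∀ i → 1 ℕ.≤ i → fromℕ w ≤ two * seq ρ i
          w≤2ρ = half-below {ρ = ρ} w 1≤w isRoot (subst₂ _≤_ (fromℕ-cube w) (fromℕ-square n) (fromℕ-mono-≤ w³≤n²))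
          high : ∀ i → 1 ℕ.≤ i → fromℕ k ≤ fromℕ (4 ℕ.* Γ) * seq ρ i
          high i 1≤i = begin
            fromℕ k                              ≤⟨ fromℕ-mono-≤ k≤ ⟩
            fromℕ (Γ ℕ.* (2 ℕ.* w))
              ≡⟨ trans (fromℕ-* Γ (2 ℕ.* w)) (cong (fromℕ Γ *_) (fromℕ-* 2 w)) ⟩
            fromℕ Γ * (two * fromℕ w)
              ≤⟨ ℚ.*-monoˡ-≤-nonNeg (fromℕ Γ) {{fromℕ-nonNeg Γ}} (ℚ.*-monoˡ-≤-nonNeg two (w≤2ρ i 1≤i)) ⟩
            fromℕ Γ * (two * (two * seq ρ i))
              ≡⟨ solve 2 (λ Γ x → Γ :* (con two :* (con two :* x)) := con (fromℕ 4) :* Γ :* x) refl (fromℕ Γ) (seq ρ i) ⟩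
            fromℕ 4 * fromℕ Γ * seq ρ i          ≡⟨ cong (_* seq ρ i) (fromℕ-* 4 Γ) ⟨
            fromℕ (4 ℕ.* Γ) * seq ρ i            ∎

  Tight : ℝ → (r : ℕ) .{{_ : NonZero r}} → Set
  Tight c r =
    ∃[ C₁ ] ∃[ C₂ ] ∃[ n₀ ]
      (fromℚ 0ℚ <ᴿ C₁) × (fromℚ 0ℚ <ᴿ C₂) ×
      ( (n : ℕ) .{{_ : NonTrivial n}} → n₀ ℕ.≤ n → (p : ℚ) →
        fromℚ p ≈ᴿ fromℚ (+ r / suc r) +ᴿ c *ᴿ fromℕ n ^ᴿ (-[1+ 1 ] / 3) →
        (∃[ z ] p * fromℕ (n C 2) ≡ z / 1) →
        ∃ λ k → (f[_,_]≡_ n p k) ×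
          (C₁ *ᴿ fromℕ n ^ᴿ (+ 2 / 3) ≤ᴿ fromℚ (fromℕ k)) ×
          (fromℚ (fromℕ k) ≤ᴿ C₂ *ᴿ fromℕ n ^ᴿ (+ 2 / 3)) )

  tight : (c : ℝ) → fromℚ 1ℚ ≤ᴿ c → (r : ℕ) .{{_ : NonZero r}} →
    (∃[ B ] 0ℚ < B × ∃[ K ] ∀ i → K ℕ.≤ i → ℚ.∣ seq c i ∣ < B) → Tight c r
  tight c 1≤c r (B , 0<B , K , c<B) =
    -- The threshold is a sum so as to dominate each condition: `n₁` keeps δ at most 1/(2R), `n₂`
    -- makes the `L` low vertices fit into `n`, and 512 serves `rn≤E`.
    fromℚ (½ * (+ 1 / 4 * a)) , fromℚ (fromℕ (4 ℕ.* Γ)) , n₁ ℕ.+ n₂ ℕ.+ 512 ,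
    0<fromℚ (*-pos (ℚ.positive⁻¹ ½) (*-pos (ℚ.positive⁻¹ (+ 1 / 4)) 0<a)) ,
    0<fromℚ (fromℕ-mono-< {0} {4 ℕ.* Γ} (ℕ.*-mono-< {0} {4} (ℕ.s≤s ℕ.z≤n) (ℕ.<-≤-trans (ℕ.s≤s ℕ.z≤n) (ℕ.m≤n+m 3 (suc r ℕ.* A))))) ,
    bound
    where
    -- A natural upper bound for B + 1, so that the sizes in the construction are natural numbers.
    D = suc ℤ.∣ ↥ (B + 1ℚ) ∣
    A = suc r ℕ.* D ℕ.+ (suc r ℕ.+ r)
    Γ = suc r ℕ.* A ℕ.+ 3
    n₁ = cube (2 ℕ.* suc r ℕ.* D)
    n₂ = cube (2 ℕ.* A)
    a = + 1 / (2 ℕ.* suc r)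
    a≡ : a * fromℕ (2 ℕ.* suc r) ≡ 1ℚ
    a≡ = /-cancel 1 (2 ℕ.* suc r)
    0<2R : 0ℚ < fromℕ (2 ℕ.* suc r)
    0<2R = fromℕ-mono-< {0} {2 ℕ.* suc r} (ℕ.s≤s ℕ.z≤n)
    0<a : 0ℚ < a
    0<a = ℚ.*-cancelʳ-<-nonNeg (fromℕ (2 ℕ.* suc r)) {{ℚ.nonNegative (ℚ.<⇒≤ 0<2R)}}
      (subst₂ _<_ (sym (ℚ.*-zeroˡ (fromℕ (2 ℕ.* suc r)))) (sym a≡) (ℚ.positive⁻¹ 1ℚ))
    a≤1 : a ≤ 1ℚ
    a≤1 = subst₂ _≤_ (ℚ.*-identityʳ a) a≡ (ℚ.*-monoˡ-≤-nonNeg a {{ℚ.nonNegative (ℚ.<⇒≤ 0<a)}}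
      (fromℕ-mono-≤ {1} {2 ℕ.* suc r} (ℕ.s≤s ℕ.z≤n)))
    bound : (n : ℕ) .{{_ : NonTrivial n}} → n₁ ℕ.+ n₂ ℕ.+ 512 ℕ.≤ n → (p : ℚ) →
      fromℚ p ≈ᴿ fromℚ (+ r / suc r) +ᴿ c *ᴿ fromℕ n ^ᴿ (-[1+ 1 ] / 3) →
      (∃[ z ] p * fromℕ (n C 2) ≡ z / 1) →
      ∃ λ k → (f[_,_]≡_ n p k) ×
        (fromℚ (½ * (+ 1 / 4 * a)) *ᴿ fromℕ n ^ᴿ (+ 2 / 3) ≤ᴿ fromℚ (fromℕ k)) ×
        (fromℚ (fromℕ k) ≤ᴿ fromℚ (fromℕ (4 ℕ.* Γ)) *ᴿ fromℕ n ^ᴿ (+ 2 / 3))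
    bound n large p p≈ (z , p≡z) = convert (order-Θ c 1≤c r B 0<B K c<B D (ℚ.<⇒≤ (q<∣num∣+1 (B + 1ℚ)))
        a a≡ 0<a a≤1 n 512≤n n₁≤n n₂≤n p p≈ (proj₁ M) (proj₂ M)
        (fromℕ n ^ᴿ (+ 2 / 3)) (^ᴿ-isRoot (fromℕ n) (+ 2 / 3) (^-nonNeg 2 (fromℕ-mono-≤ {0} {n} ℕ.z≤n))))
      where
      512≤n : 512 ℕ.≤ n
      512≤n = ℕ.m+n≤o⇒n≤o (n₁ ℕ.+ n₂) large
      n₁≤n : n₁ ℕ.≤ n
      n₁≤n = ℕ.m+n≤o⇒m≤o n₁ (ℕ.m+n≤o⇒m≤o (n₁ ℕ.+ n₂) large)
      n₂≤n : n₂ ℕ.≤ n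
      n₂≤n = ℕ.m+n≤o⇒n≤o n₁ (ℕ.m+n≤o⇒m≤o (n₁ ℕ.+ n₂) large)
      -- Nonnegativity turns the integer `z` into an edge number in ℕ; it comes from p >= r/(r+1) >=
      -- 1/2.
      0≤p : 0ℚ ≤ p
      0≤p = ℚ.≤-trans (ℚ.nonNegative⁻¹ ½) (½≤p c 1≤c r B 0<B K c<B D (ℚ.<⇒≤ (q<∣num∣+1 (B + 1ℚ)))
        a a≡ 0<a a≤1 n 512≤n n₁≤n n₂≤n p p≈)
      M : ∃[ M ] p * fromℕ (n C 2) ≡ fromℕ M
      M = natural z (*-nonNeg 0≤p (fromℕ-mono-≤ {0} {n C 2} ℕ.z≤n)) p≡z
      convert : (∃ λ k → (f[_,_]≡_ n p k) ×
        (∀ i → ½ * (+ 1 / 4 * a) * seq (fromℕ n ^ᴿ (+ 2 / 3)) i ≤ fromℕ k) ×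
        (∀ i → 1 ℕ.≤ i → fromℕ k ≤ fromℕ (4 ℕ.* Γ) * seq (fromℕ n ^ᴿ (+ 2 / 3)) i)) → _
      convert (k , fk , low , high) = k , fk ,
        fromℚ-*ᴿ-≤ᴿ (½ * (+ 1 / 4 * a)) (fromℕ n ^ᴿ (+ 2 / 3)) k low ,
        ≤ᴿ-fromℚ-*ᴿ (fromℕ (4 ℕ.* Γ)) (fromℕ n ^ᴿ (+ 2 / 3)) k high

open import Defs
open import Data.Integer.Base using (ℤ; +_; -[1+_])
open import Data.Nat.Base using (ℕ; suc; NonZero; NonTrivial; _≤_)
open import Data.Nat.Combinatorics using (_C_)
open import Data.Product.Base as Product using (_×_; ∃-syntax)
open import Data.Rational.Base using (ℚ; 0ℚ; 1ℚ; _/_; _*_; _-_)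
open import Relation.Binary.PropositionalEquality using (_≡_)

theorem1 : ( (n : ℕ) .{{_ : NonTrivial n}} (p : ℚ) →
    (∃[ m ] p * fromℕ (n C 2) ≡ fromℕ m) →
    fromℕ n ^ᴿ (-[1+ 1 ] / 3) <ᴿ fromℚ p →
    fromℚ p <ᴿ fromℚ 1ℚ -ᴿ fromℕ n ^ᴿ (-[1+ 0 ] / 7) →
    ∃[ k ] (f[ n , p ]≡ k) ×
    (fromℚ (+ 1 / 4) *ᴿ (1ℚ - p) ^ᴿ (+ 2 / 3) *ᴿ fromℕ n ^ᴿ (+ 2 / 3) -ᴿ fromℚ 1ℚ
    ≤ᴿ fromℚ (fromℕ k)) )
    ×
    ( (c : ℝ) → fromℚ 1ℚ ≤ᴿ c → (r : ℕ) .{{_ : NonZero r}} →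
    ∃[ C₁ ] ∃[ C₂ ] ∃[ n₀ ]
    (fromℚ 0ℚ <ᴿ C₁) × (fromℚ 0ℚ <ᴿ C₂) ×
    ( (n : ℕ) .{{_ : NonTrivial n}} → n₀ ≤ n → (p : ℚ) →
    fromℚ p ≈ᴿ fromℚ (+ r / suc r) +ᴿ c *ᴿ fromℕ n ^ᴿ (-[1+ 1 ] / 3) →
    (∃[ z ] p * fromℕ (n C 2) ≡ z / 1) →
    ∃[ k ] (f[ n , p ]≡ k) ×
    (C₁ *ᴿ fromℕ n ^ᴿ (+ 2 / 3) ≤ᴿ fromℚ (fromℕ k)) ×
    (fromℚ (fromℕ k) ≤ᴿ C₂ *ᴿ fromℕ n ^ᴿ (+ 2 / 3)) ) )
theorem1 = Reals.lower-bound Product., λ c 1≤c r → Reals.tight c 1≤c r (cauchy-bounded (cauchy c))
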